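{- Let $S$ be a finite (possibly empty) set of rational primes. Then the action of $\Gamma_S$ on $\mathfrak{X}_S$ is vertex transitive: for every vertex $v$ of $\mathfrak{X}_S$ there is $\gamma\in\Gamma_S$ with $\gamma\, v_0 = v$. Consequently the action of $\overline{\Gamma}_S$ on $\mathfrak{X}_S$ is vertex transitive as well.
   Context: Let $\mathcal{H}$ be the quaternion algebra over $\mathbb{Q}$ with basis $1, I, J, IJ$ and relations $I^2=J^2=-1$, $IJ=-JI$, with reduced norm $\mathrm{Nm}(a+bI+cJ+dIJ)=a^2+b^2+c^2+d^2$. Let $\mathcal{O}$ be the Hurwitz order, the $\mathbb{Z}$-span of $1, I, J, \tfrac12(1+I+J+IJ)$. For a finite set $S$ of primes, let $\mathbb{Z}_S=\mathbb{Z}[1/p : p\in S]$, $m_S=\prod_{p\in S}p$, $\mathcal{O}_S=\mathcal{O}\otimes_{\mathbb{Z}}\mathbb{Z}_S$, $\Gamma_S=\mathcal{O}_S^*$ (the $S$-unit group), and $\overline{\Gamma}_S=\Gamma_S/\mathbb{Z}_S^*$ (units modulo central scalars). For each odd prime $p$ fix an isomorphism $\mathcal{H}\otimes_{\mathbb{Q}}\mathbb{Q}_p\cong \mathrm{M}_2(\mathbb{Q}_p)$ carrying $\mathcal{O}\otimes_{\mathbb{Z}}\mathbb{Z}_p$ onto $\mathrm{M}_2(\mathbb{Z}_p)$; let $\mathfrak{X}_p$ be the Bruhat–Tits tree of $\mathrm{PGL}_2(\mathbb{Q}_p)$ (vertices are homothety classes of $\mathbb{Z}_p$-lattices in $\mathbb{Q}_p^2$,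 two classes adjacent when representatives $L'\subset L$ satisfy $L/L'\cong \mathbb{Z}/p$), on which $\Gamma_S$ acts through $\mathcal{H}^*\subset \mathrm{GL}_2(\mathbb{Q}_p)$, and let $v_{0,p}$ be the class of $\mathbb{Z}_p\oplus\mathbb{Z}_p$. For $p=2$, let $\mathfrak{X}_2$ be a single point $v_{0,2}$ with trivial action. Put $\mathfrak{X}_S=\prod_{p\in S}\mathfrak{X}_p$ with the diagonal action of $\Gamma_S$ (scalars act trivially, so $\overline{\Gamma}_S$ acts); a vertex of $\mathfrak{X}_S$ is a tuple of vertices of the factors, and $v_0=(v_{0,p})_{p\in S}$. -}

module Defs where

open import Algebra.Bundles using (Group; Monoid; CommutativeRing; RawRing)
import Algebra.Solver.Ring.NaturalCoefficients.Default as NatSolver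
import Algebra.Properties.Ring as RingProperties
open import Algebra.Morphism.Structures using (module RingMorphisms)
open RingMorphisms using (IsRingHomomorphism; IsRingIsomorphism)
open import Data.Integer.Base as ℤ using (ℤ; +_)
import Data.Integer.Divisibility.Signed as ℤ
import Data.Integer.Properties as ℤ
import Data.Integer.Solver as ℤ
open import Data.List.Base using (List)
open import Data.List.Membership.Propositional using (_∈_)
open import Data.List.Relation.Unary.All as All using (All)
open import Data.List.Relation.Unary.Unique.Propositional using (Unique)
open import Data.Nat.Base as ℕ using (ℕ; zero; suc)
import Data.Nat.Divisibility as ℕ
import Data.Nat.Properties as ℕ
open import Data.Nat.Primality using (Prime; prime⇒nonZero; prime⇒nonTrivial; euclidsLemma)
open import Data.Product.Base using (_×_; _,_; proj₁; proj₂; ∃)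
open import Data.Rational.Base as ℚ using (ℚ; mkℚ; 0ℚ; 1ℚ; ½; toℚᵘ)
import Data.Rational.Properties as ℚ
import Data.Rational.Solver as ℚ
import Data.Rational.Unnormalised.Base as ℚᵘ
open import Data.Sum.Base using (inj₁; inj₂)
open import Data.Unit.Base using (⊤; tt)
open import Function.Bundles using (_⇔_; mk⇔; Equivalence)
open import Level using (0ℓ; _⊔_)
open import Relation.Binary.Bundles using (Setoid)
open import Relation.Binary.Definitions using (Reflexive; Symmetric; Transitive)
open import Relation.Binary.PropositionalEquality
  using (_≡_; _≢_; refl; sym; trans; cong; cong₂; subst)
  renaming (setoid to ≡-setoid)
import Relation.Binary.Reasoning.Setoid as SetoidReasoning
open import Relation.Nullary using (¬_; Dec; yes; no; contradiction)
open import Relation.Unary using (Pred)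

record Action {g ℓ x ℓ′} (G : Group g ℓ) (X : Setoid x ℓ′) : Set (g ⊔ ℓ ⊔ x ⊔ ℓ′) where
  private
    module G = Group G
    module X = Setoid X
  infixr 5 _▷_
  field
    _▷_        : G.Carrier → X.Carrier → X.Carrier
    ▷-cong     : ∀ {g h x y} → g G.≈ h → x X.≈ y → (g ▷ x) X.≈ (h ▷ y)
    ▷-identity : ∀ x → (G.ε ▷ x) X.≈ x
    ▷-assoc    : ∀ g h x → ((g G.∙ h) ▷ x) X.≈ (g ▷ h ▷ x)

TransitiveFrom : ∀ {g ℓ x ℓ′} {G : Group g ℓ} {X : Setoid x ℓ′} →
                 Action G X → Setoid.Carrier X → Set _
TransitiveFrom {G = G} {X = X} A x₀ =
  ∀ x → ∃ λ (γ : Group.Carrier G) → Setoid._≈_ X (Action._▷_ A γ x₀) x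

module _ {c ℓ} (M : Monoid c ℓ) where
  open Monoid M

  record Unit : Set (c ⊔ ℓ) where
    field
      val inv : Carrier
      inverseˡ : inv ∙ val ≈ ε
      inverseʳ : val ∙ inv ≈ ε

  open Unit

  private
    inv-unique : ∀ u v → val u ≈ val v → inv u ≈ inv v
    inv-unique u v eq = begin
      inv u                     ≈⟨ identityʳ _ ⟨
      inv u ∙ ε                 ≈⟨ ∙-congˡ (inverseʳ v) ⟨
      inv u ∙ (val v ∙ inv v)   ≈⟨ assoc _ _ _ ⟨
      (inv u ∙ val v) ∙ inv v   ≈⟨ ∙-congʳ (∙-congˡ eq) ⟨
      (inv u ∙ val u) ∙ inv v   ≈⟨ ∙-congʳ (inverseˡ u) ⟩
      ε ∙ inv v                 ≈⟨ identityˡ _ ⟩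
      inv v                     ∎
      where open SetoidReasoning setoid

    cancel : ∀ a b c d → b ∙ c ≈ ε → a ∙ d ≈ ε → (a ∙ b) ∙ (c ∙ d) ≈ ε
    cancel a b c d bc ad = begin
      (a ∙ b) ∙ (c ∙ d)   ≈⟨ assoc _ _ _ ⟩
      a ∙ (b ∙ (c ∙ d))   ≈⟨ ∙-congˡ (assoc _ _ _) ⟨
      a ∙ ((b ∙ c) ∙ d)   ≈⟨ ∙-congˡ (∙-congʳ bc) ⟩
      a ∙ (ε ∙ d)         ≈⟨ ∙-congˡ (identityˡ _) ⟩
      a ∙ d               ≈⟨ ad ⟩
      ε                   ∎
      where open SetoidReasoning setoid

  unitGroup : Group (c ⊔ ℓ) ℓ
  unitGroup = record
    { Carrier = Unit
    ; _≈_     = λ u v → val u ≈ val v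
    ; _∙_     = λ u v → record
      { val      = val u ∙ val v
      ; inv      = inv v ∙ inv u
      ; inverseˡ = cancel _ _ _ _ (inverseˡ u) (inverseˡ v)
      ; inverseʳ = cancel _ _ _ _ (inverseʳ v) (inverseʳ u)
      }
    ; ε       = record { val = ε ; inv = ε ; inverseˡ = identityˡ ε ; inverseʳ = identityˡ ε }
    ; _⁻¹     = λ u → record
      { val = inv u ; inv = val u ; inverseˡ = inverseʳ u ; inverseʳ = inverseˡ u }
    ; isGroup = record
      { isMonoid = record
        { isSemigroup = record
          { isMagma = record
            { isEquivalence = record
              { refl = Monoid.refl M ; sym = Monoid.sym M ; trans = Monoid.trans M }
            ; ∙-cong = ∙-cong
            }
          ; assoc = λ u v w → assoc (val u) (val v) (val w)
          }
        ; identity = (λ u → identityˡ (val u)) , (λ u → identityʳ (val u))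
        }
      ; inverse = inverseˡ , inverseʳ
      ; ⁻¹-cong = λ {u} {v} → inv-unique u v
      }
    }

-- ℋ for A = ℚ, and ℋ ⊗ A for a ℚ-algebra A, in the basis 1, I, J, IJ.

record Quaternion {c} (A : Set c) : Set c where
  no-eta-equality
  constructor quat
  field
    re im jm km : A

open Quaternion

mapQ : ∀ {a b} {A : Set a} {B : Set b} → (A → B) → Quaternion A → Quaternion B
mapQ f x .re = f (re x)
mapQ f x .im = f (im x)
mapQ f x .jm = f (jm x)
mapQ f x .km = f (km x)

module Quaternions {c ℓ} (R : RawRing c ℓ) where
  open RawRing R

  infix 4 _≋_
  record _≋_ (x y : Quaternion Carrier) : Set ℓ where
    constructor mk≋
    field
      re≈ : re x ≈ re y
      im≈ : im x ≈ im y
      jm≈ : jm x ≈ jm y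
      km≈ : km x ≈ km y

  infixl 7 _·_
  _·_ : Quaternion Carrier → Quaternion Carrier → Quaternion Carrier
  (x · y) .re = re x * re y + - (im x * im y) + - (jm x * jm y) + - (km x * km y)
  (x · y) .im = re x * im y + im x * re y + jm x * km y + - (km x * jm y)
  (x · y) .jm = re x * jm y + - (im x * km y) + jm x * re y + km x * im y
  (x · y) .km = re x * km y + im x * jm y + - (jm x * im y) + km x * re y

  infixl 6 _⊕_
  _⊕_ : Quaternion Carrier → Quaternion Carrier → Quaternion Carrier
  (x ⊕ y) .re = re x + re y
  (x ⊕ y) .im = im x + im y
  (x ⊕ y) .jm = jm x + jm y
  (x ⊕ y) .km = km x + km y

  infixr 8 _•_
  _•_ : Carrier → Quaternion Carrier → Quaternion Carrier
  (r • x) .re = r * re x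
  (r • x) .im = r * im x
  (r • x) .jm = r * jm x
  (r • x) .km = r * km x

  1q : Quaternion Carrier
  1q = quat 1# 0# 0# 0#

  quaternionRing : RawRing c ℓ
  quaternionRing = record
    { Carrier = Quaternion Carrier
    ; _≈_     = _≋_
    ; _+_     = _⊕_
    ; _*_     = _·_
    ; -_      = mapQ (-_)
    ; 0#      = quat 0# 0# 0# 0#
    ; 1#      = 1q
    }

  data Span (A : Pred Carrier ℓ) (e₀ e₁ e₂ e₃ : Quaternion Carrier)
            (x : Quaternion Carrier) : Set (c ⊔ ℓ) where
    span : ∀ c₀ c₁ c₂ c₃ → A c₀ → A c₁ → A c₂ → A c₃ →
           x ≋ c₀ • e₀ ⊕ c₁ • e₁ ⊕ c₂ • e₂ ⊕ c₃ • e₃ →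
           Span A e₀ e₁ e₂ e₃ x

record Matrix {c} (A : Set c) : Set c where
  no-eta-equality
  constructor mat
  field
    a₁₁ a₁₂ a₂₁ a₂₂ : A

record Vector {c} (A : Set c) : Set c where
  no-eta-equality
  constructor vec
  field
    x₁ x₂ : A

module Matrices {c ℓ} (R : RawRing c ℓ) where
  open RawRing R
  open Matrix
  open Vector

  infix 4 _≋_ _≋ᵥ_
  record _≋_ (M N : Matrix Carrier) : Set ℓ where
    constructor mk≋
    field
      ₁₁≈ : a₁₁ M ≈ a₁₁ N
      ₁₂≈ : a₁₂ M ≈ a₁₂ N
      ₂₁≈ : a₂₁ M ≈ a₂₁ N
      ₂₂≈ : a₂₂ M ≈ a₂₂ N

  infixl 6 _⊕_
  _⊕_ : Matrix Carrier → Matrix Carrier → Matrix Carrier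
  (M ⊕ N) .a₁₁ = a₁₁ M + a₁₁ N
  (M ⊕ N) .a₁₂ = a₁₂ M + a₁₂ N
  (M ⊕ N) .a₂₁ = a₂₁ M + a₂₁ N
  (M ⊕ N) .a₂₂ = a₂₂ M + a₂₂ N

  infixl 7 _·_
  _·_ : Matrix Carrier → Matrix Carrier → Matrix Carrier
  (M · N) .a₁₁ = a₁₁ M * a₁₁ N + a₁₂ M * a₂₁ N
  (M · N) .a₁₂ = a₁₁ M * a₁₂ N + a₁₂ M * a₂₂ N
  (M · N) .a₂₁ = a₂₁ M * a₁₁ N + a₂₂ M * a₂₁ N
  (M · N) .a₂₂ = a₂₁ M * a₁₂ N + a₂₂ M * a₂₂ N

  ⊖_ : Matrix Carrier → Matrix Carrier
  (⊖ M) .a₁₁ = - a₁₁ M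
  (⊖ M) .a₁₂ = - a₁₂ M
  (⊖ M) .a₂₁ = - a₂₁ M
  (⊖ M) .a₂₂ = - a₂₂ M

  infixr 8 _•_
  _•_ : Carrier → Matrix Carrier → Matrix Carrier
  (r • M) .a₁₁ = r * a₁₁ M
  (r • M) .a₁₂ = r * a₁₂ M
  (r • M) .a₂₁ = r * a₂₁ M
  (r • M) .a₂₂ = r * a₂₂ M

  1ₘ : Matrix Carrier
  1ₘ = mat 1# 0# 0# 1#

  matrixRing : RawRing c ℓ
  matrixRing = record
    { Carrier = Matrix Carrier
    ; _≈_     = _≋_
    ; _+_     = _⊕_
    ; _*_     = _·_
    ; -_      = ⊖_
    ; 0#      = mat 0# 0# 0# 0#
    ; 1#      = 1ₘ
    }

  Entries : Pred Carrier ℓ → Pred (Matrix Carrier) ℓ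
  Entries A M = A (a₁₁ M) × A (a₁₂ M) × A (a₂₁ M) × A (a₂₂ M)

  record _≋ᵥ_ (u v : Vector Carrier) : Set ℓ where
    constructor mk≋
    field
      ₁≈ : x₁ u ≈ x₁ v
      ₂≈ : x₂ u ≈ x₂ v

  infixl 6 _+ᵥ_
  _+ᵥ_ : Vector Carrier → Vector Carrier → Vector Carrier
  (u +ᵥ v) .x₁ = x₁ u + x₁ v
  (u +ᵥ v) .x₂ = x₂ u + x₂ v

  infixr 8 _*ᵥ_
  _*ᵥ_ : Carrier → Vector Carrier → Vector Carrier
  (r *ᵥ v) .x₁ = r * x₁ v
  (r *ᵥ v) .x₂ = r * x₂ v

  0ᵥ : Vector Carrier
  0ᵥ = vec 0# 0#

  infixr 8 _$ᵥ_
  _$ᵥ_ : Matrix Carrier → Vector Carrier → Vector Carrier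
  (M $ᵥ v) .x₁ = a₁₁ M * x₁ v + a₁₂ M * x₂ v
  (M $ᵥ v) .x₂ = a₂₁ M * x₁ v + a₂₂ M * x₂ v

-- Applied below with K = ℚₚ and 𝒪 its subset ℤₚ.
module Lattices (K : CommutativeRing 0ℓ 0ℓ)
                (𝒪 : Pred (CommutativeRing.Carrier K) 0ℓ) where

  open CommutativeRing K hiding (refl; sym; trans)
  private module K = CommutativeRing K
  open Matrices rawRing
  private
    V = Vector Carrier

  record IsBasis (b₁ b₂ : V) : Set where
    no-eta-equality
    field
      independent : ∀ c₁ c₂ → c₁ *ᵥ b₁ +ᵥ c₂ *ᵥ b₂ ≋ᵥ 0ᵥ → c₁ ≈ 0# × c₂ ≈ 0#
      spanning    : ∀ v → ∃ λ c₁ → ∃ λ c₂ → v ≋ᵥ c₁ *ᵥ b₁ +ᵥ c₂ *ᵥ b₂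

  -- The 𝒪-span of a basis of K².  The basis is data, but _∼_ below only
  -- depends on which vectors belong to the lattice.
  record Lattice : Set where
    no-eta-equality
    field
      b₁ b₂   : V
      isBasis : IsBasis b₁ b₂

  open Lattice

  infix 4 _∈ₗ_
  _∈ₗ_ : V → Lattice → Set
  v ∈ₗ L = ∃ λ z₁ → ∃ λ z₂ → 𝒪 z₁ × 𝒪 z₂ × v ≋ᵥ z₁ *ᵥ b₁ L +ᵥ z₂ *ᵥ b₂ L

  infix 4 _∼_
  record _∼_ (L L′ : Lattice) : Set where
    constructor homothety
    field
      factor   : Unit *-monoid
      scales   : ∀ v → v ∈ₗ L′ ⇔ ∃ λ w → w ∈ₗ L × v ≋ᵥ Unit.val factor *ᵥ w

  open NatSolver K.commutativeSemiring using (solve; _:=_; _:+_; _:*_; con)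

  ≋ᵥ-refl : Reflexive _≋ᵥ_
  ≋ᵥ-refl = mk≋ K.refl K.refl

  ≋ᵥ-sym : Symmetric _≋ᵥ_
  ≋ᵥ-sym (mk≋ p q) = mk≋ (K.sym p) (K.sym q)

  ≋ᵥ-trans : Transitive _≋ᵥ_
  ≋ᵥ-trans (mk≋ p q) (mk≋ p′ q′) = mk≋ (K.trans p p′) (K.trans q q′)

  vectorSetoid : Setoid 0ℓ 0ℓ
  vectorSetoid = record
    { Carrier = V
    ; _≈_ = _≋ᵥ_
    ; isEquivalence = record { refl = ≋ᵥ-refl ; sym = ≋ᵥ-sym ; trans = ≋ᵥ-trans }
    }

  open SetoidReasoning vectorSetoid

  combo : Carrier → V → Carrier → V → V
  combo c u d v = c *ᵥ u +ᵥ d *ᵥ v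

  combo-cong : ∀ {c d u v c′ d′ u′ v′} → c ≈ c′ → u ≋ᵥ u′ → d ≈ d′ → v ≋ᵥ v′ →
               combo c u d v ≋ᵥ combo c′ u′ d′ v′
  combo-cong c (mk≋ u₁ u₂) d (mk≋ v₁ v₂) =
    mk≋ (+-cong (*-cong c u₁) (*-cong d v₁)) (+-cong (*-cong c u₂) (*-cong d v₂))

  *ᵥ-cong : ∀ {c d u v} → c ≈ d → u ≋ᵥ v → c *ᵥ u ≋ᵥ d *ᵥ v
  *ᵥ-cong c (mk≋ p q) = mk≋ (*-cong c p) (*-cong c q)

  *ᵥ-assoc : ∀ c d v → (c * d) *ᵥ v ≋ᵥ c *ᵥ d *ᵥ v
  *ᵥ-assoc c d v = mk≋ (*-assoc _ _ _) (*-assoc _ _ _)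

  *ᵥ-identity : ∀ v → 1# *ᵥ v ≋ᵥ v
  *ᵥ-identity v = mk≋ (*-identityˡ _) (*-identityˡ _)

  *ᵥ-combo : ∀ r c u d v → combo c (r *ᵥ u) d (r *ᵥ v) ≋ᵥ r *ᵥ combo c u d v
  *ᵥ-combo r c u d v = mk≋ (eq _ _ _ _ _) (eq _ _ _ _ _)
    where eq = solve 5 (λ r c x d y → c :* (r :* x) :+ d :* (r :* y) := r :* (c :* x :+ d :* y)) K.refl

  $-cong : ∀ {M N u v} → M ≋ N → u ≋ᵥ v → M $ᵥ u ≋ᵥ N $ᵥ v
  $-cong (mk≋ a b c d) (mk≋ x y) =
    mk≋ (+-cong (*-cong a x) (*-cong b y)) (+-cong (*-cong c x) (*-cong d y))

  ≋-refl : ∀ {M} → M ≋ M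
  ≋-refl = mk≋ K.refl K.refl K.refl K.refl

  $-combo : ∀ M c u d v → M $ᵥ combo c u d v ≋ᵥ combo c (M $ᵥ u) d (M $ᵥ v)
  $-combo M c u d v = mk≋ (eq _ _ _ _ _ _ _ _) (eq _ _ _ _ _ _ _ _)
    where
    eq = solve 8 (λ a b c u₁ u₂ d v₁ v₂ →
           a :* (c :* u₁ :+ d :* v₁) :+ b :* (c :* u₂ :+ d :* v₂) :=
           c :* (a :* u₁ :+ b :* u₂) :+ d :* (a :* v₁ :+ b :* v₂)) K.refl

  $-*ᵥ : ∀ M c u → M $ᵥ c *ᵥ u ≋ᵥ c *ᵥ M $ᵥ u
  $-*ᵥ M c u = mk≋ (eq _ _ _ _ _) (eq _ _ _ _ _)
    where eq = solve 5 (λ a b c x y → a :* (c :* x) :+ b :* (c :* y) := c :* (a :* x :+ b :* y)) K.refl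

  •-$ : ∀ c M u → (c • M) $ᵥ u ≋ᵥ c *ᵥ M $ᵥ u
  •-$ c M u = mk≋ (eq _ _ _ _ _) (eq _ _ _ _ _)
    where eq = solve 5 (λ c a b x y → (c :* a) :* x :+ (c :* b) :* y := c :* (a :* x :+ b :* y)) K.refl

  $-assoc : ∀ M N u → (M · N) $ᵥ u ≋ᵥ M $ᵥ N $ᵥ u
  $-assoc M N u = mk≋ (eq _ _ _ _ _ _ _ _) (eq _ _ _ _ _ _ _ _)
    where
    eq = solve 8 (λ a b p q r s x y →
           (a :* p :+ b :* r) :* x :+ (a :* q :+ b :* s) :* y :=
           a :* (p :* x :+ q :* y) :+ b :* (r :* x :+ s :* y)) K.refl

  1·x+0·y : ∀ x y → 1# * x + 0# * y ≈ x
  1·x+0·y = solve 2 (λ x y → con 1 :* x :+ con 0 :* y := x) K.refl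

  0·x+1·y : ∀ x y → 0# * x + 1# * y ≈ y
  0·x+1·y = solve 2 (λ x y → con 0 :* x :+ con 1 :* y := y) K.refl

  x·1+y·0 : ∀ x y → x * 1# + y * 0# ≈ x
  x·1+y·0 = solve 2 (λ x y → x :* con 1 :+ y :* con 0 := x) K.refl

  x·0+y·1 : ∀ x y → x * 0# + y * 1# ≈ y
  x·0+y·1 = solve 2 (λ x y → x :* con 0 :+ y :* con 1 := y) K.refl

  $-identity : ∀ u → 1ₘ $ᵥ u ≋ᵥ u
  $-identity u = mk≋ (1·x+0·y _ _) (0·x+1·y _ _)

  $-zero : ∀ M → M $ᵥ 0ᵥ ≋ᵥ 0ᵥ
  $-zero M = mk≋ (eq _ _) (eq _ _)
    where eq = solve 2 (λ x y → x :* con 0 :+ y :* con 0 := con 0) K.refl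

  ∈ₗ-resp : ∀ {u v} L → u ≋ᵥ v → u ∈ₗ L → v ∈ₗ L
  ∈ₗ-resp L u≋v (z₁ , z₂ , p₁ , p₂ , eq) = z₁ , z₂ , p₁ , p₂ , ≋ᵥ-trans (≋ᵥ-sym u≋v) eq

  standardLattice : Lattice
  standardLattice = record
    { b₁ = vec 1# 0#
    ; b₂ = vec 0# 1#
    ; isBasis = record
      { independent = λ c₁ c₂ (mk≋ p q) →
          K.trans (K.sym (x·1+y·0 c₁ c₂)) p , K.trans (K.sym (x·0+y·1 c₁ c₂)) q
      ; spanning = λ v → _ , _ , mk≋ (K.sym (x·1+y·0 _ _)) (K.sym (x·0+y·1 _ _))
      }
    }

  ∼-scaledBasis : ∀ (c : Unit *-monoid) L L′ →
                  b₁ L′ ≋ᵥ Unit.val c *ᵥ b₁ L → b₂ L′ ≋ᵥ Unit.val c *ᵥ b₂ L → L ∼ L′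
  ∼-scaledBasis c L L′ eq₁ eq₂ = homothety c λ v → mk⇔
    (λ (z₁ , z₂ , p₁ , p₂ , eq) →
      combo z₁ (b₁ L) z₂ (b₂ L) , (z₁ , z₂ , p₁ , p₂ , ≋ᵥ-refl) , ≋ᵥ-trans eq (scale z₁ z₂))
    (λ (w , (z₁ , z₂ , p₁ , p₂ , eq) , v≋) →
      z₁ , z₂ , p₁ , p₂ , ≋ᵥ-trans v≋ (≋ᵥ-trans (*ᵥ-cong K.refl eq) (≋ᵥ-sym (scale z₁ z₂))))
    where
    scale : ∀ z₁ z₂ → combo z₁ (b₁ L′) z₂ (b₂ L′) ≋ᵥ Unit.val c *ᵥ combo z₁ (b₁ L) z₂ (b₂ L)
    scale z₁ z₂ = ≋ᵥ-trans (combo-cong K.refl eq₁ K.refl eq₂) (*ᵥ-combo _ _ _ _ _)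

  ∼-sameBasis : ∀ L L′ → b₁ L′ ≋ᵥ b₁ L → b₂ L′ ≋ᵥ b₂ L → L ∼ L′
  ∼-sameBasis L L′ eq₁ eq₂ = ∼-scaledBasis (Group.ε (unitGroup *-monoid)) L L′
    (≋ᵥ-trans eq₁ (≋ᵥ-sym (*ᵥ-identity _))) (≋ᵥ-trans eq₂ (≋ᵥ-sym (*ᵥ-identity _)))

  ∼-refl : Reflexive _∼_
  ∼-refl {L} = ∼-sameBasis L L ≋ᵥ-refl ≋ᵥ-refl

  ∼-sym : Symmetric _∼_
  ∼-sym {L} {L′} (homothety c f) = homothety (Group._⁻¹ (unitGroup *-monoid) c) λ v → mk⇔
    (λ v∈L → _ , Equivalence.from (f _) (v , v∈L , ≋ᵥ-refl) , ≋ᵥ-sym (undo (inverseˡ c)))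
    (λ (w , w∈L′ , v≋) → let (u , u∈L , w≋) = Equivalence.to (f w) w∈L′ in
      ∈ₗ-resp L (≋ᵥ-sym (≋ᵥ-trans v≋ (≋ᵥ-trans (*ᵥ-cong K.refl w≋) (undo (inverseˡ c))))) u∈L)
    where
    open Unit
    undo : ∀ {a b v} → a * b ≈ 1# → a *ᵥ b *ᵥ v ≋ᵥ v
    undo {a} {b} {v} ab = begin
      a *ᵥ b *ᵥ v     ≈⟨ *ᵥ-assoc a b v ⟨
      (a * b) *ᵥ v    ≈⟨ *ᵥ-cong ab ≋ᵥ-refl ⟩
      1# *ᵥ v         ≈⟨ *ᵥ-identity v ⟩
      v               ∎

  ∼-trans : Transitive _∼_
  ∼-trans (homothety c f) (homothety d g) =
    homothety (Group._∙_ (unitGroup *-monoid) d c) λ v → mk⇔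
      (λ v∈N → let (w , w∈M , v≋) = Equivalence.to (g v) v∈N
                   (u , u∈L , w≋) = Equivalence.to (f w) w∈M
               in u , u∈L , ≋ᵥ-trans v≋ (≋ᵥ-trans (*ᵥ-cong K.refl w≋) (≋ᵥ-sym (*ᵥ-assoc _ _ _))))
      (λ (u , u∈L , v≋) →
        Equivalence.from (g v)
          (_ , Equivalence.from (f _) (u , u∈L , ≋ᵥ-refl) , ≋ᵥ-trans v≋ (*ᵥ-assoc _ _ _)))

  homothetyClasses : Setoid 0ℓ 0ℓ
  homothetyClasses = record
    { Carrier = Lattice
    ; _≈_ = _∼_
    ; isEquivalence = record { refl = ∼-refl ; sym = ∼-sym ; trans = ∼-trans }
    }

  record GL₂ : Set where
    no-eta-equality
    field
      g g⁻¹    : Matrix Carrier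
      inverseˡ : g⁻¹ · g ≋ 1ₘ
      inverseʳ : g · g⁻¹ ≋ 1ₘ

  module _ (A : GL₂) where
    open GL₂ A

    undoˡ : ∀ v → g⁻¹ $ᵥ g $ᵥ v ≋ᵥ v
    undoˡ v = ≋ᵥ-trans (≋ᵥ-sym ($-assoc _ _ _)) (≋ᵥ-trans ($-cong inverseˡ ≋ᵥ-refl) ($-identity v))

    undoʳ : ∀ v → g $ᵥ g⁻¹ $ᵥ v ≋ᵥ v
    undoʳ v = ≋ᵥ-trans (≋ᵥ-sym ($-assoc _ _ _)) (≋ᵥ-trans ($-cong inverseʳ ≋ᵥ-refl) ($-identity v))

    -- The lattice { g v : v ∈ L }.
    image : Lattice → Lattice
    image L .b₁ = g $ᵥ b₁ L
    image L .b₂ = g $ᵥ b₂ L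
    image L .isBasis .IsBasis.independent c₁ c₂ eq = IsBasis.independent (isBasis L) c₁ c₂ (begin
      combo c₁ (b₁ L) c₂ (b₂ L)                   ≈⟨ undoˡ _ ⟨
      g⁻¹ $ᵥ g $ᵥ combo c₁ (b₁ L) c₂ (b₂ L)       ≈⟨ $-cong ≋-refl ($-combo _ _ _ _ _) ⟩
      g⁻¹ $ᵥ combo c₁ (g $ᵥ b₁ L) c₂ (g $ᵥ b₂ L)  ≈⟨ $-cong ≋-refl eq ⟩
      g⁻¹ $ᵥ 0ᵥ                                   ≈⟨ $-zero _ ⟩
      0ᵥ                                          ∎)
    image L .isBasis .IsBasis.spanning v =
      let (c₁ , c₂ , eq) = IsBasis.spanning (isBasis L) (g⁻¹ $ᵥ v) in c₁ , c₂ , (begin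
        v                                    ≈⟨ undoʳ v ⟨
        g $ᵥ g⁻¹ $ᵥ v                        ≈⟨ $-cong ≋-refl eq ⟩
        g $ᵥ combo c₁ (b₁ L) c₂ (b₂ L)       ≈⟨ $-combo _ _ _ _ _ ⟩
        combo c₁ (g $ᵥ b₁ L) c₂ (g $ᵥ b₂ L)  ∎)

    ∈-image : ∀ {v} L → v ∈ₗ L → g $ᵥ v ∈ₗ image L
    ∈-image L (z₁ , z₂ , p₁ , p₂ , eq) =
      z₁ , z₂ , p₁ , p₂ , ≋ᵥ-trans ($-cong ≋-refl eq) ($-combo _ _ _ _ _)

    image-∈ : ∀ {v} L → v ∈ₗ image L → g⁻¹ $ᵥ v ∈ₗ L
    image-∈ {v} L (z₁ , z₂ , p₁ , p₂ , eq) = z₁ , z₂ , p₁ , p₂ , (begin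
      g⁻¹ $ᵥ v                                    ≈⟨ $-cong ≋-refl eq ⟩
      g⁻¹ $ᵥ combo z₁ (g $ᵥ b₁ L) z₂ (g $ᵥ b₂ L)  ≈⟨ $-cong ≋-refl ($-combo _ _ _ _ _) ⟨
      g⁻¹ $ᵥ g $ᵥ combo z₁ (b₁ L) z₂ (b₂ L)       ≈⟨ undoˡ _ ⟩
      combo z₁ (b₁ L) z₂ (b₂ L)                   ∎)

    image-cong : ∀ {L L′} → L ∼ L′ → image L ∼ image L′
    image-cong {L} {L′} (homothety c f) = homothety c λ v → mk⇔
      (λ v∈ → let (w , w∈L , eq) = Equivalence.to (f _) (image-∈ L′ v∈) in
        g $ᵥ w , ∈-image L w∈L , (begin
          v                        ≈⟨ undoʳ v ⟨
          g $ᵥ g⁻¹ $ᵥ v            ≈⟨ $-cong ≋-refl eq ⟩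
          g $ᵥ Unit.val c *ᵥ w     ≈⟨ $-*ᵥ _ _ _ ⟩
          Unit.val c *ᵥ g $ᵥ w     ∎))
      (λ (w , w∈ , eq) →
        ∈ₗ-resp (image L′) (undoʳ v) (∈-image L′ (Equivalence.from (f _)
          (g⁻¹ $ᵥ w , image-∈ L w∈ , ≋ᵥ-trans ($-cong ≋-refl eq) ($-*ᵥ _ _ _)))))

  image-scalar : ∀ A B (c : Unit *-monoid) → GL₂.g A ≋ Unit.val c • GL₂.g B →
                 ∀ L → image A L ∼ image B L
  image-scalar A B c eq L = ∼-sym (∼-scaledBasis c (image B L) (image A L)
    (≋ᵥ-trans ($-cong eq ≋ᵥ-refl) (•-$ _ _ _)) (≋ᵥ-trans ($-cong eq ≋ᵥ-refl) (•-$ _ _ _)))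

  image-identity : ∀ A → GL₂.g A ≋ 1ₘ → ∀ L → image A L ∼ L
  image-identity A eq L = ∼-sym (∼-sameBasis L (image A L)
    (≋ᵥ-trans ($-cong eq ≋ᵥ-refl) ($-identity _)) (≋ᵥ-trans ($-cong eq ≋ᵥ-refl) ($-identity _)))

  image-assoc : ∀ A B C → GL₂.g C ≋ GL₂.g A · GL₂.g B →
                ∀ L → image C L ∼ image A (image B L)
  image-assoc A B C eq L = ∼-sym (∼-sameBasis (image A (image B L)) (image C L)
    (≋ᵥ-trans ($-cong eq ≋ᵥ-refl) ($-assoc _ _ _)) (≋ᵥ-trans ($-cong eq ≋ᵥ-refl) ($-assoc _ _ _)))

-- The localisation of R at a multiplicative set of cancellable elements; for
-- R = ℤₚ and all nonzero denominators this is the field of fractions ℚₚ.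
module Fractions
  (R : CommutativeRing 0ℓ 0ℓ)
  (Denominator : Pred (CommutativeRing.Carrier R) 0ℓ)
  (1-den  : Denominator (CommutativeRing.1# R))
  (*-den  : ∀ {x y} → Denominator x → Denominator y → Denominator (CommutativeRing._*_ R x y))
  (cancel : ∀ {a x y} → Denominator a →
            CommutativeRing._≈_ R (CommutativeRing._*_ R a x) (CommutativeRing._*_ R a y) →
            CommutativeRing._≈_ R x y)
  where

  open CommutativeRing R hiding (refl; sym; trans; distribˡ)
  private
    module R = CommutativeRing R
    open NatSolver commutativeSemiring using (solve; _:=_; _:+_; _:*_; con)
    open SetoidReasoning setoid

  record Fraction : Set where
    no-eta-equality
    pattern
    constructor _/_[_]
    field
      num den : Carrier
      isDen   : Denominator den

  open Fraction public

  infix 4 _≈ᶠ_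
  record _≈ᶠ_ (x y : Fraction) : Set where
    constructor mk≈
    field
      cross : num x * den y ≈ num y * den x

  infixl 6 _+ᶠ_
  infixl 7 _*ᶠ_
  infix  8 -ᶠ_

  _+ᶠ_ _*ᶠ_ : Fraction → Fraction → Fraction
  (a / b [ p ]) +ᶠ (c / d [ q ]) = (a * d + c * b) / b * d [ *-den p q ]
  (a / b [ p ]) *ᶠ (c / d [ q ]) = (a * c) / b * d [ *-den p q ]

  -ᶠ_ : Fraction → Fraction
  -ᶠ (a / b [ p ]) = (- a) / b [ p ]

  fromR : Carrier → Fraction
  fromR a = a / 1# [ 1-den ]

  private
    ≈ᶠ-trans : Transitive _≈ᶠ_
    ≈ᶠ-trans {a / b [ _ ]} {a′ / b′ [ q ]} {a″ / b″ [ _ ]} (mk≈ e) (mk≈ f) = mk≈ (cancel q (begin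
      b′ * (a * b″)    ≈⟨ solve 3 (λ x y z → x :* (y :* z) := (y :* x) :* z) R.refl b′ a b″ ⟩
      (a * b′) * b″    ≈⟨ *-congʳ e ⟩
      (a′ * b) * b″    ≈⟨ solve 3 (λ x y z → (x :* y) :* z := (x :* z) :* y) R.refl a′ b b″ ⟩
      (a′ * b″) * b    ≈⟨ *-congʳ f ⟩
      (a″ * b′) * b    ≈⟨ solve 3 (λ x y z → (x :* y) :* z := y :* (x :* z)) R.refl a″ b′ b ⟩
      b′ * (a″ * b)    ∎))

    +ᶠ-cong : ∀ {x x′ y y′} → x ≈ᶠ x′ → y ≈ᶠ y′ → x +ᶠ y ≈ᶠ x′ +ᶠ y′
    +ᶠ-cong {a / b [ _ ]} {a′ / b′ [ _ ]} {c / d [ _ ]} {c′ / d′ [ _ ]} (mk≈ e) (mk≈ f) = mk≈ (begin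
      (a * d + c * b) * (b′ * d′)               ≈⟨ regroup a b c d b′ d′ ⟩
      (a * b′) * (d * d′) + (c * d′) * (b * b′) ≈⟨ +-cong (*-congʳ e) (*-congʳ f) ⟩
      (a′ * b) * (d * d′) + (c′ * d) * (b * b′) ≈⟨ +-cong (*-congˡ (*-comm _ _)) (*-congˡ (*-comm _ _)) ⟩
      (a′ * b) * (d′ * d) + (c′ * d) * (b′ * b) ≈⟨ regroup a′ b′ c′ d′ b d ⟨
      (a′ * d′ + c′ * b′) * (b * d)             ∎)
      where
      regroup : ∀ a b c d b′ d′ →
                (a * d + c * b) * (b′ * d′) ≈ (a * b′) * (d * d′) + (c * d′) * (b * b′)
      regroup = solve 6 (λ a b c d b′ d′ →
        (a :* d :+ c :* b) :* (b′ :* d′) :=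
        (a :* b′) :* (d :* d′) :+ (c :* d′) :* (b :* b′)) R.refl

    *ᶠ-cong : ∀ {x x′ y y′} → x ≈ᶠ x′ → y ≈ᶠ y′ → x *ᶠ y ≈ᶠ x′ *ᶠ y′
    *ᶠ-cong {a / b [ _ ]} {a′ / b′ [ _ ]} {c / d [ _ ]} {c′ / d′ [ _ ]} (mk≈ e) (mk≈ f) = mk≈ (begin
      (a * c) * (b′ * d′)    ≈⟨ interchange a c b′ d′ ⟩
      (a * b′) * (c * d′)    ≈⟨ *-cong e f ⟩
      (a′ * b) * (c′ * d)    ≈⟨ interchange a′ b c′ d ⟩
      (a′ * c′) * (b * d)    ∎)
      where
      interchange : ∀ a b c d → (a * b) * (c * d) ≈ (a * c) * (b * d)
      interchange = solve 4 (λ a b c d → (a :* b) :* (c :* d) := (a :* c) :* (b :* d)) R.refl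

    -ᶠ-cong : ∀ {x x′} → x ≈ᶠ x′ → -ᶠ x ≈ᶠ -ᶠ x′
    -ᶠ-cong {a / b [ _ ]} {a′ / b′ [ _ ]} (mk≈ e) = mk≈ (begin
      - a * b′     ≈⟨ -‿distribˡ-* a b′ ⟨
      - (a * b′)   ≈⟨ -‿cong e ⟩
      - (a′ * b)   ≈⟨ -‿distribˡ-* a′ b ⟩
      - a′ * b     ∎)
      where open RingProperties ring using (-‿distribˡ-*)

    -ᶠ-inverse : ∀ x → -ᶠ x +ᶠ x ≈ᶠ fromR 0#
    -ᶠ-inverse (a / b [ _ ]) = mk≈ (begin
      (- a * b + a * b) * 1#    ≈⟨ solve 3 (λ n a b → (n :* b :+ a :* b) :* con 1 := (n :+ a) :* b) R.refl (- a) a b ⟩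
      (- a + a) * b             ≈⟨ *-congʳ (-‿inverseˡ a) ⟩
      0# * b                    ≈⟨ zeroˡ b ⟩
      0#                        ≈⟨ zeroˡ (b * b) ⟨
      0# * (b * b)              ∎)

    +ᶠ-assoc : ∀ x y z → (x +ᶠ y) +ᶠ z ≈ᶠ x +ᶠ (y +ᶠ z)
    +ᶠ-assoc (a / b [ _ ]) (c / d [ _ ]) (e / f [ _ ]) = mk≈ (solve 6 (λ a b c d e f →
      ((a :* d :+ c :* b) :* f :+ e :* (b :* d)) :* (b :* (d :* f)) :=
      (a :* (d :* f) :+ (c :* f :+ e :* d) :* b) :* ((b :* d) :* f)) R.refl a b c d e f)

    *ᶠ-assoc : ∀ x y z → (x *ᶠ y) *ᶠ z ≈ᶠ x *ᶠ (y *ᶠ z)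
    *ᶠ-assoc (a / b [ _ ]) (c / d [ _ ]) (e / f [ _ ]) = mk≈ (solve 6 (λ a b c d e f →
      ((a :* c) :* e) :* (b :* (d :* f)) :=
      (a :* (c :* e)) :* ((b :* d) :* f)) R.refl a b c d e f)

    +ᶠ-comm : ∀ x y → x +ᶠ y ≈ᶠ y +ᶠ x
    +ᶠ-comm (a / b [ _ ]) (c / d [ _ ]) = mk≈ (solve 4 (λ a b c d →
      (a :* d :+ c :* b) :* (d :* b) := (c :* b :+ a :* d) :* (b :* d)) R.refl a b c d)

    *ᶠ-comm : ∀ x y → x *ᶠ y ≈ᶠ y *ᶠ x
    *ᶠ-comm (a / b [ _ ]) (c / d [ _ ]) = mk≈ (solve 4 (λ a b c d →
      (a :* c) :* (d :* b) := (c :* a) :* (b :* d)) R.refl a b c d)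

    +ᶠ-identityˡ : ∀ x → fromR 0# +ᶠ x ≈ᶠ x
    +ᶠ-identityˡ (a / b [ _ ]) = mk≈ (solve 2 (λ a b →
      (con 0 :* b :+ a :* con 1) :* b := a :* (con 1 :* b)) R.refl a b)

    *ᶠ-identityˡ : ∀ x → fromR 1# *ᶠ x ≈ᶠ x
    *ᶠ-identityˡ (a / b [ _ ]) = mk≈ (solve 2 (λ a b →
      (con 1 :* a) :* b := a :* (con 1 :* b)) R.refl a b)

    *ᶠ-distribˡ-+ᶠ : ∀ x y z → x *ᶠ (y +ᶠ z) ≈ᶠ x *ᶠ y +ᶠ x *ᶠ z
    *ᶠ-distribˡ-+ᶠ (a / b [ _ ]) (c / d [ _ ]) (e / f [ _ ]) = mk≈ (solve 6 (λ a b c d e f →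
      (a :* (c :* f :+ e :* d)) :* ((b :* d) :* (b :* f)) :=
      ((a :* c) :* (b :* f) :+ (a :* e) :* (b :* d)) :* (b :* (d :* f))) R.refl a b c d e f)

  fractions : CommutativeRing 0ℓ 0ℓ
  fractions = record
    { Carrier = Fraction ; _≈_ = _≈ᶠ_ ; _+_ = _+ᶠ_ ; _*_ = _*ᶠ_ ; -_ = -ᶠ_
    ; 0# = fromR 0# ; 1# = fromR 1#
    ; isCommutativeRing = record
      { isRing = record
        { +-isAbelianGroup = record
          { isGroup = record
            { isMonoid = record
              { isSemigroup = record
                { isMagma = record
                  { isEquivalence = record
                    { refl = mk≈ R.refl ; sym = λ (mk≈ e) → mk≈ (R.sym e) ; trans = ≈ᶠ-trans }
                  ; ∙-cong = +ᶠ-cong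
                  }
                ; assoc = +ᶠ-assoc
                }
              ; identity = +ᶠ-identityˡ
                         , (λ x → ≈ᶠ-trans (+ᶠ-comm x (fromR 0#)) (+ᶠ-identityˡ x))
              }
            ; inverse = -ᶠ-inverse , (λ x → ≈ᶠ-trans (+ᶠ-comm x (-ᶠ x)) (-ᶠ-inverse x))
            ; ⁻¹-cong = -ᶠ-cong
            }
          ; comm = +ᶠ-comm
          }
        ; *-cong = *ᶠ-cong
        ; *-assoc = *ᶠ-assoc
        ; *-identity = *ᶠ-identityˡ
                     , (λ x → ≈ᶠ-trans (*ᶠ-comm x (fromR 1#)) (*ᶠ-identityˡ x))
        ; distrib = *ᶠ-distribˡ-+ᶠ
                  , (λ x y z → ≈ᶠ-trans (*ᶠ-comm (y +ᶠ z) x) (≈ᶠ-trans (*ᶠ-distribˡ-+ᶠ x y z)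
                                 (+ᶠ-cong (*ᶠ-comm x y) (*ᶠ-comm x z))))
        }
      ; *-comm = *ᶠ-comm
      }
    }

module PAdic (p : ℕ) (p-prime : Prime p) where

  private
    instance
      p≢0 : ℕ.NonZero p
      p≢0 = prime⇒nonZero p-prime

  pow : ℕ → ℤ
  pow n = + (p ℕ.^ n)

  -- ℤₚ is the inverse limit of the rings ℤ/pⁿ; approx n represents the
  -- component in ℤ/pⁿ.
  record ℤₚ : Set where
    no-eta-equality
    field
      approx   : ℕ → ℤ
      coherent : ∀ n → pow n ℤ.∣ approx (suc n) ℤ.- approx n

  open ℤₚ public

  infix 4 _≈ᶻ_
  record _≈ᶻ_ (x y : ℤₚ) : Set where
    constructor mk≈
    field
      congruent : ∀ n → pow n ℤ.∣ approx x n ℤ.- approx y n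

  open _≈ᶻ_ public

  ∣-resp : ∀ {k a b} → a ≡ b → k ℤ.∣ a → k ℤ.∣ b
  ∣-resp {k} = subst (k ℤ.∣_)

  module Cong (k : ℤ) where
    open ℤ.+-*-Solver

    ∣-refl : ∀ a → k ℤ.∣ a ℤ.- a
    ∣-refl a = ∣-resp (sym (ℤ.+-inverseʳ a)) (ℤ.divides ℤ.0ℤ refl)

    ∣-sym : ∀ a b → k ℤ.∣ a ℤ.- b → k ℤ.∣ b ℤ.- a
    ∣-sym a b d = ∣-resp
      (solve 2 (λ a b → :- (a :- b) := b :- a) refl a b) (ℤ.∣m⇒∣-m d)

    ∣-trans : ∀ a b c → k ℤ.∣ a ℤ.- b → k ℤ.∣ b ℤ.- c → k ℤ.∣ a ℤ.- c
    ∣-trans a b c d e = ∣-resp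
      (solve 3 (λ a b c → (a :- b) :+ (b :- c) := a :- c) refl a b c) (ℤ.∣m∣n⇒∣m+n d e)

    ∣-+ : ∀ a a′ b b′ → k ℤ.∣ a ℤ.- a′ → k ℤ.∣ b ℤ.- b′ →
          k ℤ.∣ (a ℤ.+ b) ℤ.- (a′ ℤ.+ b′)
    ∣-+ a a′ b b′ d e = ∣-resp
      (solve 4 (λ a a′ b b′ → (a :- a′) :+ (b :- b′) := (a :+ b) :- (a′ :+ b′)) refl a a′ b b′)
      (ℤ.∣m∣n⇒∣m+n d e)

    ∣-* : ∀ a a′ b b′ → k ℤ.∣ a ℤ.- a′ → k ℤ.∣ b ℤ.- b′ →
          k ℤ.∣ (a ℤ.* b) ℤ.- (a′ ℤ.* b′)
    ∣-* a a′ b b′ d e = ∣-resp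
      (solve 4 (λ a a′ b b′ → a :* (b :- b′) :+ b′ :* (a :- a′) := (a :* b) :- (a′ :* b′))
        refl a a′ b b′)
      (ℤ.∣m∣n⇒∣m+n (ℤ.∣n⇒∣m*n a e) (ℤ.∣n⇒∣m*n b′ d))

    ∣-neg : ∀ a a′ → k ℤ.∣ a ℤ.- a′ → k ℤ.∣ ℤ.- a ℤ.- ℤ.- a′
    ∣-neg a a′ d = ∣-resp
      (solve 2 (λ a a′ → :- (a :- a′) := :- a :- :- a′) refl a a′) (ℤ.∣m⇒∣-m d)

  open Cong

  const : ℤ → ℤₚ
  const a .approx   _ = a
  const a .coherent n = ∣-refl (pow n) a

  infixl 6 _+ᶻ_
  infixl 7 _*ᶻ_
  infix  8 -ᶻ_

  _+ᶻ_ : ℤₚ → ℤₚ → ℤₚ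
  (x +ᶻ y) .approx   n = approx x n ℤ.+ approx y n
  (x +ᶻ y) .coherent n =
    ∣-+ (pow n) (approx x (suc n)) (approx x n) (approx y (suc n)) (approx y n)
      (coherent x n) (coherent y n)

  _*ᶻ_ : ℤₚ → ℤₚ → ℤₚ
  (x *ᶻ y) .approx   n = approx x n ℤ.* approx y n
  (x *ᶻ y) .coherent n =
    ∣-* (pow n) (approx x (suc n)) (approx x n) (approx y (suc n)) (approx y n)
      (coherent x n) (coherent y n)

  -ᶻ_ : ℤₚ → ℤₚ
  (-ᶻ x) .approx   n = ℤ.- approx x n
  (-ᶻ x) .coherent n = ∣-neg (pow n) (approx x (suc n)) (approx x n) (coherent x n)

  ≡⇒≈ᶻ : ∀ {x y} → (∀ n → approx x n ≡ approx y n) → x ≈ᶻ y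
  ≡⇒≈ᶻ {x} {y} eq = mk≈ λ n →
    subst (λ a → pow n ℤ.∣ approx x n ℤ.- a) (eq n) (∣-refl (pow n) (approx x n))

  ℤₚ-commutativeRing : CommutativeRing 0ℓ 0ℓ
  ℤₚ-commutativeRing = record
    { Carrier = ℤₚ ; _≈_ = _≈ᶻ_ ; _+_ = _+ᶻ_ ; _*_ = _*ᶻ_ ; -_ = -ᶻ_
    ; 0# = const ℤ.0ℤ ; 1# = const ℤ.1ℤ
    ; isCommutativeRing = record
      { isRing = record
        { +-isAbelianGroup = record
          { isGroup = record
            { isMonoid = record
              { isSemigroup = record
                { isMagma = record
                  { isEquivalence = record
                    { refl  = ≡⇒≈ᶻ (λ _ → refl)
                    ; sym   = λ {x} {y} e → mk≈ λ n →
                        ∣-sym (pow n) (approx x n) (approx y n) (congruent e n)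
                    ; trans = λ {x} {y} {z} e f → mk≈ λ n →
                        ∣-trans (pow n) (approx x n) (approx y n) (approx z n)
                          (congruent e n) (congruent f n)
                    }
                  ; ∙-cong = λ {x} {y} {u} {v} e f → mk≈ λ n →
                      ∣-+ (pow n) (approx x n) (approx y n) (approx u n) (approx v n)
                        (congruent e n) (congruent f n)
                  }
                ; assoc = λ x y z → ≡⇒≈ᶻ λ n →
                    ℤ.+-assoc (approx x n) (approx y n) (approx z n)
                }
              ; identity = (λ x → ≡⇒≈ᶻ λ n → ℤ.+-identityˡ (approx x n))
                         , (λ x → ≡⇒≈ᶻ λ n → ℤ.+-identityʳ (approx x n))
              }
            ; inverse = (λ x → ≡⇒≈ᶻ λ n → ℤ.+-inverseˡ (approx x n))
                      , (λ x → ≡⇒≈ᶻ λ n → ℤ.+-inverseʳ (approx x n))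
            ; ⁻¹-cong = λ {x} {y} e → mk≈ λ n →
                ∣-neg (pow n) (approx x n) (approx y n) (congruent e n)
            }
          ; comm = λ x y → ≡⇒≈ᶻ λ n → ℤ.+-comm (approx x n) (approx y n)
          }
        ; *-cong = λ {x} {y} {u} {v} e f → mk≈ λ n →
            ∣-* (pow n) (approx x n) (approx y n) (approx u n) (approx v n)
              (congruent e n) (congruent f n)
        ; *-assoc = λ x y z → ≡⇒≈ᶻ λ n → ℤ.*-assoc (approx x n) (approx y n) (approx z n)
        ; *-identity = (λ x → ≡⇒≈ᶻ λ n → ℤ.*-identityˡ (approx x n))
                     , (λ x → ≡⇒≈ᶻ λ n → ℤ.*-identityʳ (approx x n))
        ; distrib = (λ x y z → ≡⇒≈ᶻ λ n →
                       ℤ.*-distribˡ-+ (approx x n) (approx y n) (approx z n))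
                  , (λ x y z → ≡⇒≈ᶻ λ n →
                       ℤ.*-distribʳ-+ (approx x n) (approx y n) (approx z n))
        }
      ; *-comm = λ x y → ≡⇒≈ᶻ λ n → ℤ.*-comm (approx x n) (approx y n)
      }
    }

  -- Apartness from 0: some component is nonzero in ℤ/pⁿ.
  record Nonzero (z : ℤₚ) : Set where
    constructor nonzero
    field
      index  : ℕ
      index∤ : ¬ pow index ℤ.∣ approx z index

  coprime-factor : ∀ m {a b} → ¬ p ℕ.∣ a → p ℕ.^ m ℕ.∣ a ℕ.* b → p ℕ.^ m ℕ.∣ b
  coprime-factor zero    _   _ = ℕ.1∣ _
  coprime-factor (suc m) {a} {b} p∤a d
    with coprime-factor m p∤a (ℕ.∣-trans (ℕ.n∣m*n p) d)
  ... | ℕ.divides-refl c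
    with euclidsLemma a c p-prime
           (ℕ.*-cancelʳ-∣ (p ℕ.^ m) ⦃ ℕ.m^n≢0 p m ⦄
             (subst (p ℕ.^ suc m ℕ.∣_) (sym (ℕ.*-assoc a c _)) d))
  ... | inj₁ p∣a = contradiction p∣a p∤a
  ... | inj₂ p∣c = ℕ.*-monoˡ-∣ (p ℕ.^ m) p∣c

  valuation : ∀ n m {a b} → ¬ p ℕ.^ n ℕ.∣ a → p ℕ.^ (n ℕ.+ m) ℕ.∣ a ℕ.* b → p ℕ.^ m ℕ.∣ b
  valuation zero    m {a} n∤a d = contradiction (ℕ.1∣ a) n∤a
  valuation (suc n) m {a} {b} n∤a d with p ℕ.∣? a
  ... | no  p∤a = coprime-factor m p∤a (ℕ.∣-trans
          (subst (p ℕ.^ m ℕ.∣_) (sym (ℕ.^-distribˡ-+-* p (suc n) m)) (ℕ.n∣m*n (p ℕ.^ suc n))) d)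
  ... | yes (ℕ.divides-refl c) = valuation n m
          (λ n∣c → n∤a (subst (p ℕ.^ suc n ℕ.∣_) (ℕ.*-comm p c) (ℕ.*-monoʳ-∣ p n∣c)))
          (ℕ.*-cancelˡ-∣ p (subst (p ℕ.^ (suc n ℕ.+ m) ℕ.∣_)
            (trans (cong (ℕ._* b) (ℕ.*-comm c p)) (ℕ.*-assoc p c b)) d))

  valuationᶻ : ∀ n m a b → ¬ pow n ℤ.∣ a → pow (n ℕ.+ m) ℤ.∣ a ℤ.* b → pow m ℤ.∣ b
  valuationᶻ n m a b n∤a d = ℤ.∣ᵤ⇒∣ (valuation n m (λ e → n∤a (ℤ.∣ᵤ⇒∣ e))
    (subst (p ℕ.^ (n ℕ.+ m) ℕ.∣_) (ℤ.abs-* a b) (ℤ.∣⇒∣ᵤ d)))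

  pow-mono : ∀ k n → pow n ℤ.∣ pow (k ℕ.+ n)
  pow-mono k n = ℤ.∣ᵤ⇒∣
    (subst (p ℕ.^ n ℕ.∣_) (sym (ℕ.^-distribˡ-+-* p k n)) (ℕ.n∣m*n (p ℕ.^ k)))

  coherent+ : ∀ z k n → pow n ℤ.∣ approx z (k ℕ.+ n) ℤ.- approx z n
  coherent+ z zero    n = ∣-refl (pow n) (approx z n)
  coherent+ z (suc k) n = ∣-trans (pow n) (approx z (suc k ℕ.+ n)) (approx z (k ℕ.+ n)) (approx z n)
    (ℤ.∣-trans (pow-mono k n) (coherent z (k ℕ.+ n))) (coherent+ z k n)

  ∣-shift : ∀ z k n → pow n ℤ.∣ approx z (k ℕ.+ n) → pow n ℤ.∣ approx z n
  ∣-shift z k n d = ∣-resp (solve 2 (λ a b → a :- (a :- b) := b) refl (approx z (k ℕ.+ n)) (approx z n))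
    (ℤ.∣m∣n⇒∣m-n d (coherent+ z k n))
    where open ℤ.+-*-Solver

  ∤-shift : ∀ z n m → ¬ pow n ℤ.∣ approx z n → ¬ pow n ℤ.∣ approx z (n ℕ.+ m)
  ∤-shift z n m ∤ d =
    ∤ (∣-shift z m n (subst (λ i → pow n ℤ.∣ approx z i) (ℕ.+-comm n m) d))

  ℤₚ-cancel : ∀ {a x y} → Nonzero a → a *ᶻ x ≈ᶻ a *ᶻ y → x ≈ᶻ y
  ℤₚ-cancel {a} {x} {y} (nonzero n n∤a) (mk≈ e) = mk≈ λ m →
    ∣-shift (x +ᶻ -ᶻ y) n m (valuationᶻ n m (approx a (n ℕ.+ m)) _ (∤-shift a n m n∤a)
      (∣-resp (solve 3 (λ a x y → a :* x :- a :* y := a :* (x :- y)) refl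
                (approx a (n ℕ.+ m)) (approx x (n ℕ.+ m)) (approx y (n ℕ.+ m)))
              (e (n ℕ.+ m))))
    where open ℤ.+-*-Solver

  *-nonzero : ∀ {x y} → Nonzero x → Nonzero y → Nonzero (x *ᶻ y)
  *-nonzero {x} {y} (nonzero n n∤x) (nonzero m m∤y) = nonzero (n ℕ.+ m) λ d →
    m∤y (∣-shift y n m (valuationᶻ n m (approx x (n ℕ.+ m)) _ (∤-shift x n m n∤x) d))

  1<p : 1 ℕ.< p
  1<p = ℕ.nonTrivial⇒n>1 p ⦃ prime⇒nonTrivial p-prime ⦄

  n<pⁿ : ∀ n → n ℕ.< p ℕ.^ n
  n<pⁿ zero    = ℕ.s≤s ℕ.z≤n
  n<pⁿ (suc n) = ℕ.≤-<-trans (n<pⁿ n) (ℕ.^-monoʳ-< p 1<p (ℕ.n<1+n n))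

  const-nonzero : ∀ d → Nonzero (const (+ suc d))
  const-nonzero d = nonzero (suc d) λ e → ℕ.<⇒≱ (n<pⁿ (suc d)) (ℕ.∣⇒≤ (ℤ.∣⇒∣ᵤ e))

  open Fractions ℤₚ-commutativeRing Nonzero (const-nonzero 0) *-nonzero ℤₚ-cancel public
    using (num; den; isDen; mk≈; _/_[_]; fromR)
    renaming (Fraction to ℚₚ; fractions to ℚₚ-commutativeRing)

  module Kₚ = CommutativeRing ℚₚ-commutativeRing

  Integral : Pred ℚₚ 0ℓ
  Integral x = ∃ λ (z : ℤₚ) → x Kₚ.≈ fromR z

  fromℚ : ℚ → ℚₚ
  fromℚ (mkℚ n d-1 _) = const n / const (+ suc d-1) [ const-nonzero d-1 ]

  fromℚᵘ : ℚᵘ.ℚᵘ → ℚₚ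
  fromℚᵘ (ℚᵘ.mkℚᵘ n d-1) = const n / const (+ suc d-1) [ const-nonzero d-1 ]

  fromℚ-≃ : ∀ q r → toℚᵘ q ℚᵘ.≃ r → fromℚ q Kₚ.≈ fromℚᵘ r
  fromℚ-≃ (mkℚ _ _ _) (ℚᵘ.mkℚᵘ _ _) (ℚᵘ.*≡* e) = mk≈ (≡⇒≈ᶻ λ _ → e)

  fromℚ-+ : ∀ q r → fromℚ (q ℚ.+ r) Kₚ.≈ fromℚ q Kₚ.+ fromℚ r
  fromℚ-+ q@(mkℚ _ _ _) r@(mkℚ _ _ _) =
    Kₚ.trans (fromℚ-≃ (q ℚ.+ r) _ (ℚ.toℚᵘ-homo-+ q r)) (mk≈ (≡⇒≈ᶻ λ _ → refl))

  fromℚ-* : ∀ q r → fromℚ (q ℚ.* r) Kₚ.≈ fromℚ q Kₚ.* fromℚ r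
  fromℚ-* q@(mkℚ _ _ _) r@(mkℚ _ _ _) =
    Kₚ.trans (fromℚ-≃ (q ℚ.* r) _ (ℚ.toℚᵘ-homo-* q r)) (mk≈ (≡⇒≈ᶻ λ _ → refl))

  fromℚ-neg : ∀ q → fromℚ (ℚ.- q) Kₚ.≈ Kₚ.- fromℚ q
  fromℚ-neg q@(mkℚ _ _ _) =
    Kₚ.trans (fromℚ-≃ (ℚ.- q) _ (ℚ.toℚᵘ-homo‿- q)) (mk≈ (≡⇒≈ᶻ λ _ → refl))

  fromℚ-isRingHomomorphism : IsRingHomomorphism ℚ.+-*-rawRing Kₚ.rawRing fromℚ
  fromℚ-isRingHomomorphism = record
    { isSemiringHomomorphism = record
      { isNearSemiringHomomorphism = record
        { +-isMonoidHomomorphism = record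
          { isMagmaHomomorphism = record
            { isRelHomomorphism = record { cong = λ { refl → Kₚ.refl } }
            ; homo = fromℚ-+
            }
          ; ε-homo = Kₚ.refl
          }
        ; *-homo = fromℚ-*
        }
      ; 1#-homo = Kₚ.refl
      }
    ; -‿homo = fromℚ-neg
    }

module ℋ = Quaternions ℚ.+-*-rawRing
open ℋ using (_≋_; mk≋; _·_; _⊕_; _•_; 1q; Span; span)

I J ω : Quaternion ℚ
I = quat 0ℚ 1ℚ 0ℚ 0ℚ
J = quat 0ℚ 0ℚ 1ℚ 0ℚ
ω = quat ½ ½ ½ ½

≋-refl : Reflexive _≋_
≋-refl = mk≋ refl refl refl refl

≋-sym : Symmetric _≋_
≋-sym (mk≋ a b c d) = mk≋ (sym a) (sym b) (sym c) (sym d)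

≋-trans : Transitive _≋_
≋-trans (mk≋ a b c d) (mk≋ a′ b′ c′ d′) =
  mk≋ (trans a a′) (trans b b′) (trans c c′) (trans d d′)

·-cong : ∀ {x x′ y y′} → x ≋ x′ → y ≋ y′ → x · y ≋ x′ · y′
·-cong (mk≋ a b c d) (mk≋ a′ b′ c′ d′) = mk≋
  (sum (a ⊛ a′) (neg (b ⊛ b′)) (neg (c ⊛ c′)) (neg (d ⊛ d′)))
  (sum (a ⊛ b′) (b ⊛ a′) (c ⊛ d′) (neg (d ⊛ c′)))
  (sum (a ⊛ c′) (neg (b ⊛ d′)) (c ⊛ a′) (d ⊛ b′))
  (sum (a ⊛ d′) (b ⊛ c′) (neg (c ⊛ b′)) (d ⊛ a′))
  where
  _⊛_ : ∀ {p p′ q q′} → p ≡ p′ → q ≡ q′ → p ℚ.* q ≡ p′ ℚ.* q′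
  _⊛_ = cong₂ ℚ._*_
  neg : ∀ {p p′} → p ≡ p′ → ℚ.- p ≡ ℚ.- p′
  neg = cong (ℚ.-_)
  sum : ∀ {p p′ q q′ r r′ s s′} → p ≡ p′ → q ≡ q′ → r ≡ r′ → s ≡ s′ →
        p ℚ.+ q ℚ.+ r ℚ.+ s ≡ p′ ℚ.+ q′ ℚ.+ r′ ℚ.+ s′
  sum refl refl refl refl = refl

open ℚ.+-*-Solver using (solve; Polynomial; _:=_; _:+_; _:*_; _:-_; :-_; con)

-- Quaternions of polynomials: the solver is then given the product
-- formulas above rather than a second copy of them.
polynomials : ℕ → RawRing 0ℓ 0ℓ
polynomials n = record
  { Carrier = Polynomial n ; _≈_ = _≡_ ; _+_ = _:+_ ; _*_ = _:*_ ; -_ = :-_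
  ; 0# = con 0ℚ ; 1# = con 1ℚ }

module Symbolic n = Quaternions (polynomials n)

·-assoc : ∀ x y z → (x · y) · z ≋ x · (y · z)
·-assoc x y z = mk≋
  (solve 12 (λ a b c d a′ b′ c′ d′ a″ b″ c″ d″ →
    re (lhs a b c d a′ b′ c′ d′ a″ b″ c″ d″) := re (rhs a b c d a′ b′ c′ d′ a″ b″ c″ d″)) refl
    (re x) (im x) (jm x) (km x) (re y) (im y) (jm y) (km y) (re z) (im z) (jm z) (km z))
  (solve 12 (λ a b c d a′ b′ c′ d′ a″ b″ c″ d″ →
    im (lhs a b c d a′ b′ c′ d′ a″ b″ c″ d″) := im (rhs a b c d a′ b′ c′ d′ a″ b″ c″ d″)) refl
    (re x) (im x) (jm x) (km x) (re y) (im y) (jm y) (km y) (re z) (im z) (jm z) (km z))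
  (solve 12 (λ a b c d a′ b′ c′ d′ a″ b″ c″ d″ →
    jm (lhs a b c d a′ b′ c′ d′ a″ b″ c″ d″) := jm (rhs a b c d a′ b′ c′ d′ a″ b″ c″ d″)) refl
    (re x) (im x) (jm x) (km x) (re y) (im y) (jm y) (km y) (re z) (im z) (jm z) (km z))
  (solve 12 (λ a b c d a′ b′ c′ d′ a″ b″ c″ d″ →
    km (lhs a b c d a′ b′ c′ d′ a″ b″ c″ d″) := km (rhs a b c d a′ b′ c′ d′ a″ b″ c″ d″)) refl
    (re x) (im x) (jm x) (km x) (re y) (im y) (jm y) (km y) (re z) (im z) (jm z) (km z))
  where
  open Symbolic 12 using () renaming (_·_ to _⊙_)
  P = Polynomial 12
  lhs rhs : (a b c d a′ b′ c′ d′ a″ b″ c″ d″ : P) → Quaternion P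
  lhs a b c d a′ b′ c′ d′ a″ b″ c″ d″ =
    (quat a b c d ⊙ quat a′ b′ c′ d′) ⊙ quat a″ b″ c″ d″
  rhs a b c d a′ b′ c′ d′ a″ b″ c″ d″ =
    quat a b c d ⊙ (quat a′ b′ c′ d′ ⊙ quat a″ b″ c″ d″)

scalar-central : ∀ r x → (r • 1q) · x ≋ x · (r • 1q)
scalar-central r x = mk≋
  (solve 5 (λ r a b c d → re (lhs r a b c d) := re (rhs r a b c d)) refl r (re x) (im x) (jm x) (km x))
  (solve 5 (λ r a b c d → im (lhs r a b c d) := im (rhs r a b c d)) refl r (re x) (im x) (jm x) (km x))
  (solve 5 (λ r a b c d → jm (lhs r a b c d) := jm (rhs r a b c d)) refl r (re x) (im x) (jm x) (km x))
  (solve 5 (λ r a b c d → km (lhs r a b c d) := km (rhs r a b c d)) refl r (re x) (im x) (jm x) (km x))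
  where
  open Symbolic 5 using () renaming (_·_ to _⊙_; _•_ to _⊡_; 1q to 𝟏)
  P = Polynomial 5
  lhs rhs : (r a b c d : P) → Quaternion P
  lhs r a b c d = (r ⊡ 𝟏) ⊙ quat a b c d
  rhs r a b c d = quat a b c d ⊙ (r ⊡ 𝟏)

scalar-· : ∀ r x → (r • 1q) · x ≋ r • x
scalar-· r x = mk≋
  (solve 5 (λ r a b c d → re (lhs r a b c d) := r :* a) refl r (re x) (im x) (jm x) (km x))
  (solve 5 (λ r a b c d → im (lhs r a b c d) := r :* b) refl r (re x) (im x) (jm x) (km x))
  (solve 5 (λ r a b c d → jm (lhs r a b c d) := r :* c) refl r (re x) (im x) (jm x) (km x))
  (solve 5 (λ r a b c d → km (lhs r a b c d) := r :* d) refl r (re x) (im x) (jm x) (km x))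
  where
  open Symbolic 5 using () renaming (_·_ to _⊙_; _•_ to _⊡_; 1q to 𝟏)
  P = Polynomial 5
  lhs : (r a b c d : P) → Quaternion P
  lhs r a b c d = (r ⊡ 𝟏) ⊙ quat a b c d

•-identity : ∀ x → 1ℚ • x ≋ x
•-identity x = mk≋ (ℚ.*-identityˡ _) (ℚ.*-identityˡ _) (ℚ.*-identityˡ _) (ℚ.*-identityˡ _)

•-assoc : ∀ r s x → (r ℚ.* s) • x ≋ r • s • x
•-assoc r s x = mk≋ (ℚ.*-assoc r s _) (ℚ.*-assoc r s _) (ℚ.*-assoc r s _) (ℚ.*-assoc r s _)

•-cong : ∀ {r s} x → r ≡ s → r • x ≋ s • x
•-cong x refl = ≋-refl

-- 1ℚ • 1q = 1q holds by computation.
·-identityˡ : ∀ x → 1q · x ≋ x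
·-identityˡ x = ≋-trans (·-cong (mk≋ refl refl refl refl) ≋-refl)
  (≋-trans (scalar-· 1ℚ x) (•-identity x))

·-identityʳ : ∀ x → x · 1q ≋ x
·-identityʳ x = ≋-trans (·-cong ≋-refl (mk≋ refl refl refl refl))
  (≋-trans (≋-sym (scalar-central 1ℚ x)) (≋-trans (scalar-· 1ℚ x) (•-identity x)))

ℋ-*-monoid : Monoid 0ℓ 0ℓ
ℋ-*-monoid = record
  { Carrier = Quaternion ℚ ; _≈_ = _≋_ ; _∙_ = _·_ ; ε = 1q
  ; isMonoid = record
    { isSemigroup = record
      { isMagma = record
        { isEquivalence = record { refl = ≋-refl ; sym = ≋-sym ; trans = ≋-trans }
        ; ∙-cong = ·-cong
        }
      ; assoc = ·-assoc
      }
    ; identity = ·-identityˡ , ·-identityʳ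
    }
  }

record FinitePrimeSet : Set where
  field
    elements : List ℕ
    unique   : Unique elements
    prime    : All Prime elements

-- The subring of ℚ generated by 1/p for p ∈ S.
data ℤ[1/_] (S : List ℕ) : Pred ℚ 0ℓ where
  1∈   : ℤ[1/ S ] 1ℚ
  1/∈  : ∀ {p} .⦃ _ : ℕ.NonZero p ⦄ → p ∈ S → ℤ[1/ S ] (+ 1 ℚ./ p)
  +-∈  : ∀ {x y} → ℤ[1/ S ] x → ℤ[1/ S ] y → ℤ[1/ S ] (x ℚ.+ y)
  *-∈  : ∀ {x y} → ℤ[1/ S ] x → ℤ[1/ S ] y → ℤ[1/ S ] (x ℚ.* y)
  neg∈ : ∀ {x} → ℤ[1/ S ] x → ℤ[1/ S ] (ℚ.- x)

module SArithmetic (S : FinitePrimeSet) where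
  open FinitePrimeSet S

  ℤ_S : Pred ℚ 0ℓ
  ℤ_S = ℤ[1/ elements ]

  0∈ : ℤ_S 0ℚ
  0∈ = +-∈ 1∈ (neg∈ 1∈)

  -- 1, I, J, ω is a ℤ-basis of the Hurwitz order 𝒪, so 𝒪 ⊗ ℤ_S is the
  -- ℤ_S-span of these elements in ℋ.
  𝒪_S : Pred (Quaternion ℚ) 0ℓ
  𝒪_S = Span ℤ_S 1q I J ω

  _-∈_ : ∀ {x y} → ℤ_S x → ℤ_S y → ℤ_S (x ℚ.- y)
  p -∈ q = +-∈ p (neg∈ q)

  combination : ℚ → ℚ → ℚ → ℚ → Quaternion ℚ
  combination c₀ c₁ c₂ c₃ = c₀ • 1q ⊕ c₁ • I ⊕ c₂ • J ⊕ c₃ • ω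

  scalar∈ : ∀ {r} → ℤ_S r → 𝒪_S (r • 1q)
  scalar∈ {r} r∈ = span r 0ℚ 0ℚ 0ℚ r∈ 0∈ 0∈ 0∈ (mk≋
    (solve 1 (λ r → r :* con 1ℚ := r :* con 1ℚ :+ con 0ℚ :+ con 0ℚ :+ con 0ℚ) refl r)
    (solve 1 (λ r → r :* con 0ℚ := r :* con 0ℚ :+ con 0ℚ :+ con 0ℚ :+ con 0ℚ) refl r)
    (solve 1 (λ r → r :* con 0ℚ := r :* con 0ℚ :+ con 0ℚ :+ con 0ℚ :+ con 0ℚ) refl r)
    (solve 1 (λ r → r :* con 0ℚ := r :* con 0ℚ :+ con 0ℚ :+ con 0ℚ :+ con 0ℚ) refl r))

  1q∈ : 𝒪_S 1q
  1q∈ = span 1ℚ 0ℚ 0ℚ 0ℚ 1∈ 0∈ 0∈ 0∈ (mk≋ refl refl refl refl)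

  -- Coordinates of a product with respect to 1, I, J, ω.
  module Coordinates {A : Set} (_+_ _*_ _-_ : A → A → A) (c₀ c₁ c₂ c₃ d₀ d₁ d₂ d₃ : A) where
    e₀ e₁ e₂ e₃ : A
    e₀ = (((((((c₀ * d₀) - (c₁ * d₁)) - (c₂ * d₂)) - (c₁ * d₂)) + (c₂ * d₁)) - (c₁ * d₃)) - (c₃ * d₂)) - (c₃ * d₃)
    e₁ = ((((((c₀ * d₁) + (c₁ * d₀)) - (c₁ * d₂)) + (c₂ * d₁)) + (c₂ * d₃)) + (c₃ * d₁)) - (c₃ * d₂)
    e₂ = ((((((c₀ * d₂) + (c₂ * d₀)) - (c₁ * d₂)) + (c₂ * d₁)) - (c₁ * d₃)) + (c₂ * d₃)) + (c₃ * d₁)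
    e₃ = ((((((((((c₀ * d₃) + (c₃ * d₀)) + (c₃ * d₃)) + (c₁ * d₂)) + (c₁ * d₂)) - (c₂ * d₁)) - (c₂ * d₁)) + (c₁ * d₃)) + (c₃ * d₂)) - (c₂ * d₃)) - (c₃ * d₁)

  combination-· : ∀ c₀ c₁ c₂ c₃ d₀ d₁ d₂ d₃ →
    let open Coordinates ℚ._+_ ℚ._*_ ℚ._-_ c₀ c₁ c₂ c₃ d₀ d₁ d₂ d₃ in
    combination c₀ c₁ c₂ c₃ · combination d₀ d₁ d₂ d₃ ≋ combination e₀ e₁ e₂ e₃
  combination-· c₀ c₁ c₂ c₃ d₀ d₁ d₂ d₃ = mk≋
    (solve 8 (λ a b c d a′ b′ c′ d′ → re (lhs a b c d a′ b′ c′ d′) := re (rhs a b c d a′ b′ c′ d′)) refl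
      c₀ c₁ c₂ c₃ d₀ d₁ d₂ d₃)
    (solve 8 (λ a b c d a′ b′ c′ d′ → im (lhs a b c d a′ b′ c′ d′) := im (rhs a b c d a′ b′ c′ d′)) refl
      c₀ c₁ c₂ c₃ d₀ d₁ d₂ d₃)
    (solve 8 (λ a b c d a′ b′ c′ d′ → jm (lhs a b c d a′ b′ c′ d′) := jm (rhs a b c d a′ b′ c′ d′)) refl
      c₀ c₁ c₂ c₃ d₀ d₁ d₂ d₃)
    (solve 8 (λ a b c d a′ b′ c′ d′ → km (lhs a b c d a′ b′ c′ d′) := km (rhs a b c d a′ b′ c′ d′)) refl
      c₀ c₁ c₂ c₃ d₀ d₁ d₂ d₃)
    where
    open Symbolic 8 using () renaming (_·_ to _⊙_; _•_ to _⊡_; _⊕_ to _⊞_)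
    P = Polynomial 8
    comb : (a b c d : P) → Quaternion P
    comb a b c d = a ⊡ mapQ con 1q ⊞ b ⊡ mapQ con I ⊞ c ⊡ mapQ con J ⊞ d ⊡ mapQ con ω
    lhs rhs : (a b c d a′ b′ c′ d′ : P) → Quaternion P
    lhs a b c d a′ b′ c′ d′ = comb a b c d ⊙ comb a′ b′ c′ d′
    rhs a b c d a′ b′ c′ d′ = comb e₀ e₁ e₂ e₃
      where open Coordinates _:+_ _:*_ _:-_ a b c d a′ b′ c′ d′

  ·-∈ : ∀ {x y} → 𝒪_S x → 𝒪_S y → 𝒪_S (x · y)
  ·-∈ (span c₀ c₁ c₂ c₃ p₀ p₁ p₂ p₃ x≋) (span d₀ d₁ d₂ d₃ q₀ q₁ q₂ q₃ y≋) =
    span _ _ _ _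
      ((((((((*-∈ p₀ q₀) -∈ (*-∈ p₁ q₁)) -∈ (*-∈ p₂ q₂)) -∈ (*-∈ p₁ q₂)) ⊞ (*-∈ p₂ q₁)) -∈ (*-∈ p₁ q₃)) -∈ (*-∈ p₃ q₂)) -∈ (*-∈ p₃ q₃))
      (((((((*-∈ p₀ q₁) ⊞ (*-∈ p₁ q₀)) -∈ (*-∈ p₁ q₂)) ⊞ (*-∈ p₂ q₁)) ⊞ (*-∈ p₂ q₃)) ⊞ (*-∈ p₃ q₁)) -∈ (*-∈ p₃ q₂))
      (((((((*-∈ p₀ q₂) ⊞ (*-∈ p₂ q₀)) -∈ (*-∈ p₁ q₂)) ⊞ (*-∈ p₂ q₁)) -∈ (*-∈ p₁ q₃)) ⊞ (*-∈ p₂ q₃)) ⊞ (*-∈ p₃ q₁))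
      (((((((((((*-∈ p₀ q₃) ⊞ (*-∈ p₃ q₀)) ⊞ (*-∈ p₃ q₃)) ⊞ (*-∈ p₁ q₂)) ⊞ (*-∈ p₁ q₂)) -∈ (*-∈ p₂ q₁)) -∈ (*-∈ p₂ q₁)) ⊞ (*-∈ p₁ q₃)) ⊞ (*-∈ p₃ q₂)) -∈ (*-∈ p₂ q₃)) -∈ (*-∈ p₃ q₁))
      (≋-trans (·-cong x≋ y≋) (combination-· c₀ c₁ c₂ c₃ d₀ d₁ d₂ d₃))
    where
    _⊞_ : ∀ {x y} → ℤ_S x → ℤ_S y → ℤ_S (x ℚ.+ y)
    _⊞_ = +-∈

  ℤ_S-*-monoid : Monoid 0ℓ 0ℓ
  ℤ_S-*-monoid = record
    { Carrier = ∃ ℤ_S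
    ; _≈_ = λ x y → proj₁ x ≡ proj₁ y
    ; _∙_ = λ (x , x∈) (y , y∈) → x ℚ.* y , *-∈ x∈ y∈
    ; ε = 1ℚ , 1∈
    ; isMonoid = record
      { isSemigroup = record
        { isMagma = record
          { isEquivalence = record { refl = refl ; sym = sym ; trans = trans }
          ; ∙-cong = cong₂ ℚ._*_
          }
        ; assoc = λ (x , _) (y , _) (z , _) → ℚ.*-assoc x y z
        }
      ; identity = (λ (x , _) → ℚ.*-identityˡ x) , (λ (x , _) → ℚ.*-identityʳ x)
      }
    }

  𝒪_S-*-monoid : Monoid 0ℓ 0ℓ
  𝒪_S-*-monoid = record
    { Carrier = ∃ 𝒪_S
    ; _≈_ = λ x y → proj₁ x ≋ proj₁ y
    ; _∙_ = λ (x , x∈) (y , y∈) → x · y , ·-∈ x∈ y∈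
    ; ε = 1q , 1q∈
    ; isMonoid = record
      { isSemigroup = record
        { isMagma = record
          { isEquivalence = record { refl = ≋-refl ; sym = ≋-sym ; trans = ≋-trans }
          ; ∙-cong = ·-cong
          }
        ; assoc = λ (x , _) (y , _) (z , _) → ·-assoc x y z
        }
      ; identity = (λ (x , _) → ·-identityˡ x) , (λ (x , _) → ·-identityʳ x)
      }
    }

  ℤ_S* Γ_S : Group 0ℓ 0ℓ
  ℤ_S* = unitGroup ℤ_S-*-monoid
  Γ_S  = unitGroup 𝒪_S-*-monoid

  private
    module ℤ* = Group ℤ_S*
    module Γ = Group Γ_S
    open Unit

    scalar-inverse : ∀ {r s} → r ℚ.* s ≡ 1ℚ → (r • 1q) · (s • 1q) ≋ 1q
    scalar-inverse {r} {s} eq = ≋-trans (scalar-· r (s • 1q))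
      (≋-trans (≋-sym (•-assoc r s 1q)) (≋-trans (•-cong 1q eq) (•-identity 1q)))

  scalar : ℤ*.Carrier → Γ.Carrier
  scalar c = record
    { val = proj₁ (val c) • 1q , scalar∈ (proj₂ (val c))
    ; inv = proj₁ (inv c) • 1q , scalar∈ (proj₂ (inv c))
    ; inverseˡ = scalar-inverse (inverseˡ c)
    ; inverseʳ = scalar-inverse (inverseʳ c)
    }

  -- Equality in the quotient Γ_S / ℤ_S*.
  infix 4 _≈̄_
  _≈̄_ : Γ.Carrier → Γ.Carrier → Set
  γ ≈̄ δ = ∃ λ (c : ℤ*.Carrier) → γ Γ.≈ (scalar c Γ.∙ δ)

  ≈⇒≈̄ : ∀ γ δ → γ Γ.≈ δ → γ ≈̄ δ
  ≈⇒≈̄ γ δ γ≈δ = ℤ*.ε , ≋-trans γ≈δ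
    (≋-sym (≋-trans (scalar-· 1ℚ _) (•-identity _)))

  Γ̄_S : Group 0ℓ 0ℓ
  Γ̄_S = record
    { Carrier = Γ.Carrier ; _≈_ = _≈̄_ ; _∙_ = Γ._∙_ ; ε = Γ.ε ; _⁻¹ = Γ._⁻¹
    ; isGroup = record
      { isMonoid = record
        { isSemigroup = record
          { isMagma = record
            { isEquivalence = record
              { refl  = λ {γ} → ≈⇒≈̄ γ γ (Γ.refl {γ})
              ; sym   = λ {γ} {δ} → ≈̄-sym γ δ
              ; trans = λ {γ} {δ} {η} → ≈̄-trans γ δ η
              }
            ; ∙-cong = λ {γ} {γ′} {δ} {δ′} → ≈̄-∙ γ γ′ δ δ′
            }
          ; assoc = λ γ δ η → ≈⇒≈̄ ((γ Γ.∙ δ) Γ.∙ η) (γ Γ.∙ (δ Γ.∙ η)) (Γ.assoc γ δ η)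
          }
        ; identity = (λ γ → ≈⇒≈̄ (Γ.ε Γ.∙ γ) γ (Γ.identityˡ γ))
                   , (λ γ → ≈⇒≈̄ (γ Γ.∙ Γ.ε) γ (Γ.identityʳ γ))
        }
      ; inverse = (λ γ → ≈⇒≈̄ (γ Γ.⁻¹ Γ.∙ γ) Γ.ε (Γ.inverseˡ γ))
                , (λ γ → ≈⇒≈̄ (γ Γ.∙ γ Γ.⁻¹) Γ.ε (Γ.inverseʳ γ))
      ; ⁻¹-cong = λ {γ} {δ} → ≈̄-⁻¹ γ δ
      }
    }
    where
    module Σ-Reasoning = SetoidReasoning (Monoid.setoid ℋ-*-monoid)
    open Σ-Reasoning

    ⟦_⟧ : Γ.Carrier → Quaternion ℚ
    ⟦ γ ⟧ = proj₁ (val γ)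

    ⌊_⌋ : ℤ*.Carrier → ℚ
    ⌊ c ⌋ = proj₁ (val c)

    ·-congˡ : ∀ x {y z} → y ≋ z → x · y ≋ x · z
    ·-congˡ x = ·-cong (≋-refl {x})

    ·-congʳ : ∀ x {y z} → y ≋ z → y · x ≋ z · x
    ·-congʳ x eq = ·-cong eq (≋-refl {x})

    scalar-* : ∀ r s x → ((r ℚ.* s) • 1q) · x ≋ (r • 1q) · ((s • 1q) · x)
    scalar-* r s x = begin
      ((r ℚ.* s) • 1q) · x          ≈⟨ ·-congʳ x (•-assoc r s 1q) ⟩
      (r • s • 1q) · x              ≈⟨ ·-congʳ x (scalar-· r (s • 1q)) ⟨
      ((r • 1q) · (s • 1q)) · x     ≈⟨ ·-assoc (r • 1q) (s • 1q) x ⟩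
      (r • 1q) · ((s • 1q) · x)     ∎

    ≈̄-sym : ∀ γ δ → γ ≈̄ δ → δ ≈̄ γ
    ≈̄-sym γ δ (c , eq) = c ℤ*.⁻¹ , (begin
      ⟦ δ ⟧                                         ≈⟨ ·-identityˡ ⟦ δ ⟧ ⟨
      1q · ⟦ δ ⟧                                    ≈⟨ ·-congʳ ⟦ δ ⟧ (inverseˡ (scalar c)) ⟨
      (⟦ scalar c Γ.⁻¹ ⟧ · ⟦ scalar c ⟧) · ⟦ δ ⟧    ≈⟨ ·-assoc ⟦ scalar c Γ.⁻¹ ⟧ ⟦ scalar c ⟧ ⟦ δ ⟧ ⟩
      ⟦ scalar c Γ.⁻¹ ⟧ · (⟦ scalar c ⟧ · ⟦ δ ⟧)    ≈⟨ ·-congˡ ⟦ scalar c Γ.⁻¹ ⟧ eq ⟨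
      ⟦ scalar c Γ.⁻¹ ⟧ · ⟦ γ ⟧                     ∎)

    ≈̄-trans : ∀ γ δ η → γ ≈̄ δ → δ ≈̄ η → γ ≈̄ η
    ≈̄-trans γ δ η (c , eq) (d , eq′) = c ℤ*.∙ d , (begin
      ⟦ γ ⟧                                      ≈⟨ eq ⟩
      ⟦ scalar c ⟧ · ⟦ δ ⟧                       ≈⟨ ·-congˡ ⟦ scalar c ⟧ eq′ ⟩
      ⟦ scalar c ⟧ · (⟦ scalar d ⟧ · ⟦ η ⟧)      ≈⟨ scalar-* ⌊ c ⌋ ⌊ d ⌋ ⟦ η ⟧ ⟨
      ⟦ scalar (c ℤ*.∙ d) ⟧ · ⟦ η ⟧              ∎)

    ≈̄-∙ : ∀ γ γ′ δ δ′ → γ ≈̄ γ′ → δ ≈̄ δ′ → γ Γ.∙ δ ≈̄ γ′ Γ.∙ δ′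
    ≈̄-∙ γ γ′ δ δ′ (c , eq) (d , eq′) = c ℤ*.∙ d , (begin
      ⟦ γ ⟧ · ⟦ δ ⟧               ≈⟨ ·-cong eq eq′ ⟩
      (u · x) · (v · y)           ≈⟨ ·-assoc u x (v · y) ⟩
      u · (x · (v · y))           ≈⟨ ·-congˡ u (·-assoc x v y) ⟨
      u · ((x · v) · y)           ≈⟨ ·-congˡ u (·-congʳ y (scalar-central ⌊ d ⌋ x)) ⟨
      u · ((v · x) · y)           ≈⟨ ·-congˡ u (·-assoc v x y) ⟩
      u · (v · (x · y))           ≈⟨ scalar-* ⌊ c ⌋ ⌊ d ⌋ (x · y) ⟨
      ⟦ scalar (c ℤ*.∙ d) ⟧ · (x · y) ∎)
      where
      u = ⟦ scalar c ⟧
      v = ⟦ scalar d ⟧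
      x = ⟦ γ′ ⟧
      y = ⟦ δ′ ⟧

    ≈̄-⁻¹ : ∀ γ δ → γ ≈̄ δ → γ Γ.⁻¹ ≈̄ δ Γ.⁻¹
    ≈̄-⁻¹ γ δ (c , eq) = c ℤ*.⁻¹ , (begin
      ⟦ γ Γ.⁻¹ ⟧                        ≈⟨ Γ.⁻¹-cong {γ} {scalar c Γ.∙ δ} eq ⟩
      ⟦ δ Γ.⁻¹ ⟧ · ⟦ scalar c Γ.⁻¹ ⟧    ≈⟨ scalar-central (proj₁ (inv c)) ⟦ δ Γ.⁻¹ ⟧ ⟨
      ⟦ scalar c Γ.⁻¹ ⟧ · ⟦ δ Γ.⁻¹ ⟧    ∎)

-- Applied below with K = ℚₚ and 𝒪ₖ its subset ℤₚ.
module OverExtension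
  (K : CommutativeRing 0ℓ 0ℓ) (𝒪ₖ : Pred (CommutativeRing.Carrier K) 0ℓ)
  (fromℚ : ℚ → CommutativeRing.Carrier K)
  (isHom : RingMorphisms.IsRingHomomorphism ℚ.+-*-rawRing (CommutativeRing.rawRing K) fromℚ)
  where

  private
    module K = CommutativeRing K
    module ℋₖ = Quaternions K.rawRing
    module M₂ = Matrices K.rawRing
    module L = Lattices K 𝒪ₖ

  ι : Quaternion ℚ → Quaternion K.Carrier
  ι = mapQ fromℚ

  -- 𝒪 ⊗ 𝒪ₖ inside ℋ ⊗ K.
  𝒪⊗𝒪ₖ : Pred (Quaternion K.Carrier) 0ℓ
  𝒪⊗𝒪ₖ = ℋₖ.Span 𝒪ₖ (ι 1q) (ι I) (ι J) (ι ω)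

  -- An isomorphism of K-algebras ℋ ⊗ K ≅ M₂(K) carrying 𝒪 ⊗ 𝒪ₖ onto M₂(𝒪ₖ).
  record Splitting : Set where
    field
      φ          : Quaternion K.Carrier → Matrix K.Carrier
      isRingIso  : IsRingIsomorphism ℋₖ.quaternionRing M₂.matrixRing φ
      linear     : ∀ c x → φ (c ℋₖ.• x) M₂.≋ c M₂.• φ x
      into       : ∀ x → 𝒪⊗𝒪ₖ x → M₂.Entries 𝒪ₖ (φ x)
      onto       : ∀ M → M₂.Entries 𝒪ₖ M → ∃ λ x → 𝒪⊗𝒪ₖ x × φ x M₂.≋ M

  module TreeAction (σ : Splitting) where
    open Splitting σ
    private
      module φ = RingMorphisms.IsRingIsomorphism isRingIso
      module ι = RingMorphisms.IsRingHomomorphism isHom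
    open Unit

    M₂-sym : Symmetric M₂._≋_
    M₂-sym (M₂.mk≋ a b c d) = M₂.mk≋ (K.sym a) (K.sym b) (K.sym c) (K.sym d)

    M₂-trans : Transitive M₂._≋_
    M₂-trans (M₂.mk≋ a b c d) (M₂.mk≋ a′ b′ c′ d′) =
      M₂.mk≋ (K.trans a a′) (K.trans b b′) (K.trans c c′) (K.trans d d′)

    add : ∀ {x y u v} → fromℚ x K.≈ u → fromℚ y K.≈ v → fromℚ (x ℚ.+ y) K.≈ u K.+ v
    add {x} {y} e f = K.trans (ι.+-homo x y) (K.+-cong e f)

    mul : ∀ x y → fromℚ (x ℚ.* y) K.≈ fromℚ x K.* fromℚ y
    mul = ι.*-homo

    neg : ∀ {x u} → fromℚ x K.≈ u → fromℚ (ℚ.- x) K.≈ K.- u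
    neg {x} e = K.trans (ι.-‿homo x) (K.-‿cong e)

    ι-cong : ∀ {x y} → x ≋ y → ι x ℋₖ.≋ ι y
    ι-cong (mk≋ a b c d) =
      ℋₖ.mk≋ (ι.⟦⟧-cong a) (ι.⟦⟧-cong b) (ι.⟦⟧-cong c) (ι.⟦⟧-cong d)

    ι-· : ∀ x y → ι (x · y) ℋₖ.≋ ι x ℋₖ.· ι y
    ι-· x y = ℋₖ.mk≋
      (add (add (add (mul _ _) (neg (mul _ _))) (neg (mul _ _))) (neg (mul _ _)))
      (add (add (add (mul _ _) (mul _ _)) (mul _ _)) (neg (mul _ _)))
      (add (add (add (mul _ _) (neg (mul _ _))) (mul _ _)) (mul _ _))
      (add (add (add (mul _ _) (mul _ _)) (neg (mul _ _))) (mul _ _))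

    ι-• : ∀ c x → ι (c • x) ℋₖ.≋ fromℚ c ℋₖ.• ι x
    ι-• c x = ℋₖ.mk≋ (mul _ _) (mul _ _) (mul _ _) (mul _ _)

    ι-1 : ι 1q ℋₖ.≋ ℋₖ.1q
    ι-1 = ℋₖ.mk≋ ι.1#-homo ι.0#-homo ι.0#-homo ι.0#-homo

    -- The embedding ℋ ⊂ M₂(K).
    ρ : Quaternion ℚ → Matrix K.Carrier
    ρ x = φ (ι x)

    ρ-cong : ∀ {x y} → x ≋ y → ρ x M₂.≋ ρ y
    ρ-cong eq = φ.⟦⟧-cong (ι-cong eq)

    ρ-· : ∀ x y → ρ (x · y) M₂.≋ ρ x M₂.· ρ y
    ρ-· x y = M₂-trans (φ.⟦⟧-cong (ι-· x y)) (φ.*-homo (ι x) (ι y))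

    ρ-1 : ρ 1q M₂.≋ M₂.1ₘ
    ρ-1 = M₂-trans (φ.⟦⟧-cong ι-1) φ.1#-homo

    ρ-• : ∀ c x → ρ (c • x) M₂.≋ fromℚ c M₂.• ρ x
    ρ-• c x = M₂-trans (φ.⟦⟧-cong (ι-• c x)) (linear (fromℚ c) (ι x))

    ρ-inverse : ∀ {x y} → x · y ≋ 1q → ρ x M₂.· ρ y M₂.≋ M₂.1ₘ
    ρ-inverse {x} {y} eq = M₂-trans (M₂-sym (ρ-· x y)) (M₂-trans (ρ-cong eq) ρ-1)

    toGL₂ : Unit ℋ-*-monoid → L.GL₂
    toGL₂ γ .L.GL₂.g        = ρ (val γ)
    toGL₂ γ .L.GL₂.g⁻¹      = ρ (inv γ)
    toGL₂ γ .L.GL₂.inverseˡ = ρ-inverse (inverseˡ γ)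
    toGL₂ γ .L.GL₂.inverseʳ = ρ-inverse (inverseʳ γ)

    act : Unit ℋ-*-monoid → L.Lattice → L.Lattice
    act γ = L.image (toGL₂ γ)

    act-cong : ∀ γ {L M} → L L.∼ M → act γ L L.∼ act γ M
    act-cong γ = L.image-cong (toGL₂ γ)

    act-identity : ∀ γ → val γ ≋ 1q → ∀ L → act γ L L.∼ L
    act-identity γ eq = L.image-identity (toGL₂ γ) (M₂-trans (ρ-cong eq) ρ-1)

    act-assoc : ∀ γ δ η → val η ≋ val γ · val δ → ∀ L → act η L L.∼ act γ (act δ L)
    act-assoc γ δ η eq = L.image-assoc (toGL₂ γ) (toGL₂ δ) (toGL₂ η)
      (M₂-trans (ρ-cong eq) (ρ-· (val γ) (val δ)))

    act-scalar : ∀ γ δ r s → r ℚ.* s ≡ 1ℚ → val γ ≋ r • val δ → ∀ L → act γ L L.∼ act δ L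
    act-scalar γ δ r s rs eq = L.image-scalar (toGL₂ γ) (toGL₂ δ) r-unit
      (M₂-trans (ρ-cong eq) (ρ-• r (val δ)))
      where
      1≈ : fromℚ r K.* fromℚ s K.≈ K.1#
      1≈ = K.trans (K.sym (mul r s)) (K.trans (ι.⟦⟧-cong rs) ι.1#-homo)
      r-unit : Unit K.*-monoid
      r-unit = record
        { val = fromℚ r ; inv = fromℚ s
        ; inverseˡ = K.trans (K.*-comm _ _) 1≈ ; inverseʳ = 1≈ }

-- The tree of PGL₂(ℚₚ).  Edges play no part in vertex transitivity, so only
-- the vertices are formed.
module Tree (p : ℕ) (p-prime : Prime p) where
  open PAdic p p-prime
  open OverExtension ℚₚ-commutativeRing Integral fromℚ fromℚ-isRingHomomorphism public
  private module L = Lattices ℚₚ-commutativeRing Integral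

  vertices : Setoid 0ℓ 0ℓ
  vertices = L.homothetyClasses

  origin : Setoid.Carrier vertices
  origin = L.standardLattice

-- A choice of isomorphism ℋ ⊗ ℚₚ ≅ M₂(ℚₚ) for every odd prime p.
Splittings : Set
Splittings = ∀ p (p-prime : Prime p) → p ≢ 2 → Tree.Splitting p p-prime

module Product (σ : Splittings) (S : FinitePrimeSet) where
  open FinitePrimeSet S
  open SArithmetic S
  private
    module Γ = Group Γ_S
    module ℤ* = Group ℤ_S*
  open Unit

  toℋ* : Γ.Carrier → Unit ℋ-*-monoid
  toℋ* γ = record
    { val = proj₁ (val γ) ; inv = proj₁ (inv γ)
    ; inverseˡ = inverseˡ γ ; inverseʳ = inverseʳ γ }

  module _ (p : ℕ) (p-prime : Prime p) where

    -- The factor at p = 2 is a single point.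
    factor : Dec (p ≡ 2) → Setoid 0ℓ 0ℓ
    factor (yes _) = ≡-setoid ⊤
    factor (no  _) = Tree.vertices p p-prime

    base : ∀ d → Setoid.Carrier (factor d)
    base (yes _) = tt
    base (no  _) = Tree.origin p p-prime

    open module T (p≢2 : p ≢ 2) = Tree.TreeAction p p-prime (σ p p-prime p≢2)

    factorAction : ∀ d → Action Γ̄_S (factor d)
    factorAction (yes _) = record
      { _▷_        = λ _ v → v
      ; ▷-cong     = λ _ eq → eq
      ; ▷-identity = λ _ → refl
      ; ▷-assoc    = λ _ _ _ → refl
      }
    factorAction (no p≢2) = record
      { _▷_        = λ γ → act p≢2 (toℋ* γ)
      ; ▷-cong     = λ {γ} {δ} {L} {M} (c , eq) L∼M → X.trans {act p≢2 (toℋ* γ) L}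
          (act-scalar p≢2 (toℋ* γ) (toℋ* δ) (proj₁ (val c)) (proj₁ (inv c)) (inverseʳ c)
            (≋-trans eq (scalar-· (proj₁ (val c)) (proj₁ (val δ)))) L)
          (act-cong p≢2 (toℋ* δ) L∼M)
      ; ▷-identity = act-identity p≢2 (toℋ* Γ.ε) ≋-refl
      ; ▷-assoc    = λ γ δ → act-assoc p≢2 (toℋ* γ) (toℋ* δ) (toℋ* (γ Γ.∙ δ)) ≋-refl
      }
      where module X = Setoid (Tree.vertices p p-prime)

  module 𝔛ₚ p (p∈S : p ∈ elements) where
    vertices : Setoid 0ℓ 0ℓ
    vertices = factor p (All.lookup prime p∈S) (p ℕ.≟ 2)

    origin : Setoid.Carrier vertices
    origin = base p (All.lookup prime p∈S) (p ℕ.≟ 2)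

    action : Action Γ̄_S vertices
    action = factorAction p (All.lookup prime p∈S) (p ℕ.≟ 2)

  -- The vertex set of 𝔛_S.  A tuple has one entry per p, since p ∈ S has at
  -- most one proof when S has no repetitions.
  𝔛_S : Setoid 0ℓ 0ℓ
  𝔛_S = record
    { Carrier = ∀ p (p∈S : p ∈ elements) → Setoid.Carrier (𝔛ₚ.vertices p p∈S)
    ; _≈_ = λ v w → ∀ p (p∈S : p ∈ elements) → Setoid._≈_ (𝔛ₚ.vertices p p∈S) (v p p∈S) (w p p∈S)
    ; isEquivalence = record
      { refl  = λ p p∈S → Setoid.refl (𝔛ₚ.vertices p p∈S)
      ; sym   = λ eq p p∈S → Setoid.sym (𝔛ₚ.vertices p p∈S) (eq p p∈S)
      ; trans = λ eq eq′ p p∈S → Setoid.trans (𝔛ₚ.vertices p p∈S) (eq p p∈S) (eq′ p p∈S)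
      }
    }

  v₀ : Setoid.Carrier 𝔛_S
  v₀ = 𝔛ₚ.origin

  Γ̄-action : Action Γ̄_S 𝔛_S
  Γ̄-action = record
    { _▷_        = λ γ v p p∈S → Action._▷_ (𝔛ₚ.action p p∈S) γ (v p p∈S)
    ; ▷-cong     = λ {γ} {δ} γ≈δ v≈w p p∈S → Action.▷-cong (𝔛ₚ.action p p∈S) {γ} {δ} γ≈δ (v≈w p p∈S)
    ; ▷-identity = λ v p p∈S → Action.▷-identity (𝔛ₚ.action p p∈S) (v p p∈S)
    ; ▷-assoc    = λ γ δ v p p∈S → Action.▷-assoc (𝔛ₚ.action p p∈S) γ δ (v p p∈S)
    }

  Γ-action : Action Γ_S 𝔛_S
  Γ-action = record
    { _▷_        = _▷_
    ; ▷-cong     = λ {γ} {δ} γ≈δ → ▷-cong {γ} {δ} (≈⇒≈̄ γ δ γ≈δ)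
    ; ▷-identity = ▷-identity
    ; ▷-assoc    = ▷-assoc
    }
    where open Action Γ̄-action

{-# OPTIONS --safe #-}
-- The Hurwitz order 𝒪 is right Euclidean.  A vertex of 𝔛ₚ is the class of a lattice
-- B ℤₚ² with B integral and pⁿ ∈ B M₂(ℤₚ).  Approximate the element of 𝒪 ⊗ ℤₚ
-- corresponding to B by some x ∈ 𝒪 modulo pⁿ, and let γ be a right gcd of x and pⁿ.
-- Then γ generates the right ideal { y ∈ 𝒪 : y ∈ B M₂(ℤₚ) }, so γ ℤₚ² = B ℤₚ²; and
-- since γ divides pⁿ, it is an S-unit and lies in GL₂(ℤ_q) for every q ≠ p.  It
-- therefore moves the vertex at p only, and the primes of S are treated one by one.

module Submission where

open import Defs
open import Algebra.Bundles using (CommutativeRing; Group; Monoid)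
open import Algebra.Morphism.Structures using (module RingMorphisms)
import Algebra.Properties.Ring as RingProperties
import Algebra.Solver.Ring.NaturalCoefficients.Default as NatSolver
open import Data.Fin using (#_)
open import Data.Integer.Base as ℤ using (ℤ; +_; -[1+_]; ∣_∣)
import Data.Integer.Divisibility.Signed as ℤ
import Data.Integer.DivMod as ℤ
import Data.Integer.Properties as ℤ
import Data.Integer.Solver as ℤ
open import Data.List.Base using ([]; _∷_)
open import Data.List.Membership.Propositional using (_∈_; _∉_)
open import Data.List.Membership.Propositional.Properties.WithK using (unique⇒irrelevant)
open import Data.List.Relation.Unary.All as All using (All; []; _∷_)
open import Data.List.Relation.Unary.AllPairs using ([])
open import Data.List.Relation.Unary.Any using (here; there)
open import Data.Nat.Base as ℕ using (ℕ; zero; suc)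
open import Data.Nat.Coprimality using (1-coprimeTo; coprime-Bézout; Coprime) renaming (sym to coprime-sym)
import Data.Nat.Divisibility as ℕ
open import Data.Nat.GCD using (module Bézout)
open import Data.Nat.Induction using (<-rec)
open import Data.Nat.Primality using (Prime; prime⇒irreducible; prime⇒nonZero; euclidsLemma; ¬prime[1])
import Data.Nat.Properties as ℕ
import Data.Nat.Solver as ℕ
open import Data.Product.Base using (_×_; _,_; proj₁; proj₂; ∃)
open import Data.Rational.Base as ℚ using (ℚ; mkℚ; 0ℚ; 1ℚ; ½)
import Data.Rational.Properties as ℚ
import Data.Rational.Solver as ℚ
import Data.Rational.Unnormalised.Base as ℚᵘ
import Data.Rational.Unnormalised.Properties as ℚᵘ
open import Data.Sum.Base using (inj₁; inj₂)
open import Data.Vec.Base as Vec using (Vec)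
open import Function.Bundles using (mk⇔)
open import Level using (0ℓ)
open import Relation.Binary.Bundles using (Setoid)
open import Relation.Binary.PropositionalEquality
  using (_≡_; _≢_; refl; sym; trans; cong; cong₂; subst; module ≡-Reasoning)
import Relation.Binary.Reasoning.Setoid as SetoidReasoning
open import Relation.Nullary using (¬_; Dec; yes; no; contradiction)
open import Relation.Unary using (Pred)

open RingMorphisms using (IsRingHomomorphism)

-- A matrix in GL₂(ℚₚ) with the right effect at p is easy to find; the difficulty is to find one
-- that comes from ℋ and is a unit at all other primes. Including pⁿ in the gcd achieves this: away
-- from p it makes the ideal trivial, and at p it changes nothing, because pⁿ already lies in B
-- M₂(ℤₚ). For the same reason an approximation modulo pⁿ is as good as the exact local element.
-- That the global ideal has a single generator is where class number one of 𝒪 enters, through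
-- Euclid.
--
-- The splittings are arbitrary, so no explicit matrices for `I` and `J` are available: integrality
-- is carried between 𝒪 and M₂(ℤₚ) by `into` and `onto`.
--
-- Equality in ℤₚ, an inverse limit, is not decidable, so a valuation cannot be found by searching
-- the components. The exponent n is read off from a proof of apartness instead: the determinant of
-- a basis comes with an inverse, and the inverse shows at which component the scaled determinant is
-- nonzero.

-- Arithmetic of the Hurwitz order.

module HurwitzOrder where

  open ℋ using (_≋_; mk≋; _·_; _⊕_; _•_; 1q; Span; span)
  open Quaternion

  ⟪_⟫ : ℤ → ℚ
  ⟪ n ⟫ = mkℚ n 0 (coprime-sym (1-coprimeTo ∣ n ∣))

  ⟪⟫-injective : ∀ {m n} → ⟪ m ⟫ ≡ ⟪ n ⟫ → m ≡ n
  ⟪⟫-injective refl = refl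

  ⟪⟫-+ : ∀ m n → ⟪ m ℤ.+ n ⟫ ≡ ⟪ m ⟫ ℚ.+ ⟪ n ⟫
  ⟪⟫-+ m n = ℚ.toℚᵘ-injective (ℚᵘ.≃-trans
    (ℚᵘ.*≡* (cong (ℤ._* + 1) (sym (cong₂ ℤ._+_ (ℤ.*-identityʳ m) (ℤ.*-identityʳ n)))))
    (ℚᵘ.≃-sym (ℚ.toℚᵘ-homo-+ ⟪ m ⟫ ⟪ n ⟫)))

  ⟪⟫-* : ∀ m n → ⟪ m ℤ.* n ⟫ ≡ ⟪ m ⟫ ℚ.* ⟪ n ⟫
  ⟪⟫-* m n = ℚ.toℚᵘ-injective (ℚᵘ.≃-trans (ℚᵘ.*≡* refl) (ℚᵘ.≃-sym (ℚ.toℚᵘ-homo-* ⟪ m ⟫ ⟪ n ⟫)))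

  ⟪⟫-neg : ∀ n → ⟪ ℤ.- n ⟫ ≡ ℚ.- ⟪ n ⟫
  ⟪⟫-neg n = ℚ.toℚᵘ-injective (ℚᵘ.≃-trans (ℚᵘ.*≡* refl) (ℚᵘ.≃-sym (ℚ.toℚᵘ-homo‿- ⟪ n ⟫)))

  ⟪⟫∈ : ∀ {S} n → ℤ[1/ S ] ⟪ n ⟫
  ⟪⟫∈ (+ 0)             = +-∈ 1∈ (neg∈ 1∈)
  ⟪⟫∈ (+ suc n)         = subst ℤ[1/ _ ] (sym (⟪⟫-+ (+ 1) (+ n))) (+-∈ 1∈ (⟪⟫∈ (+ n)))
  ⟪⟫∈ (-[1+ 0 ])        = neg∈ 1∈
  ⟪⟫∈ (-[1+ suc n ])    = subst ℤ[1/ _ ] (sym (⟪⟫-+ -[1+ 0 ] -[1+ n ])) (+-∈ (neg∈ 1∈) (⟪⟫∈ -[1+ n ]))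

  integer : ∀ {r} → ℤ[1/ [] ] r → ∃ λ n → r ≡ ⟪ n ⟫
  integer 1∈        = + 1 , refl
  integer (1/∈ ())
  integer (+-∈ p q) with integer p | integer q
  ... | m , refl | n , refl = m ℤ.+ n , sym (⟪⟫-+ m n)
  integer (*-∈ p q) with integer p | integer q
  ... | m , refl | n , refl = m ℤ.* n , sym (⟪⟫-* m n)
  integer (neg∈ p)  with integer p
  ... | m , refl = ℤ.- m , sym (⟪⟫-neg m)

  ∅ : FinitePrimeSet
  ∅ = record { elements = [] ; unique = [] ; prime = [] }

  -- Since ℤ_∅ = ℤ, the ring 𝒪_∅ is the Hurwitz order itself.
  module 𝒪 = SArithmetic ∅
  open 𝒪 using (combination) renaming (𝒪_S to Hurwitz; ·-∈ to ·-closed)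

  open ℚ.+-*-Solver using (solve; prove; var; Polynomial; _:=_; _:+_; _:*_; _:-_; :-_; con)

  ⊖_ conj : Quaternion ℚ → Quaternion ℚ
  ⊖ x = mapQ (ℚ.-_) x
  conj x = quat (re x) (ℚ.- im x) (ℚ.- jm x) (ℚ.- km x)

  infix 8 ⊖_

  ⊕-cong : ∀ {x x′ y y′} → x ≋ x′ → y ≋ y′ → x ⊕ y ≋ x′ ⊕ y′
  ⊕-cong (mk≋ a b c d) (mk≋ a′ b′ c′ d′) =
    mk≋ (cong₂ ℚ._+_ a a′) (cong₂ ℚ._+_ b b′) (cong₂ ℚ._+_ c c′) (cong₂ ℚ._+_ d d′)

  ⊖-cong : ∀ {x y} → x ≋ y → ⊖ x ≋ ⊖ y
  ⊖-cong (mk≋ a b c d) = mk≋ (cong ℚ.-_ a) (cong ℚ.-_ b) (cong ℚ.-_ c) (cong ℚ.-_ d)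

  conj-cong : ∀ {x y} → x ≋ y → conj x ≋ conj y
  conj-cong (mk≋ a b c d) = mk≋ a (cong ℚ.-_ b) (cong ℚ.-_ c) (cong ℚ.-_ d)

  •-congˡ : ∀ r {x y} → x ≋ y → r • x ≋ r • y
  •-congˡ r (mk≋ a b c d) = mk≋ (cong (r ℚ.*_) a) (cong (r ℚ.*_) b) (cong (r ℚ.*_) c) (cong (r ℚ.*_) d)

  -- Identities with up to four quaternions X, Y, Z, W and one scalar R are read off
  -- from the product formulas by the ring solver, one coordinate at a time.
  private
    P = Polynomial 17

    open Symbolic 17 using () renaming (_·_ to _⊙_; _•_ to _⊡_; _⊕_ to _⊞_)

    R : P
    R = var (# 0)

    X Y Z W : Quaternion P
    X = quat (var (# 1)) (var (# 2)) (var (# 3)) (var (# 4))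
    Y = quat (var (# 5)) (var (# 6)) (var (# 7)) (var (# 8))
    Z = quat (var (# 9)) (var (# 10)) (var (# 11)) (var (# 12))
    W = quat (var (# 13)) (var (# 14)) (var (# 15)) (var (# 16))

    𝟙 : Quaternion P
    𝟙 = mapQ con 1q

    ⊟_ conjₚ : Quaternion P → Quaternion P
    ⊟ x = mapQ :-_ x
    conjₚ x = quat (re x) (:- im x) (:- jm x) (:- km x)

    Nmₚ : Quaternion P → P
    Nmₚ x = re x :* re x :+ im x :* im x :+ jm x :* jm x :+ km x :* km x

    comb : Quaternion P → Quaternion P
    comb c = re c ⊡ mapQ con 1q ⊞ im c ⊡ mapQ con I ⊞ jm c ⊡ mapQ con J ⊞ km c ⊡ mapQ con ω

    infix 8 ⊟_

    env : ℚ → (x y z w : Quaternion ℚ) → Vec ℚ 17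
    env r x y z w =
      r Vec.∷ re x Vec.∷ im x Vec.∷ jm x Vec.∷ km x
        Vec.∷ re y Vec.∷ im y Vec.∷ jm y Vec.∷ km y
        Vec.∷ re z Vec.∷ im z Vec.∷ jm z Vec.∷ km z
        Vec.∷ re w Vec.∷ im w Vec.∷ jm w Vec.∷ km w Vec.∷ Vec.[]

  opaque

    -- Opaque, so that a norm stays a single symbol: outside this block only `4Nm-halves` unfolds
    -- it, and everything else goes through the identities proved here.
    Nm : Quaternion ℚ → ℚ
    Nm x = re x ℚ.* re x ℚ.+ im x ℚ.* im x ℚ.+ jm x ℚ.* jm x ℚ.+ km x ℚ.* km x

    Nm-cong : ∀ {x y} → x ≋ y → Nm x ≡ Nm y
    Nm-cong (mk≋ a b c d) =
      cong₂ ℚ._+_ (cong₂ ℚ._+_ (cong₂ ℚ._+_ (cong₂ ℚ._*_ a a) (cong₂ ℚ._*_ b b)) (cong₂ ℚ._*_ c c)) (cong₂ ℚ._*_ d d)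

    Nm-1 : Nm 1q ≡ 1ℚ
    Nm-1 = refl

    Nm-· : ∀ x y → Nm (x · y) ≡ Nm x ℚ.* Nm y
    Nm-· x y = prove (env 0ℚ x y x x) (Nmₚ (X ⊙ Y)) (Nmₚ X :* Nmₚ Y) refl

    Nm-conj : ∀ x → Nm (conj x) ≡ Nm x
    Nm-conj x = prove (env 0ℚ x x x x) (Nmₚ (conjₚ X)) (Nmₚ X) refl

    Nm-• : ∀ r x → Nm (r • x) ≡ r ℚ.* r ℚ.* Nm x
    Nm-• r x = prove (env r x x x x) (Nmₚ (R ⊡ X)) (R :* R :* Nmₚ X) refl

    conj-· : ∀ x → conj x · x ≋ Nm x • 1q
    conj-· x = mk≋ (prove ρ (re l) (re r) refl) (prove ρ (im l) (im r) refl)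
                   (prove ρ (jm l) (jm r) refl) (prove ρ (km l) (km r) refl)
      where
      ρ : Vec ℚ 17
      ρ = env 0ℚ x x x x
      l : Quaternion P
      l = conjₚ X ⊙ X
      r : Quaternion P
      r = Nmₚ X ⊡ 𝟙

    -- Multiplying a remainder on the left by the conjugate of `y` turns division by `y` into
    -- division by a scalar. The factor `s`, later 4, makes that scalar the integer supplied by
    -- `4Nm-natural`.
    conj-remainder : ∀ s x y q →
      s • (conj y · (x ⊕ ⊖ (y · q))) ≋ s • (conj y · x) ⊕ ⊖ ((s ℚ.* Nm y) • q)
    conj-remainder s x y q = mk≋ (prove ρ (re l) (re r) refl) (prove ρ (im l) (im r) refl)
                                 (prove ρ (jm l) (jm r) refl) (prove ρ (km l) (km r) refl)
      where
      ρ : Vec ℚ 17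
      ρ = env s x y q x
      l : Quaternion P
      l = R ⊡ (conjₚ Y ⊙ (X ⊞ ⊟ (Y ⊙ Z)))
      r : Quaternion P
      r = R ⊡ (conjₚ Y ⊙ X) ⊞ ⊟ ((R :* Nmₚ Y) ⊡ Z)

  ·-distribˡ-⊕ : ∀ x y z → x · (y ⊕ z) ≋ x · y ⊕ x · z
  ·-distribˡ-⊕ x y z = mk≋ (prove ρ (re l) (re r) refl) (prove ρ (im l) (im r) refl)
                           (prove ρ (jm l) (jm r) refl) (prove ρ (km l) (km r) refl)
    where
    ρ = env 0ℚ x y z x
    l = X ⊙ (Y ⊞ Z)
    r = X ⊙ Y ⊞ X ⊙ Z

  ⊕-closed : ∀ {x y} → Hurwitz x → Hurwitz y → Hurwitz (x ⊕ y)
  ⊕-closed (span c₀ c₁ c₂ c₃ p₀ p₁ p₂ p₃ x≋) (span d₀ d₁ d₂ d₃ q₀ q₁ q₂ q₃ y≋) =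
    span _ _ _ _ (+-∈ p₀ q₀) (+-∈ p₁ q₁) (+-∈ p₂ q₂) (+-∈ p₃ q₃) (≋-trans (⊕-cong x≋ y≋)
      (mk≋ (prove ρ (re l) (re r) refl) (prove ρ (im l) (im r) refl)
           (prove ρ (jm l) (jm r) refl) (prove ρ (km l) (km r) refl)))
    where
    ρ = env 0ℚ (quat c₀ c₁ c₂ c₃) (quat d₀ d₁ d₂ d₃) 1q 1q
    l = comb X ⊞ comb Y
    r = comb (X ⊞ Y)

  •-closed : ∀ n {x} → Hurwitz x → Hurwitz (⟪ n ⟫ • x)
  •-closed n (span c₀ c₁ c₂ c₃ p₀ p₁ p₂ p₃ x≋) =
    span _ _ _ _ (*-∈ n∈ p₀) (*-∈ n∈ p₁) (*-∈ n∈ p₂) (*-∈ n∈ p₃) (≋-trans (•-congˡ ⟪ n ⟫ x≋)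
      (mk≋ (prove ρ (re l) (re r) refl) (prove ρ (im l) (im r) refl)
           (prove ρ (jm l) (jm r) refl) (prove ρ (km l) (km r) refl)))
    where
    n∈ = ⟪⟫∈ n
    ρ = env ⟪ n ⟫ (quat c₀ c₁ c₂ c₃) 1q 1q 1q
    l = R ⊡ comb X
    r = comb (R ⊡ X)

  ⊖-closed : ∀ {x} → Hurwitz x → Hurwitz (⊖ x)
  ⊖-closed (span c₀ c₁ c₂ c₃ p₀ p₁ p₂ p₃ x≋) =
    span _ _ _ _ (neg∈ p₀) (neg∈ p₁) (neg∈ p₂) (neg∈ p₃) (≋-trans (⊖-cong x≋)
      (mk≋ (prove ρ (re l) (re r) refl) (prove ρ (im l) (im r) refl)
           (prove ρ (jm l) (jm r) refl) (prove ρ (km l) (km r) refl)))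
    where
    ρ = env 0ℚ (quat c₀ c₁ c₂ c₃) 1q 1q 1q
    l = ⊟ comb X
    r = comb (⊟ X)

  conj-closed : ∀ {x} → Hurwitz x → Hurwitz (conj x)
  conj-closed (span c₀ c₁ c₂ c₃ p₀ p₁ p₂ p₃ x≋) =
    -- The conjugate of ω is 1 - ω, so the coefficient of ω also contributes to that of 1.
    span _ _ _ _ (+-∈ p₀ p₃) (neg∈ p₁) (neg∈ p₂) (neg∈ p₃) (≋-trans (conj-cong x≋)
      (mk≋ (prove ρ (re l) (re r) refl) (prove ρ (im l) (im r) refl)
           (prove ρ (jm l) (jm r) refl) (prove ρ (km l) (km r) refl)))
    where
    ρ = env 0ℚ (quat c₀ c₁ c₂ c₃) 1q 1q 1q
    l = conjₚ (comb X)
    r = comb (quat (re X :+ km X) (:- im X) (:- jm X) (:- km X))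

  -- Norms in half-integral coordinates.

  halves : (a b c d : ℤ) → Quaternion ℚ
  halves a b c d = quat (½ ℚ.* ⟪ a ⟫) (½ ℚ.* ⟪ b ⟫) (½ ℚ.* ⟪ c ⟫) (½ ℚ.* ⟪ d ⟫)

  4ℚ : ℚ
  4ℚ = ⟪ + 4 ⟫

  sumOfSquares : (a b c d : ℤ) → ℕ
  sumOfSquares a b c d = ∣ a ∣ ℕ.* ∣ a ∣ ℕ.+ ∣ b ∣ ℕ.* ∣ b ∣ ℕ.+ ∣ c ∣ ℕ.* ∣ c ∣ ℕ.+ ∣ d ∣ ℕ.* ∣ d ∣

  square-∣∣ : ∀ i → + (∣ i ∣ ℕ.* ∣ i ∣) ≡ i ℤ.* i
  square-∣∣ (+ n)      = ℤ.pos-* n n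
  square-∣∣ (-[1+ n ]) = refl

  ⟪square⟫ : ∀ i → ⟪ + (∣ i ∣ ℕ.* ∣ i ∣) ⟫ ≡ ⟪ i ⟫ ℚ.* ⟪ i ⟫
  ⟪square⟫ i = trans (cong ⟪_⟫ (square-∣∣ i)) (⟪⟫-* i i)

  ⟪+⟫ : ∀ m n {x y} → ⟪ + m ⟫ ≡ x → ⟪ + n ⟫ ≡ y → ⟪ + (m ℕ.+ n) ⟫ ≡ x ℚ.+ y
  ⟪+⟫ m n p q = trans (⟪⟫-+ (+ m) (+ n)) (cong₂ ℚ._+_ p q)

  opaque
    unfolding Nm

    4Nm-halves : ∀ a b c d → 4ℚ ℚ.* Nm (halves a b c d) ≡ ⟪ + sumOfSquares a b c d ⟫
    4Nm-halves a b c d = trans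
      (prove (env 0ℚ (quat ⟪ a ⟫ ⟪ b ⟫ ⟪ c ⟫ ⟪ d ⟫) 1q 1q 1q)
        (con 4ℚ :* Nmₚ (con ½ ⊡ X)) (Nmₚ X) refl)
      (sym (⟪+⟫ (a² ℕ.+ b² ℕ.+ c²) d² (⟪+⟫ (a² ℕ.+ b²) c² (⟪+⟫ a² b² (⟪square⟫ a) (⟪square⟫ b)) (⟪square⟫ c)) (⟪square⟫ d)))
      where
      a² : ℕ
      a² = ∣ a ∣ ℕ.* ∣ a ∣
      b² : ℕ
      b² = ∣ b ∣ ℕ.* ∣ b ∣
      c² : ℕ
      c² = ∣ c ∣ ℕ.* ∣ c ∣
      d² : ℕ
      d² = ∣ d ∣ ℕ.* ∣ d ∣

  Hurwitz⇒halves : ∀ {x} → Hurwitz x → ∃ λ a → ∃ λ b → ∃ λ c → ∃ λ d → x ≋ halves a b c d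
  Hurwitz⇒halves (span _ _ _ _ p₀ p₁ p₂ p₃ x≋) with integer p₀ | integer p₁ | integer p₂ | integer p₃
  ... | c₀ , refl | c₁ , refl | c₂ , refl | c₃ , refl =
    c₀ ℤ.+ c₀ ℤ.+ c₃ , c₁ ℤ.+ c₁ ℤ.+ c₃ , c₂ ℤ.+ c₂ ℤ.+ c₃ , c₃ , ≋-trans x≋ (mk≋
      (trans (prove ρ (re (comb X)) (con ½ :* (re X :+ re X :+ km X)) refl) (half c₀))
      (trans (prove ρ (im (comb X)) (con ½ :* (im X :+ im X :+ km X)) refl) (half c₁))
      (trans (prove ρ (jm (comb X)) (con ½ :* (jm X :+ jm X :+ km X)) refl) (half c₂))
      (prove ρ (km (comb X)) (con ½ :* km X) refl))
    where
    ρ = env 0ℚ (quat ⟪ c₀ ⟫ ⟪ c₁ ⟫ ⟪ c₂ ⟫ ⟪ c₃ ⟫) 1q 1q 1q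
    half : ∀ c → ½ ℚ.* (⟪ c ⟫ ℚ.+ ⟪ c ⟫ ℚ.+ ⟪ c₃ ⟫) ≡ ½ ℚ.* ⟪ c ℤ.+ c ℤ.+ c₃ ⟫
    half c = cong (½ ℚ.*_) (sym (trans (⟪⟫-+ (c ℤ.+ c) c₃) (cong (ℚ._+ ⟪ c₃ ⟫) (⟪⟫-+ c c))))

  -- The norm itself is integral on 𝒪, but seeing this takes a parity argument on the numerators.
  -- Four times the norm is visibly a sum of four integer squares and is just as good a measure for
  -- the Euclidean descent.
  4Nm-natural : ∀ {x} → Hurwitz x → ∃ λ n → 4ℚ ℚ.* Nm x ≡ ⟪ + n ⟫
  4Nm-natural x∈ = let (a , b , c , d , x≋) = Hurwitz⇒halves x∈ in
    sumOfSquares a b c d , trans (cong (4ℚ ℚ.*_) (Nm-cong x≋)) (4Nm-halves a b c d)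

  Nm≡0⇒≋0 : ∀ {x} → Hurwitz x → 4ℚ ℚ.* Nm x ≡ 0ℚ → x ≋ 0ℚ • 1q
  Nm≡0⇒≋0 x∈ eq with Hurwitz⇒halves x∈
  ... | a , b , c , d , x≋ = ≋-trans x≋ (mk≋ (half0 a ea) (half0 b eb) (half0 c ec) (half0 d ed))
    where
    sum≡0 : sumOfSquares a b c d ≡ 0
    sum≡0 = ℤ.+-injective (⟪⟫-injective (trans (sym (4Nm-halves a b c d))
      (trans (cong (4ℚ ℚ.*_) (sym (Nm-cong x≋))) eq)))
    square≡0 : ∀ i → ∣ i ∣ ℕ.* ∣ i ∣ ≡ 0 → i ≡ + 0
    square≡0 (+ zero) _ = refl
    ed = square≡0 d (ℕ.m+n≡0⇒n≡0 _ sum≡0)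
    s₃ = ℕ.m+n≡0⇒m≡0 _ sum≡0
    ec = square≡0 c (ℕ.m+n≡0⇒n≡0 (∣ a ∣ ℕ.* ∣ a ∣ ℕ.+ ∣ b ∣ ℕ.* ∣ b ∣) s₃)
    s₂ = ℕ.m+n≡0⇒m≡0 _ s₃
    eb = square≡0 b (ℕ.m+n≡0⇒n≡0 (∣ a ∣ ℕ.* ∣ a ∣) s₂)
    ea = square≡0 a (ℕ.m+n≡0⇒m≡0 _ s₂)
    half0 : ∀ i → i ≡ + 0 → ½ ℚ.* ⟪ i ⟫ ≡ 0ℚ
    half0 _ refl = refl

  -- Euclidean division and greatest common divisors.

  balanced-mod : ∀ t m .⦃ _ : ℕ.NonZero m ⦄ →
    ∃ λ k → ∃ λ u → t ≡ u ℤ.+ (+ m ℤ.* k ℤ.+ + m ℤ.* k) × ∣ u ∣ ℕ.≤ m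
  balanced-mod t (m@(suc _)) = k , + r ℤ.- + m , eq , bound
    where
    -- Shifting by m before reducing modulo 2m, and back afterwards, moves the remainders from [0,
    -- 2m) to [-m, m).
    s = t ℤ.+ + m
    r = s ℤ.%ℕ (m ℕ.+ m)
    k = s ℤ./ℕ (m ℕ.+ m)
    eq : t ≡ (+ r ℤ.- + m) ℤ.+ (+ m ℤ.* k ℤ.+ + m ℤ.* k)
    eq = begin
      t                                          ≡⟨ Sℤ.solve 2 (λ t m → t Sℤ.:= (t Sℤ.:+ m) Sℤ.:- m) refl t (+ m) ⟩
      s ℤ.- + m                                  ≡⟨ cong (ℤ._- + m) (ℤ.a≡a%ℕn+[a/ℕn]*n s (m ℕ.+ m)) ⟩
      + r ℤ.+ k ℤ.* (+ m ℤ.+ + m) ℤ.- + m        ≡⟨ Sℤ.solve 3 (λ r k m → r Sℤ.:+ k Sℤ.:* (m Sℤ.:+ m) Sℤ.:- m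
                                                      Sℤ.:= (r Sℤ.:- m) Sℤ.:+ (m Sℤ.:* k Sℤ.:+ m Sℤ.:* k)) refl (+ r) k (+ m) ⟩
      (+ r ℤ.- + m) ℤ.+ (+ m ℤ.* k ℤ.+ + m ℤ.* k) ∎
      where
      open ≡-Reasoning
      module Sℤ = ℤ.+-*-Solver
    bound : ∣ + r ℤ.- + m ∣ ℕ.≤ m
    bound rewrite ℤ.m-n≡m⊖n r m with ℕ.≤-total r m
    ... | inj₁ r≤m = ℕ.≤-trans (ℕ.≤-reflexive (ℤ.∣⊖∣-≤ r≤m)) (ℕ.m∸n≤m m r)
    ... | inj₂ m≤r = ℕ.≤-trans (ℕ.≤-reflexive (trans (ℤ.∣m⊖n∣≡∣n⊖m∣ r m) (ℤ.∣⊖∣-≤ m≤r)))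
                       (ℕ.m≤n+o⇒m∸n≤o r m (ℕ.<⇒≤ (ℤ.n%ℕd<d s (m ℕ.+ m))))

  -- Rounding the ω-coordinate first and the doubled coordinates 2cᵢ + c₃ afterwards
  -- leaves a remainder ½(u₀, u₁, u₂, r) with |uᵢ| ≤ m and 0 ≤ r < m.
  divide : ∀ {w} → Hurwitz w → ∀ m .⦃ _ : ℕ.NonZero m ⦄ →
    ∃ λ q → Hurwitz q × ∃ λ n →
      4ℚ ℚ.* Nm (w ⊕ ⊖ (⟪ + m ⟫ • q)) ≡ ⟪ + n ⟫ × n ℕ.< 4 ℕ.* (m ℕ.* m)
  divide {w} (span _ _ _ _ p₀ p₁ p₂ p₃ w≋) m with integer p₀ | integer p₁ | integer p₂ | integer p₃
  ... | c₀ , refl | c₁ , refl | c₂ , refl | c₃ , refl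
    -- Once a multiple of m ω is subtracted, the doubled coordinates are 2cᵢ + r. Changing cᵢ by m
    -- kᵢ changes them by 2 m kᵢ, hence the reduction modulo 2m.
    with balanced-mod (c₀ ℤ.+ c₀ ℤ.+ + (c₃ ℤ.%ℕ m)) m
       | balanced-mod (c₁ ℤ.+ c₁ ℤ.+ + (c₃ ℤ.%ℕ m)) m
       | balanced-mod (c₂ ℤ.+ c₂ ℤ.+ + (c₃ ℤ.%ℕ m)) m
  ... | k₀ , u₀ , e₀ , b₀ | k₁ , u₁ , e₁ , b₁ | k₂ , u₂ , e₂ , b₂ =
    combination ⟪ k₀ ⟫ ⟪ k₁ ⟫ ⟪ k₂ ⟫ ⟪ k₃ ⟫ ,
    span ⟪ k₀ ⟫ ⟪ k₁ ⟫ ⟪ k₂ ⟫ ⟪ k₃ ⟫ (⟪⟫∈ k₀) (⟪⟫∈ k₁) (⟪⟫∈ k₂) (⟪⟫∈ k₃) ≋-refl ,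
    sumOfSquares u₀ u₁ u₂ (+ r) ,
    trans (cong (4ℚ ℚ.*_) (Nm-cong remainder≋)) (4Nm-halves u₀ u₁ u₂ (+ r)) ,
    bound
    where
    r = c₃ ℤ.%ℕ m
    k₃ = c₃ ℤ./ℕ m
    ρ = env ⟪ + m ⟫ (quat ⟪ u₀ ⟫ ⟪ u₁ ⟫ ⟪ u₂ ⟫ ⟪ + r ⟫) (quat ⟪ k₀ ⟫ ⟪ k₁ ⟫ ⟪ k₂ ⟫ ⟪ k₃ ⟫) 1q 1q

    -- The ring solver cannot use the equations e₀, e₁, e₂, so each cᵢ is first eliminated in favour
    -- of uᵢ, kᵢ and r; the remainder then becomes a polynomial identity.
    undouble : ∀ c k u → c ℤ.+ c ℤ.+ + r ≡ u ℤ.+ (+ m ℤ.* k ℤ.+ + m ℤ.* k) →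
      ⟪ c ⟫ ≡ ½ ℚ.* (⟪ u ⟫ ℚ.+ (⟪ + m ⟫ ℚ.* ⟪ k ⟫ ℚ.+ ⟪ + m ⟫ ℚ.* ⟪ k ⟫) ℚ.- ⟪ + r ⟫)
    undouble c k u e = begin
      ⟪ c ⟫                                        ≡⟨ solve 2 (λ c r → c := con ½ :* (c :+ c :+ r :- r)) refl ⟪ c ⟫ ⟪ + r ⟫ ⟩
      ½ ℚ.* (⟪ c ⟫ ℚ.+ ⟪ c ⟫ ℚ.+ ⟪ + r ⟫ ℚ.- ⟪ + r ⟫) ≡⟨ cong (λ s → ½ ℚ.* (s ℚ.- ⟪ + r ⟫)) (begin
        ⟪ c ⟫ ℚ.+ ⟪ c ⟫ ℚ.+ ⟪ + r ⟫                  ≡⟨ cong (ℚ._+ ⟪ + r ⟫) (⟪⟫-+ c c) ⟨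
        ⟪ c ℤ.+ c ⟫ ℚ.+ ⟪ + r ⟫                      ≡⟨ ⟪⟫-+ (c ℤ.+ c) (+ r) ⟨
        ⟪ c ℤ.+ c ℤ.+ + r ⟫                          ≡⟨ cong ⟪_⟫ e ⟩
        ⟪ u ℤ.+ (+ m ℤ.* k ℤ.+ + m ℤ.* k) ⟫          ≡⟨ ⟪⟫-+ u _ ⟩
        ⟪ u ⟫ ℚ.+ ⟪ + m ℤ.* k ℤ.+ + m ℤ.* k ⟫        ≡⟨ cong (⟪ u ⟫ ℚ.+_) (⟪⟫-+ (+ m ℤ.* k) (+ m ℤ.* k)) ⟩
        ⟪ u ⟫ ℚ.+ (⟪ + m ℤ.* k ⟫ ℚ.+ ⟪ + m ℤ.* k ⟫)  ≡⟨ cong (λ s → ⟪ u ⟫ ℚ.+ (s ℚ.+ s)) (⟪⟫-* (+ m) k) ⟩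
        ⟪ u ⟫ ℚ.+ (⟪ + m ⟫ ℚ.* ⟪ k ⟫ ℚ.+ ⟪ + m ⟫ ℚ.* ⟪ k ⟫) ∎) ⟩
      ½ ℚ.* (⟪ u ⟫ ℚ.+ (⟪ + m ⟫ ℚ.* ⟪ k ⟫ ℚ.+ ⟪ + m ⟫ ℚ.* ⟪ k ⟫) ℚ.- ⟪ + r ⟫) ∎
      where open ≡-Reasoning

    c₃≡ : ⟪ c₃ ⟫ ≡ ⟪ + r ⟫ ℚ.+ ⟪ k₃ ⟫ ℚ.* ⟪ + m ⟫
    c₃≡ = trans (cong ⟪_⟫ (ℤ.a≡a%ℕn+[a/ℕn]*n c₃ m))
      (trans (⟪⟫-+ (+ r) (k₃ ℤ.* + m)) (cong (⟪ + r ⟫ ℚ.+_) (⟪⟫-* k₃ (+ m))))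

    dividend : P → P → P
    dividend u k = con ½ :* (u :+ (R :* k :+ R :* k) :- km X)

    l = comb (quat (dividend (re X) (re Y)) (dividend (im X) (im Y)) (dividend (jm X) (jm Y)) (km X :+ km Y :* R))
        ⊞ ⊟ (R ⊡ comb Y)
    h = con ½ ⊡ X

    remainder≋ : w ⊕ ⊖ (⟪ + m ⟫ • combination ⟪ k₀ ⟫ ⟪ k₁ ⟫ ⟪ k₂ ⟫ ⟪ k₃ ⟫) ≋ halves u₀ u₁ u₂ (+ r)
    remainder≋ = ≋-trans
      (⊕-cong (≋-trans w≋ (combination-cong (undouble c₀ k₀ u₀ e₀) (undouble c₁ k₁ u₁ e₁) (undouble c₂ k₂ u₂ e₂) c₃≡)) (≋-refl {⊖ (⟪ + m ⟫ • combination ⟪ k₀ ⟫ ⟪ k₁ ⟫ ⟪ k₂ ⟫ ⟪ k₃ ⟫)}))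
      (mk≋ (prove ρ (re l) (re h) refl) (prove ρ (im l) (im h) refl)
           (prove ρ (jm l) (jm h) refl) (prove ρ (km l) (km h) refl))
      where
      combination-cong : ∀ {a b c d a′ b′ c′ d′} → a ≡ a′ → b ≡ b′ → c ≡ c′ → d ≡ d′ →
        combination a b c d ≋ combination a′ b′ c′ d′
      combination-cong refl refl refl refl = ≋-refl

    -- Three squares are at most m² and the last is strictly smaller because r < m. This strictness
    -- is what ω buys: rounding all four coordinates over 1, I, J, IJ can leave a remainder of norm
    -- exactly m².
    bound : sumOfSquares u₀ u₁ u₂ (+ r) ℕ.< 4 ℕ.* (m ℕ.* m)
    bound = ℕ.<-≤-trans
      (ℕ.+-mono-≤-< (ℕ.+-mono-≤ (ℕ.+-mono-≤ (ℕ.*-mono-≤ b₀ b₀) (ℕ.*-mono-≤ b₁ b₁)) (ℕ.*-mono-≤ b₂ b₂))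
        (ℕ.*-mono-< r<m r<m))
      (ℕ.≤-reflexive (ℕ.+-*-Solver.solve 1 (λ s → s ℕ.+-*-Solver.:+ s ℕ.+-*-Solver.:+ s ℕ.+-*-Solver.:+ s
        ℕ.+-*-Solver.:= ℕ.+-*-Solver.con 4 ℕ.+-*-Solver.:* s) refl (m ℕ.* m)))
      where r<m = ℤ.n%ℕd<d c₃ m

  -- "Right" refers to the ideal x𝒪 + y𝒪, while divisibility is on the left: `gcd≋` puts the gcd
  -- into this right ideal, and `x≋` and `y≋` put the ideal into the multiples of the gcd.
  record RightGCD (x y : Quaternion ℚ) : Set where
    field
      {gcd a b x′ y′} : Quaternion ℚ
      gcd∈ : Hurwitz gcd
      a∈   : Hurwitz a
      b∈   : Hurwitz b
      x′∈  : Hurwitz x′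
      y′∈  : Hurwitz y′
      gcd≋ : gcd ≋ x · a ⊕ y · b
      x≋   : x ≋ gcd · x′
      y≋   : y ≋ gcd · y′

  euclid-step : ∀ x y q → RightGCD y (x ⊕ ⊖ (y · q)) → Hurwitz q → RightGCD x y
  euclid-step x y q g q∈ = record
    { gcd∈ = gcd∈ ; a∈ = b∈ ; b∈ = ⊕-closed a∈ (⊖-closed (·-closed q∈ b∈))
    ; x′∈ = ⊕-closed (·-closed x′∈ q∈) y′∈ ; y′∈ = x′∈
    ; gcd≋ = begin
        gcd                                      ≈⟨ gcd≋ ⟩
        y · a ⊕ (x ⊕ ⊖ (y · q)) · b              ≈⟨ ⊕-cong ≋-refl (expand (y · q)) ⟩
        y · a ⊕ (x · b ⊕ ⊖ ((y · q) · b))        ≈⟨ ⊕-cong ≋-refl (⊕-cong ≋-refl (⊖-cong (·-assoc y q b))) ⟩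
        y · a ⊕ (x · b ⊕ ⊖ (y · (q · b)))        ≈⟨ collect (x · b) (q · b) ⟩
        x · b ⊕ y · (a ⊕ ⊖ (q · b))              ∎
    ; x≋ = begin
        x                                   ≈⟨ remainder ⟩
        y · q ⊕ (x ⊕ ⊖ (y · q))             ≈⟨ ⊕-cong (·-cong x≋ ≋-refl) y≋ ⟩
        (gcd · x′) · q ⊕ gcd · y′           ≈⟨ ⊕-cong (·-assoc gcd x′ q) ≋-refl ⟩
        gcd · (x′ · q) ⊕ gcd · y′           ≈⟨ ·-distribˡ-⊕ gcd (x′ · q) y′ ⟨
        gcd · (x′ · q ⊕ y′)                 ∎
    ; y≋ = x≋
    }
    where
    open RightGCD g
    open SetoidReasoning (Monoid.setoid ℋ-*-monoid)

    expand : ∀ t → (x ⊕ ⊖ t) · b ≋ x · b ⊕ ⊖ (t · b)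
    expand t = mk≋ (prove ρ (re l) (re h) refl) (prove ρ (im l) (im h) refl)
                   (prove ρ (jm l) (jm h) refl) (prove ρ (km l) (km h) refl)
      where
      ρ = env 0ℚ x t b 1q
      l = (X ⊞ ⊟ Y) ⊙ Z
      h = X ⊙ Z ⊞ ⊟ (Y ⊙ Z)

    collect : ∀ s t → y · a ⊕ (s ⊕ ⊖ (y · t)) ≋ s ⊕ y · (a ⊕ ⊖ t)
    collect s t = mk≋ (prove ρ (re l) (re h) refl) (prove ρ (im l) (im h) refl)
                      (prove ρ (jm l) (jm h) refl) (prove ρ (km l) (km h) refl)
      where
      ρ = env 0ℚ y a s t
      l = X ⊙ Y ⊞ (Z ⊞ ⊟ (X ⊙ W))
      h = Z ⊞ X ⊙ (Y ⊞ ⊟ W)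

    remainder : x ≋ y · q ⊕ (x ⊕ ⊖ (y · q))
    remainder = mk≋ (prove ρ (re X) (re h) refl) (prove ρ (im X) (im h) refl)
                    (prove ρ (jm X) (jm h) refl) (prove ρ (km X) (km h) refl)
      where
      ρ = env 0ℚ x y q 1q
      h = Y ⊙ Z ⊞ (X ⊞ ⊟ (Y ⊙ Z))

  gcd-0 : ∀ {x y} → Hurwitz x → y ≋ 0ℚ • 1q → RightGCD x y
  gcd-0 {x} {y} x∈ y≋0 = record
    -- As y = 0, any Hurwitz coefficient b would do; 1 is at hand.
    { gcd∈ = x∈ ; a∈ = 𝒪.1q∈ ; b∈ = 𝒪.1q∈ ; x′∈ = 𝒪.1q∈ ; y′∈ = •-closed (+ 0) 𝒪.1q∈
    ; gcd≋ = ≋-sym (≋-trans (⊕-cong (·-identityʳ x) (·-identityʳ y)) (≋-trans (⊕-cong ≋-refl y≋0)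
        (mk≋ (ℚ.+-identityʳ _) (ℚ.+-identityʳ _) (ℚ.+-identityʳ _) (ℚ.+-identityʳ _))))
    ; x≋ = ≋-sym (·-identityʳ x)
    ; y≋ = ≋-trans y≋0 (≋-trans zero≋ (scalar-central 0ℚ x))
    }
    where
    zero≋ : 0ℚ • 1q ≋ (0ℚ • 1q) · x
    zero≋ = ≋-sym (≋-trans (scalar-· 0ℚ x) (mk≋ (ℚ.*-zeroˡ (re x)) (ℚ.*-zeroˡ (im x)) (ℚ.*-zeroˡ (jm x)) (ℚ.*-zeroˡ (km x))))

  4Nm-product : ∀ m k n {M N} → 4ℚ ℚ.* M ≡ ⟪ + m ⟫ → 4ℚ ℚ.* N ≡ ⟪ + k ⟫ →
    4ℚ ℚ.* (4ℚ ℚ.* 4ℚ ℚ.* (M ℚ.* N)) ≡ ⟪ + n ⟫ → n ≡ 4 ℕ.* (m ℕ.* k)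
  4Nm-product m k n {M} {N} m≡ k≡ n≡ = ℤ.+-injective (⟪⟫-injective (begin
    ⟪ + n ⟫                                       ≡⟨ n≡ ⟨
    4ℚ ℚ.* (4ℚ ℚ.* 4ℚ ℚ.* (M ℚ.* N))              ≡⟨ solve 3 (λ f a b → f :* (f :* f :* (a :* b)) := f :* ((f :* a) :* (f :* b))) refl 4ℚ M N ⟩
    4ℚ ℚ.* ((4ℚ ℚ.* M) ℚ.* (4ℚ ℚ.* N))            ≡⟨ cong (4ℚ ℚ.*_) (cong₂ ℚ._*_ m≡ k≡) ⟩
    4ℚ ℚ.* (⟪ + m ⟫ ℚ.* ⟪ + k ⟫)                  ≡⟨ cong (4ℚ ℚ.*_) (⟪⟫-* (+ m) (+ k)) ⟨
    4ℚ ℚ.* ⟪ + m ℤ.* + k ⟫                        ≡⟨ ⟪⟫-* (+ 4) (+ m ℤ.* + k) ⟨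
    ⟪ + 4 ℤ.* (+ m ℤ.* + k) ⟫                     ≡⟨ cong (λ i → ⟪ + 4 ℤ.* i ⟫) (ℤ.pos-* m k) ⟨
    ⟪ + 4 ℤ.* + (m ℕ.* k) ⟫                       ≡⟨ cong ⟪_⟫ (ℤ.pos-* 4 (m ℕ.* k)) ⟨
    ⟪ + (4 ℕ.* (m ℕ.* k)) ⟫                       ∎))
    where open ≡-Reasoning

  -- With r = x - yq, dividing 4ȳx by the integer m = 4 Nm y leaves the remainder 4ȳr. Its norm
  -- times 4 is 4 · 16 · Nm y · Nm r = 4mk, where k = 4 Nm r. The bound 4m² from `divide` thus reads
  -- 4mk < 4mm, and cancelling 4m leaves k < m.
  remainder-smaller : ∀ {x y} m .⦃ _ : ℕ.NonZero m ⦄ → Hurwitz x → Hurwitz y → 4ℚ ℚ.* Nm y ≡ ⟪ + m ⟫ →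
    ∃ λ q → Hurwitz q × ∃ λ n → 4ℚ ℚ.* Nm (x ⊕ ⊖ (y · q)) ≡ ⟪ + n ⟫ × n ℕ.< m
  remainder-smaller {x} {y} m x∈ y∈ m≡
    with divide (•-closed (+ 4) (·-closed (conj-closed y∈) x∈)) m
  ... | q , q∈ , n , n≡ , n< with 4Nm-natural (⊕-closed x∈ (⊖-closed (·-closed y∈ q∈)))
  ... | k , k≡ = q , q∈ , k , k≡ , ℕ.*-cancelˡ-< m k m (ℕ.*-cancelˡ-< 4 (m ℕ.* k) (m ℕ.* m)
      (subst (ℕ._< 4 ℕ.* (m ℕ.* m)) (4Nm-product m k n {Nm y} {Nm r} m≡ k≡ norms) n<))
    where
    r = x ⊕ ⊖ (y · q)
    open ≡-Reasoning
    norms : 4ℚ ℚ.* (4ℚ ℚ.* 4ℚ ℚ.* (Nm y ℚ.* Nm r)) ≡ ⟪ + n ⟫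
    norms = begin
      4ℚ ℚ.* (4ℚ ℚ.* 4ℚ ℚ.* (Nm y ℚ.* Nm r))                 ≡⟨ cong (λ t → 4ℚ ℚ.* (4ℚ ℚ.* 4ℚ ℚ.* t)) (trans (Nm-· (conj y) r) (cong (ℚ._* Nm r) (Nm-conj y))) ⟨
      4ℚ ℚ.* (4ℚ ℚ.* 4ℚ ℚ.* Nm (conj y · r))                 ≡⟨ cong (4ℚ ℚ.*_) (Nm-• 4ℚ (conj y · r)) ⟨
      4ℚ ℚ.* Nm (4ℚ • (conj y · r))                          ≡⟨ cong (4ℚ ℚ.*_) (Nm-cong (conj-remainder 4ℚ x y q)) ⟩
      4ℚ ℚ.* Nm (4ℚ • (conj y · x) ⊕ ⊖ ((4ℚ ℚ.* Nm y) • q))  ≡⟨ cong (λ t → 4ℚ ℚ.* Nm (4ℚ • (conj y · x) ⊕ ⊖ (t • q))) m≡ ⟩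
      4ℚ ℚ.* Nm (4ℚ • (conj y · x) ⊕ ⊖ (⟪ + m ⟫ • q))        ≡⟨ n≡ ⟩
      ⟪ + n ⟫                                                ∎

  rightGCD : ∀ {x y} → Hurwitz x → Hurwitz y → RightGCD x y
  rightGCD {x} {y} x∈ y∈ = let (n , n≡) = 4Nm-natural y∈ in <-rec Motive step n x y x∈ y∈ n≡
    where
    Motive : ℕ → Set
    Motive n = ∀ x y → Hurwitz x → Hurwitz y → 4ℚ ℚ.* Nm y ≡ ⟪ + n ⟫ → RightGCD x y
    step : ∀ n → (∀ {m} → m ℕ.< n → Motive m) → Motive n
    step zero      _   x y x∈ y∈ n≡ = gcd-0 {x} {y} x∈ (Nm≡0⇒≋0 {y} y∈ n≡)
    step n@(suc _) rec x y x∈ y∈ n≡ =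
      let (q , q∈ , k , k≡ , k<n) = remainder-smaller {x} {y} n x∈ y∈ n≡ in
      euclid-step x y q (rec k<n y (x ⊕ ⊖ (y · q)) y∈ (⊕-closed x∈ (⊖-closed (·-closed y∈ q∈))) k≡) q∈

  ·-• : ∀ r x y → x · (r • y) ≋ r • (x · y)
  ·-• r x y = begin
    x · (r • y)               ≈⟨ ·-cong (≋-refl {x}) (scalar-· r y) ⟨
    x · ((r • 1q) · y)        ≈⟨ ·-assoc x (r • 1q) y ⟨
    (x · (r • 1q)) · y        ≈⟨ ·-cong (scalar-central r x) (≋-refl {y}) ⟨
    ((r • 1q) · x) · y        ≈⟨ ·-assoc (r • 1q) x y ⟩
    (r • 1q) · (x · y)        ≈⟨ scalar-· r (x · y) ⟩
    r • (x · y)               ∎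
    where open SetoidReasoning (Monoid.setoid ℋ-*-monoid)

  -- y = Nm(y) Nm(x) y = Nm(y) x̄ when x y = 1.
  inverse-commutes : ∀ x y → x · y ≋ 1q → y · x ≋ 1q
  inverse-commutes x y xy = begin
    y · x                                    ≈⟨ ·-cong y≋ (≋-refl {x}) ⟩
    ((Nm y • 1q) · conj x) · x               ≈⟨ ·-assoc (Nm y • 1q) (conj x) x ⟩
    (Nm y • 1q) · (conj x · x)               ≈⟨ ·-cong (≋-refl {Nm y • 1q}) (conj-· x) ⟩
    (Nm y • 1q) · (Nm x • 1q)                ≈⟨ scalar-· (Nm y) (Nm x • 1q) ⟩
    Nm y • Nm x • 1q                         ≈⟨ •-assoc (Nm y) (Nm x) 1q ⟨
    (Nm y ℚ.* Nm x) • 1q                     ≈⟨ •-cong 1q Nm-yx ⟩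
    1ℚ • 1q                                  ≈⟨ •-identity 1q ⟩
    1q                                       ∎
    where
    open SetoidReasoning (Monoid.setoid ℋ-*-monoid)
    Nm-yx : Nm y ℚ.* Nm x ≡ 1ℚ
    Nm-yx = trans (ℚ.*-comm (Nm y) (Nm x)) (trans (sym (Nm-· x y)) (trans (Nm-cong xy) Nm-1))
    y≋ : y ≋ (Nm y • 1q) · conj x
    y≋ = begin
      y                                      ≈⟨ •-identity y ⟨
      1ℚ • y                                 ≈⟨ •-cong y Nm-yx ⟨
      (Nm y ℚ.* Nm x) • y                    ≈⟨ •-assoc (Nm y) (Nm x) y ⟩
      Nm y • Nm x • y                        ≈⟨ •-congˡ (Nm y) (scalar-· (Nm x) y) ⟨
      Nm y • ((Nm x • 1q) · y)               ≈⟨ •-congˡ (Nm y) (·-cong (conj-· x) (≋-refl {y})) ⟨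
      Nm y • ((conj x · x) · y)              ≈⟨ •-congˡ (Nm y) (·-assoc (conj x) x y) ⟩
      Nm y • (conj x · (x · y))              ≈⟨ •-congˡ (Nm y) (·-cong (≋-refl {conj x}) xy) ⟩
      Nm y • (conj x · 1q)                   ≈⟨ •-congˡ (Nm y) (·-identityʳ (conj x)) ⟩
      Nm y • conj x                          ≈⟨ scalar-· (Nm y) (conj x) ⟨
      (Nm y • 1q) · conj x                   ∎

open HurwitzOrder
open 𝒪 using () renaming (𝒪_S to Hurwitz)

-- Integral matrices and the lattices they span.

module IntegralMatrices (K : CommutativeRing 0ℓ 0ℓ) (𝒪ₖ : Pred (CommutativeRing.Carrier K) 0ℓ)
  (+-closed : ∀ {x y} → 𝒪ₖ x → 𝒪ₖ y → 𝒪ₖ (CommutativeRing._+_ K x y))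
  (*-closed : ∀ {x y} → 𝒪ₖ x → 𝒪ₖ y → 𝒪ₖ (CommutativeRing._*_ K x y))
  where

  private module K = CommutativeRing K
  open K using (_+_; _*_; -_; _≈_; 0#; 1#)
  open Matrices K.rawRing
  open Lattices K 𝒪ₖ renaming (≋-refl to ≋ₘ-refl)
  open Matrix
  open Vector
  open Lattice
  open NatSolver K.commutativeSemiring using (solve; _:=_; _:+_; _:*_; con)

  Integral : Pred (Matrix K.Carrier) 0ℓ
  Integral = Entries 𝒪ₖ

  ·-integral : ∀ M N → Integral M → Integral N → Integral (M · N)
  ·-integral _ _ (a , b , c , d) (a′ , b′ , c′ , d′) =
    +-closed (*-closed a a′) (*-closed b c′) , +-closed (*-closed a b′) (*-closed b d′) ,
    +-closed (*-closed c a′) (*-closed d c′) , +-closed (*-closed c b′) (*-closed d d′)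

  ⊕-integral : ∀ M N → Integral M → Integral N → Integral (M ⊕ N)
  ⊕-integral _ _ (a , b , c , d) (a′ , b′ , c′ , d′) =
    +-closed a a′ , +-closed b b′ , +-closed c c′ , +-closed d d′

  matrixSetoid : Setoid 0ℓ 0ℓ
  matrixSetoid = record
    { Carrier = Matrix K.Carrier ; _≈_ = _≋_
    ; isEquivalence = record
      { refl  = ≋ₘ-refl
      ; sym   = λ (mk≋ a b c d) → mk≋ (K.sym a) (K.sym b) (K.sym c) (K.sym d)
      ; trans = λ (mk≋ a b c d) (mk≋ a′ b′ c′ d′) →
          mk≋ (K.trans a a′) (K.trans b b′) (K.trans c c′) (K.trans d d′)
      }
    }

  ⊕-congₘ : ∀ {M M′ N N′} → M ≋ M′ → N ≋ N′ → M ⊕ N ≋ M′ ⊕ N′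
  ⊕-congₘ (mk≋ a b c d) (mk≋ a′ b′ c′ d′) =
    mk≋ (K.+-cong a a′) (K.+-cong b b′) (K.+-cong c c′) (K.+-cong d d′)

  ·-congₘ : ∀ {M M′ N N′} → M ≋ M′ → N ≋ N′ → M · N ≋ M′ · N′
  ·-congₘ (mk≋ a b c d) (mk≋ a′ b′ c′ d′) = mk≋
    (K.+-cong (K.*-cong a a′) (K.*-cong b c′)) (K.+-cong (K.*-cong a b′) (K.*-cong b d′))
    (K.+-cong (K.*-cong c a′) (K.*-cong d c′)) (K.+-cong (K.*-cong c b′) (K.*-cong d d′))

  •-congₘ : ∀ r {M N} → M ≋ N → r • M ≋ r • N
  •-congₘ r (mk≋ a b c d) = mk≋ (K.*-congˡ a) (K.*-congˡ b) (K.*-congˡ c) (K.*-congˡ d)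

  ·-assocₘ : ∀ M N Q → (M · N) · Q ≋ M · (N · Q)
  ·-assocₘ M N Q = mk≋ (eq _ _ _ _ _ _ _ _) (eq _ _ _ _ _ _ _ _) (eq _ _ _ _ _ _ _ _) (eq _ _ _ _ _ _ _ _)
    where
    eq = solve 8 (λ a b p q r s x y →
           (a :* p :+ b :* r) :* x :+ (a :* q :+ b :* s) :* y :=
           a :* (p :* x :+ q :* y) :+ b :* (r :* x :+ s :* y)) K.refl

  ·-distribˡₘ : ∀ M N Q → M · (N ⊕ Q) ≋ M · N ⊕ M · Q
  ·-distribˡₘ M N Q = mk≋ (eq _ _ _ _ _ _) (eq _ _ _ _ _ _) (eq _ _ _ _ _ _) (eq _ _ _ _ _ _)
    where
    eq = solve 6 (λ a b p q r s →
           a :* (p :+ q) :+ b :* (r :+ s) := (a :* p :+ b :* r) :+ (a :* q :+ b :* s)) K.refl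

  ·-distribʳₘ : ∀ M N Q → (N ⊕ Q) · M ≋ N · M ⊕ Q · M
  ·-distribʳₘ M N Q = mk≋ (eq _ _ _ _ _ _) (eq _ _ _ _ _ _) (eq _ _ _ _ _ _) (eq _ _ _ _ _ _)
    where
    eq = solve 6 (λ a b p q r s →
           (p :+ q) :* a :+ (r :+ s) :* b := (p :* a :+ r :* b) :+ (q :* a :+ s :* b)) K.refl

  ⊕-assocₘ : ∀ M N Q → (M ⊕ N) ⊕ Q ≋ M ⊕ (N ⊕ Q)
  ⊕-assocₘ M N Q = mk≋ (K.+-assoc _ _ _) (K.+-assoc _ _ _) (K.+-assoc _ _ _) (K.+-assoc _ _ _)

  •-⊕ₘ : ∀ r M N → r • M ⊕ r • N ≋ r • (M ⊕ N)
  •-⊕ₘ r M N = mk≋ (eq _ _) (eq _ _) (eq _ _) (eq _ _)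
    where eq = λ x y → K.sym (K.distribˡ r x y)

  •-·ₘ : ∀ r M N → (r • M) · N ≋ r • (M · N)
  •-·ₘ r M N = mk≋ (eq _ _ _ _ _) (eq _ _ _ _ _) (eq _ _ _ _ _) (eq _ _ _ _ _)
    where eq = solve 5 (λ r a b x y → (r :* a) :* x :+ (r :* b) :* y := r :* (a :* x :+ b :* y)) K.refl

  ·-•ₘ : ∀ r M N → M · (r • N) ≋ r • (M · N)
  ·-•ₘ r M N = mk≋ (eq _ _ _ _ _) (eq _ _ _ _ _) (eq _ _ _ _ _) (eq _ _ _ _ _)
    where eq = solve 5 (λ r a b x y → a :* (r :* x) :+ b :* (r :* y) := r :* (a :* x :+ b :* y)) K.refl

  •-assocₘ : ∀ r s M → (r * s) • M ≋ r • s • M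
  •-assocₘ r s M = mk≋ (K.*-assoc _ _ _) (K.*-assoc _ _ _) (K.*-assoc _ _ _) (K.*-assoc _ _ _)

  •-congʳₘ : ∀ {r s} M → r ≈ s → r • M ≋ s • M
  •-congʳₘ M r≈s = mk≋ (K.*-congʳ r≈s) (K.*-congʳ r≈s) (K.*-congʳ r≈s) (K.*-congʳ r≈s)

  •-identityₘ : ∀ M → 1# • M ≋ M
  •-identityₘ M = mk≋ (K.*-identityˡ _) (K.*-identityˡ _) (K.*-identityˡ _) (K.*-identityˡ _)

  ·-identityˡₘ : ∀ M → 1ₘ · M ≋ M
  ·-identityˡₘ M = mk≋ (1·x+0·y _ _) (1·x+0·y _ _) (0·x+1·y _ _) (0·x+1·y _ _)

  columns : Lattice → Matrix K.Carrier
  columns L = mat (x₁ (b₁ L)) (x₁ (b₂ L)) (x₂ (b₁ L)) (x₂ (b₂ L))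

  columns-$ : ∀ L u v → columns L $ᵥ vec u v ≋ᵥ combo u (b₁ L) v (b₂ L)
  columns-$ L u v = mk≋ (eq _ _) (eq _ _)
    where
    eq : ∀ x y → x * u + y * v ≈ u * x + v * y
    eq x y = K.+-cong (K.*-comm x u) (K.*-comm y v)

  $-integral : ∀ M u → Integral M → 𝒪ₖ (x₁ u) → 𝒪ₖ (x₂ u) → 𝒪ₖ (x₁ (M $ᵥ u)) × 𝒪ₖ (x₂ (M $ᵥ u))
  $-integral _ _ (a , b , c , d) p q = +-closed (*-closed a p) (*-closed b q) , +-closed (*-closed c p) (*-closed d q)

  standard-∈ : ∀ u → 𝒪ₖ (x₁ u) → 𝒪ₖ (x₂ u) → u ∈ₗ standardLattice
  standard-∈ u p q = x₁ u , x₂ u , p , q , mk≋ (K.sym (x·1+y·0 _ _)) (K.sym (x·0+y·1 _ _))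

  -- g 𝒪² = c B 𝒪² as soon as each of g and c B is a right multiple of the other
  -- by an integral matrix.
  image-standard : ∀ A L (c : Unit K.*-monoid) C D → Integral C → Integral D →
    GL₂.g A ≋ (Unit.val c • columns L) · C → Unit.val c • columns L ≋ GL₂.g A · D →
    image A standardLattice ∼ L
  -- The image is c L, so L is recovered from it by the factor c⁻¹.
  image-standard A L c C D C∈ D∈ g≋ cB≋ = homothety (Group._⁻¹ (unitGroup K.*-monoid) c) λ v → mk⇔
    (λ (z₁ , z₂ , p₁ , p₂ , v≋) →
      let (q₁ , q₂) = $-integral D (vec z₁ z₂) D∈ p₁ p₂ in
      g $ᵥ D $ᵥ vec z₁ z₂ , ∈-image A standardLattice (standard-∈ (D $ᵥ vec z₁ z₂) q₁ q₂) , (begin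
        v                                                       ≈⟨ v≋ ⟩
        combo z₁ (b₁ L) z₂ (b₂ L)                               ≈⟨ columns-$ L z₁ z₂ ⟨
        B $ᵥ vec z₁ z₂                                          ≈⟨ unscale (B $ᵥ vec z₁ z₂) ⟨
        Unit.inv c *ᵥ Unit.val c *ᵥ B $ᵥ vec z₁ z₂              ≈⟨ *ᵥ-cong K.refl (•-$ (Unit.val c) B (vec z₁ z₂)) ⟨
        Unit.inv c *ᵥ (Unit.val c • B) $ᵥ vec z₁ z₂             ≈⟨ *ᵥ-cong K.refl ($-cong cB≋ ≋ᵥ-refl) ⟩
        Unit.inv c *ᵥ (g · D) $ᵥ vec z₁ z₂                      ≈⟨ *ᵥ-cong K.refl ($-assoc g D (vec z₁ z₂)) ⟩
        Unit.inv c *ᵥ g $ᵥ D $ᵥ vec z₁ z₂                       ∎))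
    (λ (w , w∈ , v≋) →
      let (z₁ , z₂ , p₁ , p₂ , w≋) = image-∈ A standardLattice w∈
          (q₁ , q₂) = $-integral C (vec z₁ z₂) C∈ p₁ p₂
          y = C $ᵥ vec z₁ z₂
      in x₁ y , x₂ y , q₁ , q₂ , (begin
        v                                                       ≈⟨ v≋ ⟩
        Unit.inv c *ᵥ w                                         ≈⟨ *ᵥ-cong K.refl (undoʳ A w) ⟨
        Unit.inv c *ᵥ g $ᵥ GL₂.g⁻¹ A $ᵥ w                       ≈⟨ *ᵥ-cong K.refl ($-cong g≋ (≋ᵥ-trans w≋ (mk≋ (x·1+y·0 _ _) (x·0+y·1 _ _)))) ⟩
        Unit.inv c *ᵥ ((Unit.val c • B) · C) $ᵥ vec z₁ z₂       ≈⟨ *ᵥ-cong K.refl ($-assoc (Unit.val c • B) C (vec z₁ z₂)) ⟩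
        Unit.inv c *ᵥ (Unit.val c • B) $ᵥ y                     ≈⟨ *ᵥ-cong K.refl (•-$ (Unit.val c) B y) ⟩
        Unit.inv c *ᵥ Unit.val c *ᵥ B $ᵥ y                      ≈⟨ unscale (B $ᵥ y) ⟩
        B $ᵥ y                                                  ≈⟨ $-cong ≋ₘ-refl (mk≋ K.refl K.refl) ⟩
        B $ᵥ vec (x₁ y) (x₂ y)                                  ≈⟨ columns-$ L (x₁ y) (x₂ y) ⟩
        combo (x₁ y) (b₁ L) (x₂ y) (b₂ L)                       ∎))
    where
    open SetoidReasoning vectorSetoid
    open GL₂ A using (g)
    B = columns L
    unscale : ∀ v → Unit.inv c *ᵥ Unit.val c *ᵥ v ≋ᵥ v
    unscale v = begin
      Unit.inv c *ᵥ Unit.val c *ᵥ v      ≈⟨ *ᵥ-assoc _ _ v ⟨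
      (Unit.inv c * Unit.val c) *ᵥ v     ≈⟨ *ᵥ-cong (Unit.inverseˡ c) ≋ᵥ-refl ⟩
      1# *ᵥ v                            ≈⟨ *ᵥ-identity v ⟩
      v                                  ∎

  -- Determinants and adjugates.

  open RingProperties K.ring using (-‿distribˡ-*; -‿distribʳ-*; -‿involutive; -‿+-comm)

  -- The sign is attached to the entry a₂₁, so that with -a₂₁ as a variable the determinant is a
  -- semiring expression, as the solver requires.
  det : Matrix K.Carrier → K.Carrier
  det M = a₁₁ M * a₂₂ M + a₁₂ M * - a₂₁ M

  adj : Matrix K.Carrier → Matrix K.Carrier
  adj M = mat (a₂₂ M) (- a₁₂ M) (- a₂₁ M) (a₁₁ M)

  neg-swap : ∀ x y → x * - y ≈ - x * y
  neg-swap x y = K.trans (K.sym (-‿distribʳ-* x y)) (-‿distribˡ-* x y)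

  ·-adj : ∀ M → M · adj M ≋ det M • 1ₘ
  ·-adj M = mk≋ (K.sym (K.*-identityʳ _))
    (begin
      a * - b + b * a     ≈⟨ K.+-congˡ (K.*-comm b a) ⟩
      a * - b + a * b     ≈⟨ K.distribˡ a (- b) b ⟨
      a * (- b + b)       ≈⟨ K.*-congˡ (K.-‿inverseˡ b) ⟩
      a * 0#              ≈⟨ K.zeroʳ a ⟩
      0#                  ≈⟨ K.zeroʳ _ ⟨
      det M * 0#          ∎)
    (begin
      c * d + d * - c     ≈⟨ K.+-congʳ (K.*-comm c d) ⟩
      d * c + d * - c     ≈⟨ K.distribˡ d c (- c) ⟨
      d * (c + - c)       ≈⟨ K.*-congˡ (K.-‿inverseʳ c) ⟩
      d * 0#              ≈⟨ K.zeroʳ d ⟩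
      0#                  ≈⟨ K.zeroʳ _ ⟨
      det M * 0#          ∎)
    (begin
      c * - b + d * a     ≈⟨ K.+-cong (K.trans (neg-swap c b) (K.*-comm (- c) b)) (K.*-comm d a) ⟩
      b * - c + a * d     ≈⟨ K.+-comm _ _ ⟩
      det M               ≈⟨ K.*-identityʳ _ ⟨
      det M * 1#          ∎)
    where
    open SetoidReasoning K.setoid
    a = a₁₁ M
    b = a₁₂ M
    c = a₂₁ M
    d = a₂₂ M

  -- det M det N = (x − y)(u − v) with the notation below; the solver only knows
  -- semirings, so it is used on x u + y v = 1 + (y u + x v).
  det-unit : ∀ M N → M · N ≋ 1ₘ → ∃ λ e → det M * e ≈ 1#
  det-unit M N (mk≋ e₁₁ e₁₂ e₂₁ e₂₂) = u + - v , (begin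
    (x + a₁₂ M * - a₂₁ M) * (u + - v)      ≈⟨ K.*-congʳ (K.+-congˡ (-‿distribʳ-* _ _)) ⟨
    (x + - y) * (u + - v)                  ≈⟨ solve 4 (λ x y u v → (x :+ y) :* (u :+ v) := (x :* u :+ y :* v) :+ (y :* u :+ x :* v)) K.refl x (- y) u (- v) ⟩
    (x * u + - y * - v) + (- y * u + x * - v)  ≈⟨ K.+-cong (K.+-congˡ neg-neg) neg-sum ⟩
    (x * u + y * v) + - w                  ≈⟨ K.+-congʳ expanded ⟩
    (1# + w) + - w                         ≈⟨ K.+-assoc 1# w (- w) ⟩
    1# + (w + - w)                         ≈⟨ K.+-congˡ (K.-‿inverseʳ w) ⟩
    1# + 0#                                ≈⟨ K.+-identityʳ 1# ⟩
    1#                                     ∎)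
    where
    open SetoidReasoning K.setoid
    x = a₁₁ M * a₂₂ M
    y = a₁₂ M * a₂₁ M
    u = a₁₁ N * a₂₂ N
    v = a₁₂ N * a₂₁ N
    w = y * u + x * v
    neg-neg : - y * - v ≈ y * v
    neg-neg = begin
      - y * - v      ≈⟨ -‿distribˡ-* y (- v) ⟨
      - (y * - v)    ≈⟨ K.-‿cong (-‿distribʳ-* y v) ⟨
      - - (y * v)    ≈⟨ -‿involutive _ ⟩
      y * v          ∎
    neg-sum : - y * u + x * - v ≈ - w
    neg-sum = begin
      - y * u + x * - v        ≈⟨ K.+-cong (-‿distribˡ-* y u) (-‿distribʳ-* x v) ⟨
      - (y * u) + - (x * v)    ≈⟨ -‿+-comm (y * u) (x * v) ⟩
      - w                      ∎
    -- This is det (M N) = det M det N with every negative term moved to the other side; the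
    -- off-diagonal entries of M N supply the product 0 · 0 and the diagonal ones 1 · 1.
    expanded : x * u + y * v ≈ 1# + w
    expanded = begin
      x * u + y * v                ≈⟨ K.+-identityˡ _ ⟨
      0# + (x * u + y * v)         ≈⟨ K.+-congʳ (K.zeroˡ 0#) ⟨
      0# * 0# + (x * u + y * v)    ≈⟨ K.+-congʳ (K.*-cong e₂₁ e₁₂) ⟨
      (a₂₁ M * a₁₁ N + a₂₂ M * a₂₁ N) * (a₁₁ M * a₁₂ N + a₁₂ M * a₂₂ N) + (x * u + y * v)
        ≈⟨ solve 8 (λ a b c d a′ b′ c′ d′ →
             (c :* a′ :+ d :* c′) :* (a :* b′ :+ b :* d′) :+ ((a :* d) :* (a′ :* d′) :+ (b :* c) :* (b′ :* c′)) :=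
             (a :* a′ :+ b :* c′) :* (c :* b′ :+ d :* d′) :+ ((b :* c) :* (a′ :* d′) :+ (a :* d) :* (b′ :* c′)))
             K.refl (a₁₁ M) (a₁₂ M) (a₂₁ M) (a₂₂ M) (a₁₁ N) (a₁₂ N) (a₂₁ N) (a₂₂ N) ⟩
      (a₁₁ M * a₁₁ N + a₁₂ M * a₂₁ N) * (a₂₁ M * a₁₂ N + a₂₂ M * a₂₂ N) + w  ≈⟨ K.+-congʳ (K.*-cong e₁₁ e₂₂) ⟩
      1# * 1# + w                  ≈⟨ K.+-congʳ (K.*-identityˡ 1#) ⟩
      1# + w                       ∎

  -- The coordinates of the two standard vectors in the basis of L form a right inverse of the
  -- matrix of columns.
  columns-det-unit : ∀ L → ∃ λ e → det (columns L) * e ≈ 1#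
  columns-det-unit L =
    let (c₁₁ , c₂₁ , e₁) = IsBasis.spanning (isBasis L) (vec 1# 0#)
        (c₁₂ , c₂₂ , e₂) = IsBasis.spanning (isBasis L) (vec 0# 1#)
        (mk≋ p₁₁ p₂₁) = ≋ᵥ-trans (columns-$ L c₁₁ c₂₁) (≋ᵥ-sym e₁)
        (mk≋ p₁₂ p₂₂) = ≋ᵥ-trans (columns-$ L c₁₂ c₂₂) (≋ᵥ-sym e₂)
    in det-unit (columns L) (mat c₁₁ c₁₂ c₂₁ c₂₂) (mk≋ p₁₁ p₁₂ p₂₁ p₂₂)

  det-• : ∀ r M → det (r • M) ≈ (r * r) * det M
  det-• r M = begin
    (r * a₁₁ M) * (r * a₂₂ M) + (r * a₁₂ M) * - (r * a₂₁ M)    ≈⟨ K.+-congˡ (K.*-congˡ (-‿distribʳ-* r _)) ⟩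
    (r * a₁₁ M) * (r * a₂₂ M) + (r * a₁₂ M) * (r * - a₂₁ M)    ≈⟨ solve 5 (λ r a b c d →
      (r :* a) :* (r :* d) :+ (r :* b) :* (r :* c) := (r :* r) :* (a :* d :+ b :* c)) K.refl r (a₁₁ M) (a₁₂ M) (- a₂₁ M) (a₂₂ M) ⟩
    (r * r) * det M                                            ∎
    where
    open SetoidReasoning K.setoid

-- What the local argument asks of ℤₚ and ℚₚ.

module Congruence (K : CommutativeRing 0ℓ 0ℓ) (𝒪ₖ : Pred (CommutativeRing.Carrier K) 0ℓ) where
  open CommutativeRing K using (Carrier; _+_; _*_; _≈_)

  -- Both directions are kept because both are consumed: one shows that the approximation lies in
  -- the right ideal of B, the other that B lies in the right ideal of the gcd.
  record _≡_[mod_] (x y m : Carrier) : Set where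
    field
      quotient quotient′ : Carrier
      quotient∈  : 𝒪ₖ quotient
      quotient′∈ : 𝒪ₖ quotient′
      eq  : x ≈ y + m * quotient
      eq′ : y ≈ x + m * quotient′

-- What is used of a ring of fractions K of ℤₚ and its subset 𝒪ₖ of integers.
record LocalRing (K : CommutativeRing 0ℓ 0ℓ) (𝒪ₖ : Pred (CommutativeRing.Carrier K) 0ℓ)
                 (fromℚ : ℚ → CommutativeRing.Carrier K) (p : ℕ) : Set where
  private module K = CommutativeRing K
  open K using (_+_; _*_; -_; _≈_; 1#)

  open Congruence K 𝒪ₖ

  field
    +-closed    : ∀ {x y} → 𝒪ₖ x → 𝒪ₖ y → 𝒪ₖ (x + y)
    *-closed    : ∀ {x y} → 𝒪ₖ x → 𝒪ₖ y → 𝒪ₖ (x * y)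
    neg-closed  : ∀ {x} → 𝒪ₖ x → 𝒪ₖ (- x)
    resp        : ∀ {x y} → x ≈ y → 𝒪ₖ x → 𝒪ₖ y
    ℤ⊆𝒪ₖ        : ∀ n → 𝒪ₖ (fromℚ ⟪ n ⟫)
    denominator : ∀ x → ∃ λ (c : Unit K.*-monoid) → 𝒪ₖ (Unit.val c) × 𝒪ₖ (Unit.val c * x)
    -- Invertibility in K is the positive form of x ≠ 0: the inverse carries the information from
    -- which n is found.
    divides-pow : ∀ {x} → 𝒪ₖ x → (∃ λ y → x * y ≈ 1#) →
                  ∃ λ n → ∃ λ t → 𝒪ₖ t × x * t ≈ fromℚ ⟪ + (p ℕ.^ n) ⟫
    approximate : ∀ n {x} → 𝒪ₖ x → ∃ λ a → fromℚ ⟪ a ⟫ ≡ x [mod fromℚ ⟪ + (p ℕ.^ n) ⟫ ]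
    invert      : ∀ a → ¬ + p ℤ.∣ a → ∃ λ t → 𝒪ₖ t × fromℚ ⟪ a ⟫ * t ≈ 1#

-- Global generators of local right ideals.

module IntegralGenerators (K : CommutativeRing 0ℓ 0ℓ) (𝒪ₖ : Pred (CommutativeRing.Carrier K) 0ℓ)
  (fromℚ : ℚ → CommutativeRing.Carrier K)
  (isHom : IsRingHomomorphism ℚ.+-*-rawRing (CommutativeRing.rawRing K) fromℚ)
  (p : ℕ) (local : LocalRing K 𝒪ₖ fromℚ p)
  (σ : OverExtension.Splitting K 𝒪ₖ fromℚ isHom)
  where

  private module K = CommutativeRing K
  open K using (_+_; _*_; -_; _≈_; 0#; 1#)
  open LocalRing local
  open Congruence K 𝒪ₖ
  open OverExtension K 𝒪ₖ fromℚ isHom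
  open Splitting σ
  open TreeAction σ
  open Quaternion
  open Matrix
  open IntegralMatrices K 𝒪ₖ +-closed *-closed
  open Lattices K 𝒪ₖ using () renaming (≋-refl to ≋ₘ-refl)
  open Matrices K.rawRing using (_≋_; mk≋; _·_; _⊕_; _•_; 1ₘ)
  open NatSolver K.commutativeSemiring using (solve; _:=_; _:+_; _:*_; con)
  private
    module ℋₖ = Quaternions K.rawRing
    module φ = RingMorphisms.IsRingIsomorphism isRingIso
    module M = Setoid matrixSetoid

  combinationₖ : (c₀ c₁ c₂ c₃ : K.Carrier) → Quaternion K.Carrier
  combinationₖ c₀ c₁ c₂ c₃ = c₀ ℋₖ.• ι ℋ.1q ℋₖ.⊕ c₁ ℋₖ.• ι I ℋₖ.⊕ c₂ ℋₖ.• ι J ℋₖ.⊕ c₃ ℋₖ.• ι ω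

  ι-combination : ∀ c₀ c₁ c₂ c₃ →
    ι (𝒪.combination c₀ c₁ c₂ c₃) ℋₖ.≋ combinationₖ (fromℚ c₀) (fromℚ c₁) (fromℚ c₂) (fromℚ c₃)
  ι-combination c₀ c₁ c₂ c₃ = ℋₖ.mk≋
    (add (add (add (mul c₀ _) (mul c₁ _)) (mul c₂ _)) (mul c₃ _))
    (add (add (add (mul c₀ _) (mul c₁ _)) (mul c₂ _)) (mul c₃ _))
    (add (add (add (mul c₀ _) (mul c₁ _)) (mul c₂ _)) (mul c₃ _))
    (add (add (add (mul c₀ _) (mul c₁ _)) (mul c₂ _)) (mul c₃ _))

  ℋₖ-sym : ∀ {x y} → x ℋₖ.≋ y → y ℋₖ.≋ x
  ℋₖ-sym (ℋₖ.mk≋ a b c d) = ℋₖ.mk≋ (K.sym a) (K.sym b) (K.sym c) (K.sym d)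

  ℋₖ-trans : ∀ {x y z} → x ℋₖ.≋ y → y ℋₖ.≋ z → x ℋₖ.≋ z
  ℋₖ-trans (ℋₖ.mk≋ a b c d) (ℋₖ.mk≋ a′ b′ c′ d′) =
    ℋₖ.mk≋ (K.trans a a′) (K.trans b b′) (K.trans c c′) (K.trans d d′)

  ρ-integral : ∀ {x} → Hurwitz x → Integral (ρ x)
  ρ-integral {x} (ℋ.span _ _ _ _ p₀ p₁ p₂ p₃ x≋) with integer p₀ | integer p₁ | integer p₂ | integer p₃
  ... | c₀ , refl | c₁ , refl | c₂ , refl | c₃ , refl = into (ι x)
    (ℋₖ.span _ _ _ _ (ℤ⊆𝒪ₖ c₀) (ℤ⊆𝒪ₖ c₁) (ℤ⊆𝒪ₖ c₂) (ℤ⊆𝒪ₖ c₃)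
      (ℋₖ-trans (ι-cong x≋) (ι-combination ⟪ c₀ ⟫ ⟪ c₁ ⟫ ⟪ c₂ ⟫ ⟪ c₃ ⟫)))

  ρ-⊕ : ∀ x y → ρ (x ℋ.⊕ y) ≋ ρ x ⊕ ρ y
  ρ-⊕ x y = M.trans (φ.⟦⟧-cong (ℋₖ.mk≋ (add K.refl K.refl) (add K.refl K.refl) (add K.refl K.refl) (add K.refl K.refl)))
    (φ.+-homo (ι x) (ι y))

  combinationₖ-shift : ∀ m {a₀ a₁ a₂ a₃ b₀ b₁ b₂ b₃ t₀ t₁ t₂ t₃} →
    a₀ ≈ b₀ + m * t₀ → a₁ ≈ b₁ + m * t₁ → a₂ ≈ b₂ + m * t₂ → a₃ ≈ b₃ + m * t₃ →
    combinationₖ a₀ a₁ a₂ a₃ ℋₖ.≋ combinationₖ b₀ b₁ b₂ b₃ ℋₖ.⊕ m ℋₖ.• combinationₖ t₀ t₁ t₂ t₃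
  combinationₖ-shift m {b₀ = b₀} {b₁} {b₂} {b₃} {t₀} {t₁} {t₂} {t₃} p₀ p₁ p₂ p₃ =
    ℋₖ.mk≋ (coordinate re) (coordinate im) (coordinate jm) (coordinate km)
    where
    coordinate : ∀ (f : Quaternion K.Carrier → K.Carrier) → _
    coordinate f = K.trans
      (K.+-cong (K.+-cong (K.+-cong (K.*-congʳ p₀) (K.*-congʳ p₁)) (K.*-congʳ p₂)) (K.*-congʳ p₃))
      (solve 13 (λ m b₀ b₁ b₂ b₃ t₀ t₁ t₂ t₃ e₀ e₁ e₂ e₃ →
        (b₀ :+ m :* t₀) :* e₀ :+ (b₁ :+ m :* t₁) :* e₁ :+ (b₂ :+ m :* t₂) :* e₂ :+ (b₃ :+ m :* t₃) :* e₃ :=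
        (b₀ :* e₀ :+ b₁ :* e₁ :+ b₂ :* e₂ :+ b₃ :* e₃) :+ m :* (t₀ :* e₀ :+ t₁ :* e₁ :+ t₂ :* e₂ :+ t₃ :* e₃))
        K.refl m b₀ b₁ b₂ b₃ t₀ t₁ t₂ t₃ (f (ι ℋ.1q)) (f (ι I)) (f (ι J)) (f (ι ω)))

  -- A generator γ of the right ideal { x ∈ 𝒪 : ρ x ∈ B M₂(𝒪ₖ) } of an integral B
  -- dividing the integer n.
  record Generator (n : ℤ) (B : Matrix K.Carrier) : Set where
    field
      γ cofactor : Quaternion ℚ
      C D        : Matrix K.Carrier
      γ∈         : Hurwitz γ
      cofactor∈  : Hurwitz cofactor
      γ·cofactor : γ ℋ.· cofactor ℋ.≋ ⟪ n ⟫ ℋ.• ℋ.1q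
      C∈         : Integral C
      D∈         : Integral D
      γ≋         : ρ γ ≋ B · C
      B≋         : B ≋ ρ γ · D

  private module _ (n : ℕ) where

    m : K.Carrier
    m = fromℚ ⟪ + (p ℕ.^ n) ⟫

    open _≡_[mod_]

    -- `onto` gives M a preimage in 𝒪 ⊗ 𝒪ₖ. Its coordinates over 1, I, J, ω are what gets
    -- approximated, since integers in these coordinates, unlike integral matrix entries, yield an
    -- element of 𝒪. Linearity of `φ` carries the error terms m t and m t′ over to matrices.
    lift : ∀ M → Integral M → ∃ λ x → ∃ λ T → ∃ λ T′ → Hurwitz x × Integral T × Integral T′ ×
      ρ x ≋ M ⊕ m • T × M ≋ ρ x ⊕ m • T′
    lift M M∈ with onto M M∈
    ... | x , ℋₖ.span c₀ c₁ c₂ c₃ p₀ p₁ p₂ p₃ x≋ , φx≋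
      with approximate n p₀ | approximate n p₁ | approximate n p₂ | approximate n p₃
    ... | a₀ , e₀ | a₁ , e₁ | a₂ , e₂ | a₃ , e₃ =
      x₀ , φ t , φ t′ , ℋ.span _ _ _ _ (⟪⟫∈ a₀) (⟪⟫∈ a₁) (⟪⟫∈ a₂) (⟪⟫∈ a₃) ≋-refl ,
      into t (ℋₖ.span _ _ _ _ (quotient∈ e₀) (quotient∈ e₁) (quotient∈ e₂) (quotient∈ e₃) ℋₖ-refl) ,
      into t′ (ℋₖ.span _ _ _ _ (quotient′∈ e₀) (quotient′∈ e₁) (quotient′∈ e₂) (quotient′∈ e₃) ℋₖ-refl) ,
      M.trans (φ.⟦⟧-cong (ℋₖ-trans (ι-combination ⟪ a₀ ⟫ ⟪ a₁ ⟫ ⟪ a₂ ⟫ ⟪ a₃ ⟫)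
          (combinationₖ-shift m (eq e₀) (eq e₁) (eq e₂) (eq e₃))))
        (M.trans (φ-affine c t) (⊕-congₘ (M.trans (φ.⟦⟧-cong (ℋₖ-sym x≋)) φx≋) M.refl)) ,
      M.trans (M.trans (M.sym φx≋) (φ.⟦⟧-cong (ℋₖ-trans x≋ (combinationₖ-shift m (eq′ e₀) (eq′ e₁) (eq′ e₂) (eq′ e₃)))))
        (M.trans (φ-affine a t′) (⊕-congₘ (φ.⟦⟧-cong (ℋₖ-sym (ι-combination ⟪ a₀ ⟫ ⟪ a₁ ⟫ ⟪ a₂ ⟫ ⟪ a₃ ⟫))) M.refl))
      where
      x₀ = 𝒪.combination ⟪ a₀ ⟫ ⟪ a₁ ⟫ ⟪ a₂ ⟫ ⟪ a₃ ⟫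
      a = combinationₖ (fromℚ ⟪ a₀ ⟫) (fromℚ ⟪ a₁ ⟫) (fromℚ ⟪ a₂ ⟫) (fromℚ ⟪ a₃ ⟫)
      c = combinationₖ c₀ c₁ c₂ c₃
      t = combinationₖ (quotient e₀) (quotient e₁) (quotient e₂) (quotient e₃)
      t′ = combinationₖ (quotient′ e₀) (quotient′ e₁) (quotient′ e₂) (quotient′ e₃)
      ℋₖ-refl : ∀ {x} → x ℋₖ.≋ x
      ℋₖ-refl = ℋₖ.mk≋ K.refl K.refl K.refl K.refl
      φ-affine : ∀ x y → φ (x ℋₖ.⊕ m ℋₖ.• y) ≋ φ x ⊕ m • φ y
      φ-affine x y = M.trans (φ.+-homo x (m ℋₖ.• y)) (⊕-congₘ M.refl (linear m y))

    -- Since m = B P, every multiple of m is a right multiple of B. Hence so is ρ x = B + m T, and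
    -- with it γ = x a + m b. Conversely B = ρ x + m T′, where x and m are both right multiples of
    -- γ.
    generator : ∀ B P → Integral B → Integral P → B · P ≋ m • 1ₘ → Generator (+ (p ℕ.^ n)) B
    generator B P B∈ P∈ BP with lift B B∈
    ... | x , T , T′ , x∈ , T∈ , T′∈ , x≋ , B≋ =
      record
        { γ = γ ; cofactor = y′ ; C = C ; D = D ; γ∈ = gcd∈ ; cofactor∈ = y′∈ ; γ·cofactor = ≋-sym y≋
        ; C∈ = ⊕-integral (ρ a) (P · S) (ρ-integral a∈) (·-integral P S P∈ S∈)
        ; D∈ = ⊕-integral (ρ x′) (ρ y′ · T′) (ρ-integral x′∈) (·-integral (ρ y′) T′ (ρ-integral y′∈) T′∈)
        ; γ≋ = γ≋BC
        ; B≋ = B≋γD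
        }
      where
      open SetoidReasoning matrixSetoid
      μ = ⟪ + (p ℕ.^ n) ⟫ ℋ.• ℋ.1q
      μ∈ : Hurwitz μ
      μ∈ = 𝒪.scalar∈ (⟪⟫∈ (+ (p ℕ.^ n)))
      open RightGCD (rightGCD x∈ μ∈) renaming (gcd to γ; x≋ to gx≋)
      -- Expanding (B + m T) ρ a + m ρ b, this is the coefficient of m; replacing m by B P gives
      -- `C`.
      S = T · ρ a ⊕ ρ b
      S∈ : Integral S
      S∈ = ⊕-integral (T · ρ a) (ρ b) (·-integral T (ρ a) T∈ (ρ-integral a∈)) (ρ-integral b∈)
      C = ρ a ⊕ P · S
      D = ρ x′ ⊕ ρ y′ · T′
      ρ-μ· : ∀ x → ρ (μ ℋ.· x) ≋ m • ρ x
      ρ-μ· x = M.trans (ρ-cong (scalar-· ⟪ + (p ℕ.^ n) ⟫ x)) (ρ-• ⟪ + (p ℕ.^ n) ⟫ x)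
      m•≋ : ∀ S → m • S ≋ B · (P · S)
      m•≋ S = begin
        m • S             ≈⟨ •-congₘ m (·-identityˡₘ S) ⟨
        m • (1ₘ · S)      ≈⟨ •-·ₘ m 1ₘ S ⟨
        (m • 1ₘ) · S      ≈⟨ ·-congₘ BP M.refl ⟨
        (B · P) · S       ≈⟨ ·-assocₘ B P S ⟩
        B · (P · S)       ∎
      ρ-μT : m • T′ ≋ ρ γ · (ρ y′ · T′)
      ρ-μT = begin
        m • T′                  ≈⟨ •-congₘ m (·-identityˡₘ T′) ⟨
        m • (1ₘ · T′)           ≈⟨ •-·ₘ m 1ₘ T′ ⟨
        (m • 1ₘ) · T′           ≈⟨ ·-congₘ (M.trans (ρ-• ⟪ + (p ℕ.^ n) ⟫ ℋ.1q) (•-congₘ m ρ-1)) M.refl ⟨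
        ρ μ · T′                ≈⟨ ·-congₘ (M.trans (ρ-cong y≋) (ρ-· γ y′)) M.refl ⟩
        (ρ γ · ρ y′) · T′       ≈⟨ ·-assocₘ (ρ γ) (ρ y′) T′ ⟩
        ρ γ · (ρ y′ · T′)       ∎
      γ≋BC : ρ γ ≋ B · C
      γ≋BC = begin
        ρ γ                                          ≈⟨ ρ-cong gcd≋ ⟩
        ρ (x ℋ.· a ℋ.⊕ μ ℋ.· b)                      ≈⟨ ρ-⊕ (x ℋ.· a) (μ ℋ.· b) ⟩
        ρ (x ℋ.· a) ⊕ ρ (μ ℋ.· b)                    ≈⟨ ⊕-congₘ (ρ-· x a) (ρ-μ· b) ⟩
        ρ x · ρ a ⊕ m • ρ b                          ≈⟨ ⊕-congₘ (·-congₘ x≋ M.refl) M.refl ⟩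
        (B ⊕ m • T) · ρ a ⊕ m • ρ b                  ≈⟨ ⊕-congₘ (·-distribʳₘ (ρ a) B (m • T)) M.refl ⟩
        (B · ρ a ⊕ (m • T) · ρ a) ⊕ m • ρ b          ≈⟨ ⊕-assocₘ _ _ _ ⟩
        B · ρ a ⊕ ((m • T) · ρ a ⊕ m • ρ b)          ≈⟨ ⊕-congₘ M.refl (⊕-congₘ (•-·ₘ m T (ρ a)) M.refl) ⟩
        B · ρ a ⊕ (m • (T · ρ a) ⊕ m • ρ b)          ≈⟨ ⊕-congₘ M.refl (•-⊕ₘ m (T · ρ a) (ρ b)) ⟩
        B · ρ a ⊕ m • S                              ≈⟨ ⊕-congₘ M.refl (m•≋ S) ⟩
        B · ρ a ⊕ B · (P · S)                        ≈⟨ ·-distribˡₘ B (ρ a) (P · S) ⟨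
        B · C                                        ∎
      B≋γD : B ≋ ρ γ · D
      B≋γD = begin
        B                                            ≈⟨ B≋ ⟩
        ρ x ⊕ m • T′                                 ≈⟨ ⊕-congₘ (M.trans (ρ-cong gx≋) (ρ-· γ x′)) ρ-μT ⟩
        ρ γ · ρ x′ ⊕ ρ γ · (ρ y′ · T′)               ≈⟨ ·-distribˡₘ (ρ γ) (ρ x′) (ρ y′ · T′) ⟨
        ρ γ · D                                      ∎

  -- From lattices to elements of the order.

  module L = Lattices K 𝒪ₖ
  open L using (Lattice; standardLattice; _∼_)

  scale-integral : ∀ M → ∃ λ (c : Unit K.*-monoid) → Integral (Unit.val c • M)
  scale-integral M with denominator (a₁₁ M) | denominator (a₁₂ M) | denominator (a₂₁ M) | denominator (a₂₂ M)
  ... | a , a∈ , ax∈ | b , b∈ , bx∈ | c , c∈ , cx∈ | d , d∈ , dx∈ =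
    (a ∙ b) ∙ (c ∙ d) ,
    resp (pull₁ (val a) (val b) (val c) (val d) (a₁₁ M)) (*-closed (*-closed b∈ (*-closed c∈ d∈)) ax∈) ,
    resp (pull₂ (val a) (val b) (val c) (val d) (a₁₂ M)) (*-closed (*-closed a∈ (*-closed c∈ d∈)) bx∈) ,
    resp (pull₃ (val a) (val b) (val c) (val d) (a₂₁ M)) (*-closed (*-closed (*-closed a∈ b∈) d∈) cx∈) ,
    resp (pull₄ (val a) (val b) (val c) (val d) (a₂₂ M)) (*-closed (*-closed (*-closed a∈ b∈) c∈) dx∈)
    where
    open Group (unitGroup K.*-monoid) using (_∙_)
    open Unit using (val)
    pull₁ = solve 5 (λ a b c d x → (b :* (c :* d)) :* (a :* x) := ((a :* b) :* (c :* d)) :* x) K.refl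
    pull₂ = solve 5 (λ a b c d x → (a :* (c :* d)) :* (b :* x) := ((a :* b) :* (c :* d)) :* x) K.refl
    pull₃ = solve 5 (λ a b c d x → ((a :* b) :* d) :* (c :* x) := ((a :* b) :* (c :* d)) :* x) K.refl
    pull₄ = solve 5 (λ a b c d x → ((a :* b) :* c) :* (d :* x) := ((a :* b) :* (c :* d)) :* x) K.refl

  -- B divides its determinant through the adjugate, and the determinant, an integral element with
  -- an inverse in K, divides a power of p.
  power-multiple : ∀ B → Integral B → (∃ λ e → det B * e ≈ 1#) →
    ∃ λ n → ∃ λ P → Integral P × B · P ≋ fromℚ ⟪ + (p ℕ.^ n) ⟫ • 1ₘ
  power-multiple B (p₁₁ , p₁₂ , p₂₁ , p₂₂) det-unit
    with divides-pow (+-closed (*-closed p₁₁ p₂₂) (*-closed p₁₂ (neg-closed p₂₁))) det-unit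
  ... | n , t , t∈ , t≈ = n , t • adj B ,
    (*-closed t∈ p₂₂ , *-closed t∈ (neg-closed p₁₂) , *-closed t∈ (neg-closed p₂₁) , *-closed t∈ p₁₁) ,
    (begin
      B · (t • adj B)          ≈⟨ ·-•ₘ t B (adj B) ⟩
      t • (B · adj B)          ≈⟨ •-congₘ t (·-adj B) ⟩
      t • det B • 1ₘ           ≈⟨ •-assocₘ t (det B) 1ₘ ⟨
      (t * det B) • 1ₘ         ≈⟨ •-congʳₘ 1ₘ (K.trans (K.*-comm t (det B)) t≈) ⟩
      fromℚ ⟪ + (p ℕ.^ n) ⟫ • 1ₘ ∎)
    where open SetoidReasoning matrixSetoid

  scaled-det-unit : ∀ (c : Unit K.*-monoid) L → ∃ λ e → det (Unit.val c • columns L) * e ≈ 1#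
  scaled-det-unit c L = let (e , de) = columns-det-unit L in (Unit.inv c * Unit.inv c) * e , (begin
    det (Unit.val c • columns L) * ((Unit.inv c * Unit.inv c) * e)                      ≈⟨ K.*-congʳ (det-• (Unit.val c) (columns L)) ⟩
    ((Unit.val c * Unit.val c) * det (columns L)) * ((Unit.inv c * Unit.inv c) * e)     ≈⟨
      solve 4 (λ c d i e → ((c :* c) :* d) :* ((i :* i) :* e) := ((c :* i) :* (c :* i)) :* (d :* e)) K.refl
        (Unit.val c) (det (columns L)) (Unit.inv c) e ⟩
    ((Unit.val c * Unit.inv c) * (Unit.val c * Unit.inv c)) * (det (columns L) * e)     ≈⟨
      K.*-cong (K.*-cong (Unit.inverseʳ c) (Unit.inverseʳ c)) de ⟩
    (1# * 1#) * 1#                                                                      ≈⟨ K.trans (K.*-identityʳ (1# * 1#)) (K.*-identityʳ 1#) ⟩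
    1#                                                                                  ∎)
    where open SetoidReasoning K.setoid

  generator-moves-standard : ∀ {n} L c (g : Generator n (Unit.val c • columns L)) →
    ∀ u → Unit.val u ℋ.≋ Generator.γ g → act u standardLattice ∼ L
  generator-moves-standard L c g u u≋ = image-standard (toGL₂ u) L c C D C∈ D∈
    (M.trans {i = ρ (Unit.val u)} {ρ γ} {(Unit.val c • columns L) · C} (ρ-cong {Unit.val u} {γ} u≋) γ≋)
    (M.trans {i = Unit.val c • columns L} {ρ γ · D} {ρ (Unit.val u) · D} B≋
      (·-congₘ {ρ γ} {ρ (Unit.val u)} {D} {D} (ρ-cong {γ} {Unit.val u} (≋-sym u≋)) ≋ₘ-refl))
    where open Generator g

  -- Only what the global argument consumes. `moves` ranges over all units with value γ because the
  -- inverse of γ is built later, over ℤ_S, from `cofactor`.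
  record Transporter (L : Lattice) : Set where
    field
      exponent   : ℕ
      γ cofactor : Quaternion ℚ
      γ∈         : Hurwitz γ
      cofactor∈  : Hurwitz cofactor
      γ·cofactor : γ ℋ.· cofactor ℋ.≋ ⟪ + (p ℕ.^ exponent) ⟫ ℋ.• ℋ.1q
      moves      : ∀ u → Unit.val u ℋ.≋ γ → act u standardLattice ∼ L

  opaque
    lattice-generator : ∀ L → ∃ λ (c : Unit K.*-monoid) → ∃ λ n → Generator (+ (p ℕ.^ n)) (Unit.val c • columns L)
    lattice-generator L =
      proj₁ scaled , proj₁ multiple ,
      generator (proj₁ multiple) (Unit.val (proj₁ scaled) • columns L) (proj₁ (proj₂ multiple)) (proj₂ scaled)
        (proj₁ (proj₂ (proj₂ multiple))) (proj₂ (proj₂ (proj₂ multiple)))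
      where
      scaled : ∃ λ (c : Unit K.*-monoid) → Integral (Unit.val c • columns L)
      scaled = scale-integral (columns L)
      multiple : ∃ λ n → ∃ λ P → Integral P × (Unit.val (proj₁ scaled) • columns L) · P ≋ fromℚ ⟪ + (p ℕ.^ n) ⟫ • 1ₘ
      multiple = power-multiple (Unit.val (proj₁ scaled) • columns L) (proj₂ scaled) (scaled-det-unit (proj₁ scaled) L)

  transporter : ∀ L → Transporter L
  transporter L = let (c , n , g) = lattice-generator L in record
    { exponent = n ; γ = Generator.γ g ; cofactor = Generator.cofactor g ; γ∈ = Generator.γ∈ g
    ; cofactor∈ = Generator.cofactor∈ g ; γ·cofactor = Generator.γ·cofactor g
    ; moves = generator-moves-standard L c g }

  -- ρ γ is integral, and so is its right inverse a⁻¹ ρ z, because a is invertible in 𝒪ₖ. The lemma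
  -- is applied at a prime q with a power of a different prime as `a`.
  fixes-standard : ∀ a → ¬ + p ℤ.∣ a → ∀ {γ z} → Hurwitz γ → Hurwitz z → γ ℋ.· z ℋ.≋ ⟪ a ⟫ ℋ.• ℋ.1q →
    ∀ u → Unit.val u ℋ.≋ γ → act u standardLattice ∼ standardLattice
  fixes-standard a p∤a {γ} {z} γ∈ z∈ γz u u≋ with invert a p∤a | ρ-integral z∈
  ... | t , t∈ , at≈1 | (z₁₁ , z₁₂ , z₂₁ , z₂₂) =
    image-standard (toGL₂ u) standardLattice ε (ρ γ) (t • ρ z) (ρ-integral γ∈)
      (*-closed t∈ z₁₁ , *-closed t∈ z₁₂ , *-closed t∈ z₂₁ , *-closed t∈ z₂₂)
      (begin
        ρ (Unit.val u)                               ≈⟨ ρ-cong {Unit.val u} {γ} u≋ ⟩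
        ρ γ                                          ≈⟨ ·-identityˡₘ (ρ γ) ⟨
        1ₘ · ρ γ                                     ≈⟨ ·-congₘ standard≋ M.refl ⟨
        (Unit.val ε • columns standardLattice) · ρ γ ∎)
      (begin
        Unit.val ε • columns standardLattice         ≈⟨ standard≋ ⟩
        1ₘ                                           ≈⟨ •-identityₘ 1ₘ ⟨
        1# • 1ₘ                                      ≈⟨ •-congʳₘ 1ₘ (K.trans (K.*-comm t (fromℚ ⟪ a ⟫)) at≈1) ⟨
        (t * fromℚ ⟪ a ⟫) • 1ₘ                       ≈⟨ •-assocₘ t (fromℚ ⟪ a ⟫) 1ₘ ⟩
        t • fromℚ ⟪ a ⟫ • 1ₘ                         ≈⟨ •-congₘ t (M.trans (ρ-• ⟪ a ⟫ ℋ.1q) (•-congₘ (fromℚ ⟪ a ⟫) ρ-1)) ⟨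
        t • ρ (⟪ a ⟫ ℋ.• ℋ.1q)                       ≈⟨ •-congₘ t (ρ-cong {γ ℋ.· z} {⟪ a ⟫ ℋ.• ℋ.1q} γz) ⟨
        t • ρ (γ ℋ.· z)                              ≈⟨ •-congₘ t (ρ-· γ z) ⟩
        t • (ρ γ · ρ z)                              ≈⟨ ·-•ₘ t (ρ γ) (ρ z) ⟨
        ρ γ · (t • ρ z)                              ≈⟨ ·-congₘ (ρ-cong {Unit.val u} {γ} u≋) M.refl ⟨
        ρ (Unit.val u) · (t • ρ z)                   ∎)
    where
    open SetoidReasoning matrixSetoid
    open Group (unitGroup K.*-monoid) using (ε)
    standard≋ : Unit.val ε • columns standardLattice ≋ 1ₘ
    standard≋ = •-identityₘ (columns standardLattice)

-- Congruences modulo powers of p and division in ℤₚ.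

module ModPowers (p : ℕ) (p-prime : Prime p) where
  open PAdic p p-prime
  open Cong
  open ℤ.+-*-Solver

  private instance
    p≢0 : ℕ.NonZero p
    p≢0 = prime⇒nonZero p-prime

  inverse-mod-p : ∀ a → ¬ + p ℤ.∣ a → ∃ λ s → + p ℤ.∣ a ℤ.* s ℤ.- + 1
  inverse-mod-p a p∤a = signed a (bezout (coprime-Bézout coprime))
    where
    coprime : Coprime ∣ a ∣ p
    coprime (d∣a , d∣p) with prime⇒irreducible p-prime d∣p
    ... | inj₁ d≡1  = d≡1
    ... | inj₂ refl = contradiction (ℤ.∣ᵤ⇒∣ d∣a) p∤a

    cast : ∀ x y u v → 1 ℕ.+ x ℕ.* y ≡ u ℕ.* v → + 1 ℤ.+ + x ℤ.* + y ≡ + u ℤ.* + v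
    cast x y u v eq = trans (cong (ℤ._+_ (+ 1)) (sym (ℤ.pos-* x y))) (trans (cong +_ eq) (ℤ.pos-* u v))

    bezout : Bézout.Identity 1 ∣ a ∣ p → ∃ λ s → + p ℤ.∣ + ∣ a ∣ ℤ.* s ℤ.- + 1
    bezout (Bézout.+- x y eq) = + x , ℤ.divides (+ y) (begin
      + ∣ a ∣ ℤ.* + x ℤ.- + 1              ≡⟨ cong (ℤ._- + 1) (trans (ℤ.*-comm (+ ∣ a ∣) (+ x)) (sym (cast y p x ∣ a ∣ eq))) ⟩
      + 1 ℤ.+ + y ℤ.* + p ℤ.- + 1          ≡⟨ solve 1 (λ t → con (+ 1) :+ t :- con (+ 1) := t) refl (+ y ℤ.* + p) ⟩
      + y ℤ.* + p                          ∎)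
      where open ≡-Reasoning
    bezout (Bézout.-+ x y eq) = ℤ.- + x , ℤ.divides (ℤ.- + y) (begin
      + ∣ a ∣ ℤ.* (ℤ.- + x) ℤ.- + 1        ≡⟨ solve 2 (λ a x → a :* (:- x) :- con (+ 1) := :- (con (+ 1) :+ x :* a)) refl (+ ∣ a ∣) (+ x) ⟩
      ℤ.- (+ 1 ℤ.+ + x ℤ.* + ∣ a ∣)        ≡⟨ cong ℤ.-_ (cast x ∣ a ∣ y p eq) ⟩
      ℤ.- (+ y ℤ.* + p)                    ≡⟨ ℤ.neg-distribˡ-* (+ y) (+ p) ⟩
      (ℤ.- + y) ℤ.* + p                    ∎)
      where open ≡-Reasoning

    signed : ∀ a → (∃ λ s → + p ℤ.∣ + ∣ a ∣ ℤ.* s ℤ.- + 1) → ∃ λ s → + p ℤ.∣ a ℤ.* s ℤ.- + 1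
    signed (+ _)      result  = result
    signed a@(-[1+ n ]) (s , d) = ℤ.- s , ∣-resp
      (solve 2 (λ b s → b :* s :- con (+ 1) := (:- b) :* (:- s) :- con (+ 1)) refl (+ suc n) s) d

  pow-suc : ∀ n → pow (suc n) ≡ + p ℤ.* pow n
  pow-suc n = ℤ.pos-* p (p ℕ.^ n)

  ∣*∣ : ∀ {i j k l} → i ℤ.∣ k → j ℤ.∣ l → i ℤ.* j ℤ.∣ k ℤ.* l
  ∣*∣ {i} {j} {k} {l} i∣k j∣l = ℤ.∣-trans (ℤ.*-monoˡ-∣ j i∣k) (ℤ.*-monoʳ-∣ k j∣l)

  -- Newton's iteration: (a s − 1)(a r − 1) ≡ 1 modulo a.
  inverse-mod-pow : ∀ a → ¬ + p ℤ.∣ a → ∀ n → ∃ λ s → pow n ℤ.∣ a ℤ.* s ℤ.- + 1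
  inverse-mod-pow a p∤a zero    = + 0 , ℤ.∣ᵤ⇒∣ (ℕ.1∣ _)
  inverse-mod-pow a p∤a (suc n) with inverse-mod-p a p∤a | inverse-mod-pow a p∤a n
  ... | r , r∣ | s , s∣ = r ℤ.+ s ℤ.- a ℤ.* r ℤ.* s , subst (ℤ._∣ _) (sym (pow-suc n)) (∣-resp
    (solve 3 (λ a r s → :- ((a :* r :- con (+ 1)) :* (a :* s :- con (+ 1))) :=
      a :* (r :+ s :- a :* r :* s) :- con (+ 1)) refl a r s)
    (ℤ.∣m⇒∣-m (∣*∣ r∣ s∣)))

  -- A factor p of a is matched with one factor of pⁿ and both are stripped. As pⁿ does not divide
  -- a, the process reaches a number prime to p before the exponent is exhausted, and that number is
  -- invertible modulo every pᵏ.
  divides-pow-mod : ∀ n a → ¬ pow n ℤ.∣ a → ∀ k → ∃ λ s → pow k ℤ.∣ a ℤ.* s ℤ.- pow n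
  divides-pow-mod zero    a ∤ k = contradiction (ℤ.∣ᵤ⇒∣ (ℕ.1∣ _)) ∤
  divides-pow-mod (suc n) a ∤ k with + p ℤ.∣? a
  ... | no p∤a = let (s , d) = inverse-mod-pow a p∤a k in s ℤ.* pow (suc n) , ∣-resp
    (solve 3 (λ a s q → (a :* s :- con (+ 1)) :* q := a :* (s :* q) :- q) refl a s (pow (suc n)))
    (ℤ.∣m⇒∣m*n (pow (suc n)) d)
  ... | yes (ℤ.divides q refl) =
    let (s , d) = divides-pow-mod n q
                    (λ e → ∤ (subst (ℤ._∣ _) (trans (ℤ.*-comm (pow n) (+ p)) (sym (pow-suc n))) (ℤ.*-monoˡ-∣ (+ p) e))) k
    in s , ∣-resp (trans
        (solve 4 (λ p q s r → p :* (q :* s :- r) := q :* p :* s :- p :* r) refl (+ p) q s (pow n))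
        (cong (λ r → q ℤ.* + p ℤ.* s ℤ.- r) (sym (pow-suc n))))
      (ℤ.∣n⇒∣m*n (+ p) d)

  -- Division by pⁿ loses n digits, so the k-th component of the quotient is taken from component k
  -- + n of x. Coherence follows by cancelling pⁿ from a congruence modulo pᵏ⁺ⁿ.
  scaled-approximations : ∀ n x (q : ℕ → ℤ) → (∀ k → approx x (k ℕ.+ n) ≡ q k ℤ.* pow n) →
    ∃ λ t → x ≈ᶻ const (pow n) *ᶻ t
  scaled-approximations n x q q-eq = t , mk≈ λ k → ∣-resp
      (cong (ℤ._-_ (approx x k)) (trans (q-eq k) (ℤ.*-comm (q k) (pow n))))
      (∣-sym (pow k) (approx x (k ℕ.+ n)) (approx x k)
        (subst (λ i → pow k ℤ.∣ approx x i ℤ.- approx x k) (ℕ.+-comm n k) (coherent+ x n k)))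
    where
    t : ℤₚ
    t .approx = q
    t .coherent k = ℤ.*-cancelʳ-∣ (pow n) {pow k} {q (suc k) ℤ.- q k} ⦃ ℕ.m^n≢0 p n ⦄ (subst (ℤ._∣ (q (suc k) ℤ.- q k) ℤ.* pow n) pow-+
      (∣-resp (trans (cong₂ ℤ._-_ (q-eq (suc k)) (q-eq k))
        (solve 3 (λ a b c → a :* c :- b :* c := (a :- b) :* c) refl (q (suc k)) (q k) (pow n)))
        (coherent x (k ℕ.+ n))))
      where
      pow-+ : pow (k ℕ.+ n) ≡ pow k ℤ.* pow n
      pow-+ = trans (cong +_ (ℕ.^-distribˡ-+-* p k n)) (ℤ.pos-* (p ℕ.^ k) (p ℕ.^ n))

  divide-by-pow : ∀ n x → pow n ℤ.∣ approx x n → ∃ λ t → x ≈ᶻ const (pow n) *ᶻ t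
  divide-by-pow n x d = scaled-approximations n x (λ k → quotient (divisible k)) (λ k → equality (divisible k))
    where
    open ℤ._∣_
    divisible : ∀ k → pow n ℤ.∣ approx x (k ℕ.+ n)
    divisible k = ∣-resp (solve 2 (λ a b → (a :- b) :+ b := a) refl (approx x (k ℕ.+ n)) (approx x n))
      (ℤ.∣m∣n⇒∣m+n (coherent+ x k n) d)

  -- Solutions modulo every power of p are coherent after a shift by n, because
  -- d, having valuation below n, may be cancelled at that cost.
  solve-linear : ∀ d c n → ¬ pow n ℤ.∣ approx d n →
    (∀ k → ∃ λ s → pow (n ℕ.+ k) ℤ.∣ approx d (n ℕ.+ k) ℤ.* s ℤ.- approx c (n ℕ.+ k)) →
    ∃ λ t → d *ᶻ t ≈ᶻ c
  solve-linear d c n ∤ sol = t , mk≈ λ k → ∣-trans (pow k)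
      (approx d k ℤ.* s k) (approx d (n ℕ.+ k) ℤ.* s k) (approx c k)
      (∣-* (pow k) (approx d k) (approx d (n ℕ.+ k)) (s k) (s k)
        (∣-sym (pow k) (approx d (n ℕ.+ k)) (approx d k) (coherent+ d n k)) (∣-refl (pow k) (s k)))
      (∣-trans (pow k) (approx d (n ℕ.+ k) ℤ.* s k) (approx c (n ℕ.+ k)) (approx c k)
        (ℤ.∣-trans (pow-mono n k) (proj₂ (sol k))) (coherent+ c n k))
    where
    s : ℕ → ℤ
    s k = proj₁ (sol k)
    t : ℤₚ
    t .approx = s
    t .coherent k = valuationᶻ n k (approx d m) (s (suc k) ℤ.- s k) (∤-shift d n k ∤) (∣-resp
      (solve 3 (λ a x y → a :* x :- a :* y := a :* (x :- y)) refl (approx d m) (s (suc k)) (s k))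
      (∣-trans (pow m) (approx d m ℤ.* s (suc k)) (approx c m) (approx d m ℤ.* s k)
        (∣-trans (pow m) (approx d m ℤ.* s (suc k)) (approx d (suc m) ℤ.* s (suc k)) (approx c m)
          (∣-* (pow m) (approx d m) (approx d (suc m)) (s (suc k)) (s (suc k))
            (∣-sym (pow m) (approx d (suc m)) (approx d m) (coherent d m)) (∣-refl (pow m) (s (suc k))))
          (∣-trans (pow m) (approx d (suc m) ℤ.* s (suc k)) (approx c (suc m)) (approx c m)
            (ℤ.∣-trans (pow-mono 1 m)
              (subst (λ i → pow i ℤ.∣ approx d i ℤ.* s (suc k) ℤ.- approx c i) (ℕ.+-suc n k) (proj₂ (sol (suc k)))))
            (coherent c m)))
        (∣-sym (pow m) (approx d m ℤ.* s k) (approx c m) (proj₂ (sol k)))))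
      where m = n ℕ.+ k

  divides-pow : ∀ {d} → Nonzero d → ∃ λ n → ∃ λ t → d *ᶻ t ≈ᶻ const (pow n)
  divides-pow {d} (nonzero n ∤) = n , solve-linear d (const (pow n)) n ∤
    λ k → divides-pow-mod n (approx d (n ℕ.+ k)) (∤-shift d n k ∤) (n ℕ.+ k)

  invert : ∀ a → ¬ + p ℤ.∣ a → ∃ λ t → const a *ᶻ t ≈ᶻ const (+ 1)
  -- Index 1, because a is already nonzero modulo p.
  invert a p∤a = solve-linear (const a) (const (+ 1)) 1
    (λ d → p∤a (subst (ℤ._∣ a) (cong +_ (ℕ.^-identityʳ p)) d))
    λ k → inverse-mod-pow a p∤a (1 ℕ.+ k)

-- The local properties of ℚₚ.

module PAdicLocalRing (p : ℕ) (p-prime : Prime p) where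
  open PAdic p p-prime
  open ModPowers p p-prime
  open Cong
  open Congruence ℚₚ-commutativeRing Integral
  private module R = CommutativeRing ℤₚ-commutativeRing

  fromR-cong : ∀ {x y} → x ≈ᶻ y → fromR x Kₚ.≈ fromR y
  fromR-cong x≈y = mk≈ (R.*-congʳ x≈y)

  fromR-+ : ∀ x y → fromR x Kₚ.+ fromR y Kₚ.≈ fromR (x +ᶻ y)
  fromR-+ x y = mk≈ (R.trans (R.*-congʳ (R.+-cong (R.*-identityʳ x) (R.*-identityʳ y)))
    (R.*-congˡ (R.sym (R.*-identityʳ R.1#))))

  fromR-* : ∀ x y → fromR x Kₚ.* fromR y Kₚ.≈ fromR (x *ᶻ y)
  fromR-* x y = mk≈ (R.*-congˡ (R.sym (R.*-identityʳ R.1#)))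

  fromR-den-* : ∀ x → fromR (den x) Kₚ.* x Kₚ.≈ fromR (num x)
  fromR-den-* (a / b [ _ ]) = mk≈ (R.trans (R.*-identityʳ (b *ᶻ a))
    (R.trans (R.*-comm b a) (R.*-congˡ (R.sym (R.*-identityˡ b)))))

  integral-fromR : ∀ z → Integral (fromR z)
  integral-fromR z = z , Kₚ.refl

  den-unit : ℚₚ → Unit Kₚ.*-monoid
  den-unit (a / b [ b≉0 ]) = record
    { val = fromR b ; inv = 1/b
    ; inverseˡ = Kₚ.trans (Kₚ.*-comm 1/b (fromR b)) b*1/b ; inverseʳ = b*1/b }
    where
    1/b : ℚₚ
    1/b = const (+ 1) / b [ b≉0 ]
    b*1/b : fromR b Kₚ.* 1/b Kₚ.≈ Kₚ.1#
    b*1/b = fromR-den-* 1/b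

  -- If a/b is the inverse of z then z a = b. A power of p dividing the n-th component of z would
  -- divide that of b, so the index at which the denominator b is nonzero serves for z as well.
  unit-nonzero : ∀ {z} → (∃ λ y → fromR z Kₚ.* y Kₚ.≈ Kₚ.1#) → Nonzero z
  unit-nonzero {z} (a / b [ nonzero n ∤ ] , mk≈ e) = nonzero n λ d → ∤ (∣-resp
    (solve 2 (λ b za → za :- (za :- b) := b) refl (approx b n) (approx z n ℤ.* approx a n))
    (ℤ.∣m∣n⇒∣m-n (ℤ.∣m⇒∣m*n (approx a n) d) (_≈ᶻ_.congruent za≈b n)))
    where
    open ℤ.+-*-Solver
    za≈b : z *ᶻ a ≈ᶻ b
    za≈b = R.trans (R.sym (R.*-identityʳ (z *ᶻ a))) (R.trans e
      (R.trans (R.*-identityˡ (R.1# *ᶻ b)) (R.*-identityˡ b)))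

  localRing : LocalRing ℚₚ-commutativeRing Integral fromℚ p
  localRing = record
    { +-closed    = λ (z , x≈) (w , y≈) → z +ᶻ w , Kₚ.trans (Kₚ.+-cong x≈ y≈) (fromR-+ z w)
    ; *-closed    = λ (z , x≈) (w , y≈) → z *ᶻ w , Kₚ.trans (Kₚ.*-cong x≈ y≈) (fromR-* z w)
    ; neg-closed  = λ (z , x≈) → -ᶻ z , Kₚ.-‿cong x≈
    ; resp        = λ x≈y (z , x≈) → z , Kₚ.trans (Kₚ.sym x≈y) x≈
    ; ℤ⊆𝒪ₖ        = λ n → const n , Kₚ.refl
    ; denominator = λ { x@(a / b [ _ ]) → den-unit x , integral-fromR b , a , fromR-den-* x }
    ; divides-pow = λ (z , x≈) (y , xy≈1) →
        let (n , t , zt≈) = divides-pow (unit-nonzero (y , Kₚ.trans (Kₚ.*-congʳ {y} (Kₚ.sym x≈)) xy≈1)) in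
        n , fromR t , integral-fromR t ,
        Kₚ.trans (Kₚ.*-congʳ x≈) (Kₚ.trans (fromR-* z t) (fromR-cong zt≈))
    ; approximate = λ n (z , x≈) → approx z n , congruence n z x≈
    ; invert      = λ a p∤a → let (t , at≈1) = invert a p∤a in
        fromR t , integral-fromR t , Kₚ.trans (fromR-* (const a) t) (fromR-cong at≈1)
    }
    where
    congruence : ∀ n z {x} → x Kₚ.≈ fromR z → fromℚ ⟪ approx z n ⟫ ≡ x [mod fromℚ ⟪ pow n ⟫ ]
    congruence n z {x} x≈ = record
      { quotient = fromR t ; quotient′ = fromR (-ᶻ t)
      ; quotient∈ = integral-fromR t ; quotient′∈ = integral-fromR (-ᶻ t)
      ; eq  = begin
          fromR a                            ≈⟨ fromR-cong a≈ ⟩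
          fromR (z +ᶻ m *ᶻ t)                ≈⟨ fromR-+ z (m *ᶻ t) ⟨
          fromR z Kₚ.+ fromR (m *ᶻ t)        ≈⟨ Kₚ.+-cong x≈ (fromR-* m t) ⟨
          x Kₚ.+ fromR m Kₚ.* fromR t        ∎
      ; eq′ = begin
          x                                  ≈⟨ x≈ ⟩
          fromR z                            ≈⟨ fromR-cong z≈ ⟩
          fromR (a +ᶻ m *ᶻ -ᶻ t)             ≈⟨ fromR-+ a (m *ᶻ -ᶻ t) ⟨
          fromR a Kₚ.+ fromR (m *ᶻ -ᶻ t)     ≈⟨ Kₚ.+-congˡ {fromR a} (fromR-* m (-ᶻ t)) ⟨
          fromR a Kₚ.+ fromR m Kₚ.* fromR (-ᶻ t)  ∎
      }
      where
      open SetoidReasoning Kₚ.setoid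
      a m : ℤₚ
      a = const (approx z n)
      m = const (pow n)
      -- The n-th component of a - z is zero by the choice of a, which is the condition for
      -- divisibility by pⁿ.
      t,eq : ∃ λ t → a +ᶻ -ᶻ z ≈ᶻ m *ᶻ t
      t,eq = divide-by-pow n (a +ᶻ -ᶻ z) (∣-refl (pow n) (approx z n))
      t : ℤₚ
      t = proj₁ t,eq
      open RingProperties R.ring using (-‿distribʳ-*)
      a≈ : a ≈ᶻ z +ᶻ m *ᶻ t
      a≈ = R.trans (≡⇒≈ᶻ {a} {z +ᶻ (a +ᶻ -ᶻ z)} λ k → solve 2 (λ a z → a := z :+ (a :+ :- z)) refl (approx z n) (approx z k))
             (R.+-congˡ {z} (proj₂ t,eq))
        where open ℤ.+-*-Solver
      z≈ : z ≈ᶻ a +ᶻ m *ᶻ -ᶻ t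
      z≈ = R.trans (≡⇒≈ᶻ {z} {a +ᶻ -ᶻ (a +ᶻ -ᶻ z)} λ k → solve 2 (λ a z → z := a :+ :- (a :+ :- z)) refl (approx z n) (approx z k))
             (R.+-congˡ {a} (R.trans (R.-‿cong (proj₂ t,eq)) (-‿distribʳ-* m t)))
        where open ℤ.+-*-Solver

open ℋ using (_≋_; _·_; _•_; 1q; span)

-- Group actions and S-units.

module ActionProperties {g ℓ x ℓ′} {G : Group g ℓ} {X : Setoid x ℓ′} (A : Action G X) where
  private
    module G = Group G
    module X = Setoid X
  open Action A

  ▷-adjoint : ∀ g {x y} → g ▷ y X.≈ x → g G.⁻¹ ▷ x X.≈ y
  ▷-adjoint g {x} {y} gy≈x = begin
    g G.⁻¹ ▷ x            ≈⟨ ▷-cong G.refl gy≈x ⟨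
    g G.⁻¹ ▷ g ▷ y        ≈⟨ ▷-assoc (g G.⁻¹) g y ⟨
    (g G.⁻¹ G.∙ g) ▷ y    ≈⟨ ▷-cong (G.inverseˡ g) X.refl ⟩
    G.ε ▷ y               ≈⟨ ▷-identity y ⟩
    y                     ∎
    where open SetoidReasoning X

prime∣pow : ∀ {p q} → Prime p → Prime q → ∀ n → q ℕ.∣ p ℕ.^ n → q ≡ p
prime∣pow pp pq zero    d with ℕ.∣1⇒≡1 d
... | refl = contradiction pq ¬prime[1]
prime∣pow {p} pp pq (suc n) d with euclidsLemma p (p ℕ.^ n) pq d
... | inj₂ q∣pⁿ = prime∣pow pp pq n q∣pⁿ
... | inj₁ q∣p with prime⇒irreducible pp q∣p
...   | inj₁ refl = contradiction pq ¬prime[1]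
...   | inj₂ q≡p  = q≡p

1/n*n≡1 : ∀ n .⦃ _ : ℕ.NonZero n ⦄ → (+ 1 ℚ./ n) ℚ.* ⟪ + n ⟫ ≡ 1ℚ
1/n*n≡1 (suc n) = ℚ.toℚᵘ-injective (ℚᵘ.≃-trans (ℚ.toℚᵘ-homo-* (+ 1 ℚ./ suc n) ⟪ + suc n ⟫)
  (ℚᵘ.≃-trans (ℚᵘ.*-congʳ {ℚ.toℚᵘ ⟪ + suc n ⟫} (ℚ.toℚᵘ-fromℚᵘ (ℚᵘ.mkℚᵘ (+ 1) n)))
    (ℚᵘ.*≡* (trans (ℤ.*-identityʳ (+ 1 ℤ.* + suc n)) (cong (λ m → + 1 ℤ.* + m) (sym (ℕ.*-identityʳ (suc n))))))))

module SUnits (S : FinitePrimeSet) where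
  open FinitePrimeSet S
  open SArithmetic S
  private module Γ = Group Γ_S

  Hurwitz⊆𝒪_S : ∀ {x} → Hurwitz x → 𝒪_S x
  Hurwitz⊆𝒪_S (span _ _ _ _ p₀ p₁ p₂ p₃ x≋) with integer p₀ | integer p₁ | integer p₂ | integer p₃
  ... | c₀ , refl | c₁ , refl | c₂ , refl | c₃ , refl = span _ _ _ _ (⟪⟫∈ c₀) (⟪⟫∈ c₁) (⟪⟫∈ c₂) (⟪⟫∈ c₃) x≋

  pow-inverse : ∀ {p} → p ∈ elements → ∀ n → ∃ λ r → ℤ_S r × r ℚ.* ⟪ + (p ℕ.^ n) ⟫ ≡ 1ℚ
  pow-inverse p∈S zero    = 1ℚ , 1∈ , refl
  pow-inverse {p} p∈S (suc n) with pow-inverse p∈S n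
  ... | r , r∈ , eq = (+ 1 ℚ./ p) ℚ.* r , *-∈ (1/∈ p∈S) r∈ , (begin
    (1/p ℚ.* r) ℚ.* ⟪ + (p ℕ.* p ℕ.^ n) ⟫              ≡⟨ cong ((1/p ℚ.* r) ℚ.*_) (trans (cong ⟪_⟫ (ℤ.pos-* p (p ℕ.^ n))) (⟪⟫-* (+ p) (+ (p ℕ.^ n)))) ⟩
    (1/p ℚ.* r) ℚ.* (⟪ + p ⟫ ℚ.* ⟪ + (p ℕ.^ n) ⟫)      ≡⟨ solve 4 (λ a b c d → (a :* b) :* (c :* d) := (a :* c) :* (b :* d)) refl 1/p r ⟪ + p ⟫ ⟪ + (p ℕ.^ n) ⟫ ⟩
    (1/p ℚ.* ⟪ + p ⟫) ℚ.* (r ℚ.* ⟪ + (p ℕ.^ n) ⟫)      ≡⟨ cong₂ ℚ._*_ (1/n*n≡1 p) eq ⟩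
    1ℚ ℚ.* 1ℚ                                          ≡⟨⟩
    1ℚ                                                 ∎)
    where
    instance
      p≢0 : ℕ.NonZero p
      p≢0 = prime⇒nonZero (All.lookup prime p∈S)
    1/p = + 1 ℚ./ p
    open ≡-Reasoning
    open ℚ.+-*-Solver

  -- From γ z = pⁿ the element p⁻ⁿ z, which lies in 𝒪_S as p ∈ S, is a right inverse of γ; the norm
  -- argument makes it two-sided.
  divisor-of-power : ∀ {p} → p ∈ elements → ∀ n {γ z} → Hurwitz γ → Hurwitz z → γ · z ≋ ⟪ + (p ℕ.^ n) ⟫ • 1q →
    ∃ λ (u : Γ.Carrier) → proj₁ (Unit.val u) ≋ γ
  divisor-of-power {p} p∈S n {γ} {z} γ∈ z∈ γz =
    let (r , r∈ , r≡) = pow-inverse p∈S n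
        right = begin
          γ · (r • z)                          ≈⟨ ·-• r γ z ⟩
          r • (γ · z)                          ≈⟨ •-congˡ r γz ⟩
          r • ⟪ + (p ℕ.^ n) ⟫ • 1q             ≈⟨ •-assoc r ⟪ + (p ℕ.^ n) ⟫ 1q ⟨
          (r ℚ.* ⟪ + (p ℕ.^ n) ⟫) • 1q         ≈⟨ •-cong 1q r≡ ⟩
          1ℚ • 1q                              ≈⟨ •-identity 1q ⟩
          1q                                   ∎
    in record
      { val = γ , Hurwitz⊆𝒪_S γ∈
      ; inv = r • z , 𝒪-resp (scalar-· r z) (·-∈ (scalar∈ r∈) (Hurwitz⊆𝒪_S z∈))
      ; inverseˡ = inverse-commutes γ (r • z) right
      ; inverseʳ = right
      } , ≋-refl
    where
    open SetoidReasoning (Monoid.setoid ℋ-*-monoid)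
    𝒪-resp : ∀ {x y} → x ≋ y → 𝒪_S x → 𝒪_S y
    𝒪-resp x≋y (span c₀ c₁ c₂ c₃ p₀ p₁ p₂ p₃ x≋) = span c₀ c₁ c₂ c₃ p₀ p₁ p₂ p₃ (≋-trans (≋-sym x≋y) x≋)

-- Assembling the local moves.

module Transitivity (σ : Splittings) (S : FinitePrimeSet) where
  open FinitePrimeSet S
  open SArithmetic S
  open SUnits S
  open Product σ S
  private
    module Γ = Group Γ_S
    module X = Setoid 𝔛_S

  module Local (p : ℕ) (p-prime : Prime p) (p≢2 : p ≢ 2) where
    open PAdic p p-prime
    open PAdicLocalRing p p-prime
    open IntegralGenerators ℚₚ-commutativeRing Integral fromℚ fromℚ-isRingHomomorphism p localRing (σ p p-prime p≢2) public

  module _ {p : ℕ} (p-prime : Prime p) (p≟2 : Dec (p ≡ 2)) where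

    infix 4 _≈ₚ_
    _≈ₚ_ : (v w : Setoid.Carrier (factor p p-prime p≟2)) → Set
    _≈ₚ_ = Setoid._≈_ (factor p p-prime p≟2)

    translate : Γ.Carrier → Setoid.Carrier (factor p p-prime p≟2)
    translate u = Action._▷_ (factorAction p p-prime p≟2) u (base p p-prime p≟2)

  fixes-base : ∀ {q} (q-prime : Prime q) (q≟2 : Dec (q ≡ 2)) {p n γ z} → Prime p → q ≢ p →
    Hurwitz γ → Hurwitz z → γ · z ≋ ⟪ + (p ℕ.^ n) ⟫ • 1q → ∀ u → proj₁ (Unit.val u) ≋ γ →
    _≈ₚ_ q-prime q≟2 (translate q-prime q≟2 u) (base q q-prime q≟2)
  fixes-base q-prime (yes _) _ _ _ _ _ _ _ = refl
  fixes-base {q} q-prime (no q≢2) {p} {n} {γ} {z} p-prime q≢p γ∈ z∈ γz u u≋ =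
    Local.fixes-standard q q-prime q≢2 (+ (p ℕ.^ n))
      (λ d → q≢p (prime∣pow p-prime q-prime n (ℤ.∣⇒∣ᵤ d))) {γ} {z} γ∈ z∈ γz (toℋ* u) u≋

  -- Away from p only the base vertex is required to be fixed; an S-unit that is integral at q with
  -- integral inverse need not fix the other vertices there.
  record LocalMove {p} (p-prime : Prime p) (p≟2 : Dec (p ≡ 2)) (v : Setoid.Carrier (factor p p-prime p≟2)) : Set where
    field
      γ     : Γ.Carrier
      moves : _≈ₚ_ p-prime p≟2 (translate p-prime p≟2 γ) v
      fixes : ∀ {q} (q-prime : Prime q) (q≟2 : Dec (q ≡ 2)) → q ≢ p →
              _≈ₚ_ q-prime q≟2 (translate q-prime q≟2 γ) (base q q-prime q≟2)

  transporter-moves : ∀ {p} (p-prime : Prime p) (p≢2 : p ≢ 2) L (t : Local.Transporter p p-prime p≢2 L) →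
    ∀ u → proj₁ (Unit.val u) ≋ Local.Transporter.γ t → _≈ₚ_ p-prime (no p≢2) (translate p-prime (no p≢2) u) L
  transporter-moves p-prime p≢2 L t u u≋ = Local.Transporter.moves t (toℋ* u) u≋

  unit-move : ∀ {p} (p-prime : Prime p) (p≢2 : p ≢ 2) L (t : Local.Transporter p p-prime p≢2 L) →
    ∀ u → proj₁ (Unit.val u) ≋ Local.Transporter.γ t → LocalMove p-prime (no p≢2) L
  unit-move {p} p-prime p≢2 L t u u≋ = record
    { γ = u
    ; moves = transporter-moves p-prime p≢2 L t u u≋
    ; fixes = λ {q} q-prime q≟2 q≢p → fixes-base q-prime q≟2 {p} {exponent} {γ} {cofactor} p-prime q≢p
        γ∈ cofactor∈ γ·cofactor u u≋
    }
    where
    open Local.Transporter p p-prime p≢2 t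

  transporter-move : ∀ {p} (p-prime : Prime p) → p ∈ elements → (p≢2 : p ≢ 2) → ∀ L →
    Local.Transporter p p-prime p≢2 L → LocalMove p-prime (no p≢2) L
  transporter-move {p} p-prime p∈S p≢2 L t =
    let (u , u≋) = divisor-of-power p∈S exponent {γ} {cofactor} γ∈ cofactor∈ γ·cofactor in unit-move p-prime p≢2 L t u u≋
    where
    open Local.Transporter p p-prime p≢2 t

  opaque
    local-move : ∀ {p} (p-prime : Prime p) → p ∈ elements → (p≟2 : Dec (p ≡ 2)) → ∀ v → LocalMove p-prime p≟2 v
    local-move p-prime p∈S (yes _) _ = record
      { γ = Γ.ε ; moves = refl
      ; fixes = λ {q} q-prime q≟2 _ → Action.▷-identity (factorAction q q-prime q≟2) (base q q-prime q≟2) }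
    local-move {p} p-prime p∈S (no p≢2) L =
      transporter-move p-prime p∈S p≢2 L (Local.transporter p p-prime p≢2 L)

  open Action Γ-action using (_▷_)

  -- Induction on the primes at which v may differ from v₀. If γ moves v₀ to v at p and fixes v₀ at
  -- the other primes, then γ⁻¹ v agrees with v₀ at p and wherever v already did. Its entries at the
  -- primes still in `ps` may change, which is harmless because the induction hypothesis holds for
  -- every vertex.
  transitive-on : ∀ ps → All (_∈ elements) ps → ∀ v →
    (∀ q (q∈S : q ∈ elements) → q ∉ ps → Setoid._≈_ (𝔛ₚ.vertices q q∈S) (v q q∈S) (v₀ q q∈S)) →
    ∃ λ γ → (γ ▷ v₀) X.≈ v
  transitive-on [] _ v v≈v₀ = Γ.ε , λ q q∈S →
    Setoid.trans (𝔛ₚ.vertices q q∈S) (Action.▷-identity (𝔛ₚ.action q q∈S) (v₀ q q∈S))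
      (Setoid.sym (𝔛ₚ.vertices q q∈S) (v≈v₀ q q∈S λ ()))
  transitive-on (p ∷ ps) (p∈S ∷ ps⊆S) v v≈v₀ = γ Γ.∙ proj₁ rest , λ q q∈S →
    let open Action (𝔛ₚ.action q q∈S) renaming (_▷_ to _▷ₚ_)
        open SetoidReasoning (𝔛ₚ.vertices q q∈S)
    in begin
      (γ Γ.∙ proj₁ rest) ▷ₚ v₀ q q∈S          ≈⟨ ▷-assoc γ (proj₁ rest) (v₀ q q∈S) ⟩
      γ ▷ₚ proj₁ rest ▷ₚ v₀ q q∈S             ≈⟨ ▷-cong {γ} {γ} (G.refl {γ}) (proj₂ rest q q∈S) ⟩
      γ ▷ₚ γ Γ.⁻¹ ▷ₚ v q q∈S                  ≈⟨ ▷-assoc γ (γ Γ.⁻¹) (v q q∈S) ⟨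
      (γ Γ.∙ γ Γ.⁻¹) ▷ₚ v q q∈S               ≈⟨ ▷-cong {γ Γ.∙ γ Γ.⁻¹} {Γ.ε} (G.inverseʳ γ) (Setoid.refl (𝔛ₚ.vertices q q∈S)) ⟩
      Γ.ε ▷ₚ v q q∈S                          ≈⟨ ▷-identity (v q q∈S) ⟩
      v q q∈S                                 ∎
    where
    module G = Group Γ̄_S
    open LocalMove (local-move (All.lookup prime p∈S) p∈S (p ℕ.≟ 2) (v p p∈S))
    v′ : X.Carrier
    v′ q q∈S = Action._▷_ (𝔛ₚ.action q q∈S) (γ Γ.⁻¹) (v q q∈S)
    v′≈v₀ : ∀ q (q∈S : q ∈ elements) → q ∉ ps → Setoid._≈_ (𝔛ₚ.vertices q q∈S) (v′ q q∈S) (v₀ q q∈S)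
    v′≈v₀ q q∈S q∉ps with q ℕ.≟ p
    -- A tuple is indexed by proofs of membership as well as by primes; since S has no repetitions,
    -- the two proofs that p lies in S coincide.
    ... | yes refl rewrite unique⇒irrelevant unique q∈S p∈S =
      ActionProperties.▷-adjoint (𝔛ₚ.action p p∈S) γ moves
    ... | no q≢p = ActionProperties.▷-adjoint (𝔛ₚ.action q q∈S) γ
      (Setoid.trans (𝔛ₚ.vertices q q∈S) (fixes (All.lookup prime q∈S) (q ℕ.≟ 2) q≢p)
        (Setoid.sym (𝔛ₚ.vertices q q∈S) (v≈v₀ q q∈S λ { (here q≡p) → q≢p q≡p ; (there q∈ps) → q∉ps q∈ps })))
    rest : ∃ λ δ → (δ ▷ v₀) X.≈ v′
    rest = transitive-on ps ps⊆S v′ v′≈v₀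

  Γ-transitive : TransitiveFrom Γ-action v₀
  Γ-transitive v = transitive-on elements (All.tabulate λ p∈S → p∈S) v
    λ q q∈S q∉S → contradiction q∈S q∉S

theorem2p1 : (σ : Splittings) (S : FinitePrimeSet) →
    TransitiveFrom (Product.Γ-action σ S) (Product.v₀ σ S) ×
    TransitiveFrom (Product.Γ̄-action σ S) (Product.v₀ σ S)
-- The quotient group is the same set of units with a coarser equality, acting by the same map, and
-- transitivity refers only to elements and to the map. One proof therefore serves both actions.
theorem2p1 σ S = Transitivity.Γ-transitive σ S , Transitivity.Γ-transitive σ S
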